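{- Let $q$ be a prime power with $q\equiv 1\pmod 3$. Let $\mathcal{Q}^+(7,q)$ be the hyperbolic quadric of the trace-zero hyperplane $\Pi$ of $\mathrm{PG}(8,q)$, let $\Gamma$ be the thin hexagon in $\Pi$ and let $\pi_x$ be the plane spanned by the two lines of $\Gamma$ through a point $x$ of $\Gamma$ (all as defined in the context). Then the set of points $$\mathcal{O}=\bigcup_{x\in\Gamma}\pi_x ,$$ where $x$ ranges over all points of $\Gamma$, is a $(q^2+q+1)$-ovoid of $\mathcal{Q}^+(7,q)$.
   Context: Let $q\equiv 1\pmod 3$ be a prime power and let $\mathrm{PG}(8,q)$ have homogeneous coordinates $X_1,\dots,X_9$ over the finite field $\mathbb{F}_q$. Identify a $3\times 3$ matrix $M=(m_{ij})$ over $\mathbb{F}_q$ with the vector $\rho(M)=(m_{11},m_{12},m_{13},m_{21},m_{22},m_{23},m_{31},m_{32},m_{33})\in\mathbb{F}_q^9$. Segre variety: $\mathcal{S}_{2,2}$ is the set of $(q^2+q+1)^2$ points of $\mathrm{PG}(8,q)$ represented by $(a_1b_1,a_1b_2,a_1b_3,a_2b_1,a_2b_2,a_2b_3,a_3b_1,a_3b_2,a_3b_3)$ with $a_i,b_i\in\mathbb{F}_q$, $(a_1,a_2,a_3)\neq(0,0,0)$ and $(b_1,b_2,b_3)\ne(0,0,0)$, i.e. the points corresponding to rank-one matrices. Quadrics: $\mathcal{Q}(8,q)$ is the parabolic quadric $X_2X_4-X_1X_5+X_3X_7-X_1X_9+X_6X_8-X_5X_9=0$; it contains $\mathcal{S}_{2,2}$.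 $\Pi$ is the hyperplane $X_1+X_5+X_9=0$ (trace-zero matrices), a copy of $\mathrm{PG}(7,q)$. Since $q\equiv1\pmod3$, $\Pi\cap\mathcal{Q}(8,q)$ is a hyperbolic quadric, denoted $\mathcal{Q}^+(7,q)$. Hexagon: $\Gamma$ is the point-line geometry whose points are the $(q+1)(q^2+q+1)$ points of $\Pi\cap\mathcal{S}_{2,2}$ and whose lines are the $2(q^2+q+1)$ projective lines contained in $\Pi\cap\mathcal{S}_{2,2}$; it is a thin generalized hexagon (of order $(q,1)$), isomorphic to the point-line flag geometry of $\mathrm{PG}(2,q)$. Through each point $x$ of $\Gamma$ there pass exactly two lines of $\Gamma$; they span a plane, denoted $\pi_x$, which is contained in $\mathcal{Q}^+(7,q)$. Definition of $m$-ovoid: let $\mathcal{P}$ be the point set of a hyperbolic quadric $\mathcal{Q}^+(2r-1,q)$. A subset $\mathcal{M}\subseteq\mathcal{P}$ is an $m$-ovoid ($m>0$ an integer) if for every $P\in\mathcal{P}$, $$|P^\perp\cap\mathcal{M}|=\begin{cases} m\theta_{r-1}-\theta_{r-1}+1, & P\in\mathcal{M},\\ m\theta_{r-1}, & P\notin\mathcal{M},\end{cases}$$ where $\theta_r=q^{r-1}+1$ (so $\theta_{r-1}=q^{r-2}+1$) and $P^\perp$ is the set of points of $\mathcal{Q}^+(2r-1,q)$ collinear with $P$ (including $P$ itself), i.e. the points of the quadric lying in the polar hyperplane of $P$. Here $r=4$. -}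

module Defs where

open import Algebra.Bundles using (CommutativeRing)
import Algebra.Definitions.RawMonoid as RawMonoidDefs
open import Data.Fin.Base using (Fin; combine)
open import Data.Fin using (#_)
open import Data.Nat.Base as ℕ using (ℕ; suc; _∸_; _^_)
open import Data.Nat.Primality using (Prime)
open import Data.Product.Base using (Σ; Σ-syntax; ∃; ∃-syntax; ∃₂; _×_; _,_; proj₁; proj₂)
open import Data.Vec.Functional using (Vector; []; _∷_; _++_)
open import Function.Bundles using (Inverse; _⇔_)
open import Level using (Level; _⊔_) renaming (suc to lsuc)
open import Relation.Binary.Bundles using (Setoid)
open import Relation.Binary.Core using (Rel)
import Relation.Binary.Construct.On as On
import Relation.Binary.PropositionalEquality as ≡
open ≡ using (_≡_)
open import Relation.Nullary.Negation.Core using (¬_)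
open import Relation.Unary using (Pred; _∈_; _∉_; _⊆_; _∩_; _≐_)

PrimePower : ℕ → Set
PrimePower q = ∃₂ λ p k → Prime p × q ≡ p ^ suc k

HasCardinality : ∀ {a ℓ} → Setoid a ℓ → ℕ → Set (a ⊔ ℓ)
HasCardinality S n = Inverse S (≡.setoid (Fin n))

record FiniteField (c ℓ : Level) (q : ℕ) : Set (lsuc (c ⊔ ℓ)) where
  field
    commutativeRing : CommutativeRing c ℓ
  open CommutativeRing commutativeRing public
  field
    1≉0         : ¬ (1# ≈ 0#)
    inverse     : ∀ x → ¬ (x ≈ 0#) → ∃[ y ] x * y ≈ 1#
    cardinality : HasCardinality setoid q

-- θ s = q^(s-1) + 1; only used for s ≥ 1, where ∸ does not truncate.
θ : ℕ → ℕ → ℕ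
θ q s = q ^ (s ∸ 1) ℕ.+ 1

module _ {c ℓ : Level} {q : ℕ} (F : FiniteField c ℓ q) where

  open FiniteField F
  open RawMonoidDefs +-rawMonoid using (sum)

  private
    variable
      k n : ℕ
      p m : Level

  linComb : Vector Carrier k → Vector (Vector Carrier n) k → Vector Carrier n
  linComb a v i = sum λ j → a j * v j i

  LinearlyIndependent : Vector (Vector Carrier n) k → Set (c ⊔ ℓ)
  LinearlyIndependent v = ∀ a → (∀ i → linComb a v i ≈ 0#) → ∀ j → a j ≈ 0#

  -- Points of PG(n,q) are nonzero vectors, compared by _∼_.
  record Point (n : ℕ) : Set (c ⊔ ℓ) where
    field
      coord   : Vector Carrier (suc n)
      nonzero : ¬ (∀ i → coord i ≈ 0#)

  open Point

  infix 4 _∼_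

  _∼_ : Rel (Point n) (c ⊔ ℓ)
  P ∼ R = ∃[ t ] (¬ (t ≈ 0#)) × (∀ i → coord P i ≈ t * coord R i)

  inverse-nonzero : ∀ {t s} → t * s ≈ 1# → ¬ (s ≈ 0#)
  inverse-nonzero {t} ts≈1 s≈0 =
    1≉0 (trans (sym ts≈1) (trans (*-congˡ s≈0) (zeroʳ t)))

  unscale : ∀ {t s x y} → t * s ≈ 1# → x ≈ t * y → y ≈ s * x
  unscale {t} {s} {x} {y} ts≈1 x≈ty = sym
    (trans (*-congˡ x≈ty)
    (trans (sym (*-assoc s t y))
    (trans (*-congʳ (trans (*-comm s t) ts≈1)) (*-identityˡ y))))

  ∼-refl : {P : Point n} → P ∼ P
  ∼-refl = 1# , 1≉0 , λ i → sym (*-identityˡ _)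

  ∼-sym : {P R : Point n} → P ∼ R → R ∼ P
  ∼-sym (t , t≉0 , eq) with inverse t t≉0
  ... | s , ts≈1 = s , inverse-nonzero ts≈1 , λ i → unscale ts≈1 (eq i)

  ∼-trans : {P R S : Point n} → P ∼ R → R ∼ S → P ∼ S
  ∼-trans {P = P} (t , _ , eq) (s , _ , eq′) = t * s , ts≉0 , scaled
    where
    scaled : ∀ i → coord P i ≈ t * s * _
    scaled i = trans (eq i) (trans (*-congˡ (eq′ i)) (sym (*-assoc t s _)))
    ts≉0 : ¬ (t * s ≈ 0#)
    ts≉0 ts≈0 = nonzero P λ i → trans (scaled i) (trans (*-congʳ ts≈0) (zeroˡ _))

  PG : ℕ → Setoid (c ⊔ ℓ) (c ⊔ ℓ)
  PG n = record
    { Carrier       = Point n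
    ; _≈_           = _∼_
    ; isEquivalence = record
        { refl  = λ {P} → ∼-refl {P = P}
        ; sym   = λ {P} {R} → ∼-sym {P = P} {R}
        ; trans = λ {P} {R} {S} → ∼-trans {P = P} {R} {S}
        }
    }

  -- The number of projective points in S: membership proofs are not
  -- compared, only the underlying points.
  HasSize : Pred (Point n) p → ℕ → Set (c ⊔ ℓ ⊔ p)
  HasSize {n = n} S = HasCardinality (On.setoid {B = Σ (Point n) S} (PG n) proj₁)

  Span : Vector (Point n) k → Pred (Point n) (c ⊔ ℓ)
  Span Ps R = ∃[ a ] (∀ i → coord R i ≈ linComb a (λ j → coord (Ps j)) i)

  record Line (n : ℕ) : Set (c ⊔ ℓ) where
    field
      pt₁ pt₂  : Point n
      distinct : ¬ (pt₁ ∼ pt₂)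

  open Line

  pointsOf : Line n → Pred (Point n) (c ⊔ ℓ)
  pointsOf l = Span (pt₁ l ∷ pt₂ l ∷ [])

  -- 𝒫 is a copy of Q⁺(2r-1,q): in suitable coordinates (x , y) on a
  -- 2r-dimensional subspace it is the quadric x₁y₁ + … + x_r y_r = 0.
  IsHyperbolicQuadric : ℕ → Pred (Point n) p → Set (c ⊔ ℓ ⊔ p)
  IsHyperbolicQuadric {n = n} r 𝒫 =
    Σ[ b ∈ Vector (Vector Carrier (suc n)) (r ℕ.+ r) ]
      LinearlyIndependent b ×
      (∀ P → (P ∈ 𝒫) ⇔
        (Σ[ x ∈ Vector Carrier r ] Σ[ y ∈ Vector Carrier r ]
          (∀ i → coord P i ≈ linComb (x ++ y) b i) ×
          sum (λ j → x j * y j) ≈ 0#))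

  -- P ^⊥[ 𝒫 ]: the points of 𝒫 collinear with P in 𝒫. For R ∼ P the span
  -- is the single point P, so P itself is included.
  _^⊥[_] : Point n → Pred (Point n) p → Pred (Point n) (c ⊔ ℓ ⊔ p)
  (P ^⊥[ 𝒫 ]) R = R ∈ 𝒫 × Span (P ∷ R ∷ []) ⊆ 𝒫

  record IsOvoid (r μ : ℕ) (𝒫 : Pred (Point n) p) (ℳ : Pred (Point n) m)
                 : Set (c ⊔ ℓ ⊔ p ⊔ m) where
    field
      hyperbolic : IsHyperbolicQuadric r 𝒫
      positive   : 0 ℕ.< μ
      subset     : ℳ ⊆ 𝒫
      inside     : ∀ P → P ∈ 𝒫 → P ∈ ℳ →
                   HasSize (P ^⊥[ 𝒫 ] ∩ ℳ)
                     (μ ℕ.* θ q (r ∸ 1) ∸ θ q (r ∸ 1) ℕ.+ 1)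
      outside    : ∀ P → P ∈ 𝒫 → P ∉ ℳ →
                   HasSize (P ^⊥[ 𝒫 ] ∩ ℳ) (μ ℕ.* θ q (r ∸ 1))

  -- `combine i j` is the row-major position of the matrix entry (i , j).
  Segre : Pred (Point 8) (c ⊔ ℓ)
  Segre P =
    Σ[ a ∈ Vector Carrier 3 ] Σ[ b ∈ Vector Carrier 3 ]
      (¬ (∀ i → a i ≈ 0#)) × (¬ (∀ j → b j ≈ 0#)) ×
      (∀ i j → coord P (combine i j) ≈ a i * b j)

  X₁ X₂ X₃ X₄ X₅ X₆ X₇ X₈ X₉ : Point 8 → Carrier
  X₁ P = coord P (# 0)
  X₂ P = coord P (# 1)
  X₃ P = coord P (# 2)
  X₄ P = coord P (# 3)
  X₅ P = coord P (# 4)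
  X₆ P = coord P (# 5)
  X₇ P = coord P (# 6)
  X₈ P = coord P (# 7)
  X₉ P = coord P (# 8)

  Q₈ : Pred (Point 8) ℓ
  Q₈ P = X₂ P * X₄ P - X₁ P * X₅ P + X₃ P * X₇ P
       - X₁ P * X₉ P + X₆ P * X₈ P - X₅ P * X₉ P ≈ 0#

  Π : Pred (Point 8) ℓ
  Π P = X₁ P + X₅ P + X₉ P ≈ 0#

  Q⁺₇ : Pred (Point 8) ℓ
  Q⁺₇ = Π ∩ Q₈

  ΓPoint : Pred (Point 8) (c ⊔ ℓ)
  ΓPoint = Π ∩ Segre

  ΓLine : Pred (Line 8) (c ⊔ ℓ)
  ΓLine l = pointsOf l ⊆ ΓPoint

  π : Point 8 → Pred (Point 8) (c ⊔ ℓ)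
  π x P = ∃₂ λ l l′ →
    (ΓLine l × x ∈ pointsOf l) × (ΓLine l′ × x ∈ pointsOf l′) ×
    ¬ (pointsOf l ≐ pointsOf l′) ×
    P ∈ Span (pt₁ l ∷ pt₂ l ∷ pt₁ l′ ∷ pt₂ l′ ∷ [])

  𝒪 : Pred (Point 8) (c ⊔ ℓ)
  𝒪 P = ∃[ x ] x ∈ ΓPoint × P ∈ π x

{-# OPTIONS --safe #-}
module Submission where

-- A point of Q⁺(7,q) is a 3×3 matrix P with tr P = 0 and vanishing second invariant, hence with
-- characteristic polynomial x³ - det P, and the polar form of the quadric is tr (P N).  The planes π_x
-- sweep out exactly the nilpotent matrices.
--
-- To count the nilpotent N with tr (P N) = 0, sum over the points a of PG(2,q).  For N nilpotent,
--   #{a : N a = 0} + q³ [N = 0] = 1 + q #{a : N a = 0 and im N ⊆ ⟨a⟩},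
-- so the count is a sum over a of contributions of matrices killing a.  Such an N is a nilpotent 2×2
-- block on the quotient by a together with a linear form, and tr (P N) is linear in the latter: the
-- contribution of a depends only on whether a is an eigenvector of P, and in that case on the section
-- of the cone x² + y z = 0 by a plane.  If det P ≠ 0 that plane always meets the cone in two lines,
-- because -3 is a square (q ≡ 1 mod 3), and every a contributes the same amount.  If det P = 0, the
-- deviation from this amount is evaluated by the displayed identity applied to P itself.

open import Algebra.Bundles using (CommutativeRing; RawRing)
open import Algebra.Structures using (IsCommutativeRing)
open import Data.Empty using (⊥; ⊥-elim)
open import Data.Fin.Base using (Fin)
open import Data.Nat.Base using (ℕ)
open import Data.Product.Base using (Σ; ∃; ∃₂; _×_; _,_; proj₁; proj₂)
open import Data.Sum.Base using (_⊎_; inj₁; inj₂; [_,_]′)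
open import Defs
open import Function.Base using (_∘_)
open import Function.Bundles using (mk⇔)
open import Level using (Level; 0ℓ; _⊔_)
open import Relation.Nullary using (Dec; yes; no; ¬_)
open import Relation.Nullary.Decidable using (_×-dec_; ¬?)
import Relation.Binary.PropositionalEquality as ≡
open ≡ using (_≡_; _≢_)

-- Vectors are counted rather than points: if `T` nilpotent matrices lie in the hyperplane and
-- represent `n` points, then `T - 1 = (q - 1) n`. A ray contributes its kernel count minus `q`
-- times its image count, which is `q^3 - q^2` in the generic case, so `T = q^3 + (q^2 + q + 1)(q^3
-- - q^2) = q^5 + q^3 - q^2` when `det
-- P` is nonzero. For nilpotent `P` a kernel ray deviates from this by `-(q^3 -
-- q^2)`, and by a further `q^4 - q^3` if it also contains the image. By the displayed identity
-- these corrections add up to `-(q^3 - q^2)` for every nonzero `P`, so ranks one and two are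
-- counted together and `T = q^5`. All equations are arranged so that both sides are sums of natural
-- numbers. The field comes as a setoid with an abstract equality. Its cardinality carries it over
-- to `Fin q`, where equality is propositional and decidable and sums over tuples make sense. The
-- primitive cube root of unity comes from counting, modulo 3, the fixed points of a map of order
-- three.

-- Finite sums of natural numbers.

module FiniteSums where

  open import Data.Fin.Base using (zero; suc)
  import Data.Fin.Properties as Fin
  open import Data.List.Base using (List; []; _∷_; length; lookup; filter; map; _++_; cartesianProduct; allFin)
  open import Data.List.Membership.Propositional using () renaming (_∈_ to _∈ᴸ_)
  open import Data.List.Membership.Propositional.Properties
    using (∈-cartesianProduct⁺; ∈-allFin; ∈-filter⁺; ∈-filter⁻; ∈-lookup; ∈-map⁺; ∈-map⁻; ∈-++⁺ˡ; ∈-++⁺ʳ)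
  import Data.List.Properties as List
  import Data.List.Relation.Unary.All as All
  open import Data.List.Relation.Unary.AllPairs using (_∷_)
  open import Data.List.Relation.Unary.Any as Any using (here; there)
  open import Data.List.Relation.Unary.Any.Properties using (lookup-index)
  open import Data.List.Relation.Unary.Unique.Propositional using (Unique)
  import Data.List.Relation.Unary.Unique.Propositional.Properties as Unique
  open import Data.Nat.Base using (zero; suc; _+_; _*_)
  open import Data.Nat.Properties hiding (_≟_)
  open import Data.Nat.Solver using (module +-*-Solver)
  open import Data.Product.Properties using (≡-dec)
  import Data.Sum.Properties as Sum
  open Sum using (inj₁-injective; inj₂-injective)
  open import Relation.Binary.Definitions using (DecidableEquality)
  open ≡
  open ≡-Reasoning

  -- The Iverson bracket, through which the counts below are expressed as sums.
  ι : ∀ {p} {P : Set p} → Dec P → ℕ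
  ι (yes _) = 1
  ι (no _)  = 0

  module _ {p} {P : Set p} where
    ι-yes : (P? : Dec P) → P → ι P? ≡ 1
    ι-yes (yes _) _ = refl
    ι-yes (no ¬p) p = ⊥-elim (¬p p)

    ι-no : (P? : Dec P) → ¬ P → ι P? ≡ 0
    ι-no (yes p) ¬p = ⊥-elim (¬p p)
    ι-no (no _)  _  = refl

    -- An equation under an indicator needs proof only where the condition holds. This is how
    -- hypotheses such as nilpotency enter a sum over all matrices.
    ι-case : (P? : Dec P) → ∀ {m n} → (P → m ≡ n) → ι P? * m ≡ ι P? * n
    ι-case (yes p) h = cong (1 *_) (h p)
    ι-case (no _)  _ = refl

  ι-cong : ∀ {p r} {P : Set p} {R : Set r} (P? : Dec P) (R? : Dec R) →
           (P → R) → (R → P) → ι P? ≡ ι R?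
  ι-cong (yes p) R? f _ = sym (ι-yes R? (f p))
  ι-cong (no ¬p) R? _ g = sym (ι-no R? (¬p ∘ g))

  ι-× : ∀ {p r} {P : Set p} {R : Set r} (P? : Dec P) (R? : Dec R) →
        ι (P? ×-dec R?) ≡ ι P? * ι R?
  ι-× (yes _) (yes _) = refl
  ι-× (yes _) (no _)  = refl
  ι-× (no _)  _       = refl

  module _ {a} {A : Set a} where

    ∑ᴸ : List A → (A → ℕ) → ℕ
    ∑ᴸ []       f = 0
    ∑ᴸ (x ∷ xs) f = f x + ∑ᴸ xs f

    ∑ᴸ-cong : ∀ xs {f g : A → ℕ} → (∀ x → f x ≡ g x) → ∑ᴸ xs f ≡ ∑ᴸ xs g
    ∑ᴸ-cong []       h = refl
    ∑ᴸ-cong (x ∷ xs) h = cong₂ _+_ (h x) (∑ᴸ-cong xs h)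

    ∑ᴸ-+ : ∀ xs (f g : A → ℕ) → ∑ᴸ xs (λ x → f x + g x) ≡ ∑ᴸ xs f + ∑ᴸ xs g
    ∑ᴸ-+ []       f g = refl
    ∑ᴸ-+ (x ∷ xs) f g = trans (cong (f x + g x +_) (∑ᴸ-+ xs f g))
      (solve 4 (λ a b c d → a :+ b :+ (c :+ d) := a :+ c :+ (b :+ d)) refl (f x) (g x) (∑ᴸ xs f) (∑ᴸ xs g))
      where open +-*-Solver

    ∑ᴸ-*ˡ : ∀ xs k (f : A → ℕ) → ∑ᴸ xs (λ x → k * f x) ≡ k * ∑ᴸ xs f
    ∑ᴸ-*ˡ []       k f = sym (*-zeroʳ k)
    ∑ᴸ-*ˡ (x ∷ xs) k f = trans (cong (k * f x +_) (∑ᴸ-*ˡ xs k f)) (sym (*-distribˡ-+ k (f x) _))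

    ∑ᴸ-zero : ∀ xs {f : A → ℕ} → (∀ {x} → x ∈ᴸ xs → f x ≡ 0) → ∑ᴸ xs f ≡ 0
    ∑ᴸ-zero []       h = refl
    ∑ᴸ-zero (x ∷ xs) h = cong₂ _+_ (h (here refl)) (∑ᴸ-zero xs (h ∘ there))

    ∑ᴸ-const : ∀ xs k → ∑ᴸ xs (λ _ → k) ≡ length xs * k
    ∑ᴸ-const []       k = refl
    ∑ᴸ-const (x ∷ xs) k = cong (k +_) (∑ᴸ-const xs k)

    ∑ᴸ-filter : ∀ {p} {P : A → Set p} (P? : ∀ x → Dec (P x)) xs →
                ∑ᴸ xs (λ x → ι (P? x)) ≡ length (filter P? xs)
    ∑ᴸ-filter P? []       = refl
    ∑ᴸ-filter P? (x ∷ xs) with P? x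
    ... | yes _ = cong suc (∑ᴸ-filter P? xs)
    ... | no _  = ∑ᴸ-filter P? xs

    ∑ᴸ-nonzero : ∀ xs (f : A → ℕ) → ∑ᴸ xs f ≢ 0 → ∃ λ x → f x ≢ 0
    ∑ᴸ-nonzero []       f h = ⊥-elim (h refl)
    ∑ᴸ-nonzero (x ∷ xs) f h with f x in eq
    ... | zero  = ∑ᴸ-nonzero xs f h
    ... | suc n = x , λ fx≡0 → 1+n≢0 (trans (sym eq) fx≡0)

    lookup-injective : ∀ {xs : List A} → Unique xs → ∀ i j → lookup xs i ≡ lookup xs j → i ≡ j
    lookup-injective (_ ∷ _)  zero    zero    _  = refl
    lookup-injective (x∉ ∷ _) zero    (suc j) eq = ⊥-elim (All.lookup x∉ (∈-lookup j) eq)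
    lookup-injective (x∉ ∷ _) (suc i) zero    eq = ⊥-elim (All.lookup x∉ (∈-lookup i) (sym eq))
    lookup-injective (_ ∷ u)  (suc i) (suc j) eq = cong suc (lookup-injective u i j eq)

  ∑ᴸ-comm : ∀ {a b} {A : Set a} {B : Set b} (xs : List A) (ys : List B) (f : A → B → ℕ) →
            ∑ᴸ xs (λ x → ∑ᴸ ys (f x)) ≡ ∑ᴸ ys (λ y → ∑ᴸ xs (λ x → f x y))
  ∑ᴸ-comm []       ys f = sym (∑ᴸ-zero ys (λ _ → refl))
  ∑ᴸ-comm (x ∷ xs) ys f = trans (cong (∑ᴸ ys (f x) +_) (∑ᴸ-comm xs ys f))
                                (sym (∑ᴸ-+ ys (f x) _))

  ∑ᴸ-++-map : ∀ {a b} {A : Set a} {B : Set b} (g : A → B) xs ys (f : B → ℕ) →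
              ∑ᴸ (map g xs ++ ys) f ≡ ∑ᴸ xs (λ x → f (g x)) + ∑ᴸ ys f
  ∑ᴸ-++-map g []       ys f = refl
  ∑ᴸ-++-map g (x ∷ xs) ys f = trans (cong (f (g x) +_) (∑ᴸ-++-map g xs ys f)) (sym (+-assoc (f (g x)) _ _))

  ∑ᴸ-cartesianProduct : ∀ {a b} {A : Set a} {B : Set b} (xs : List A) (ys : List B) (f : A × B → ℕ) →
                        ∑ᴸ (cartesianProduct xs ys) f ≡ ∑ᴸ xs (λ x → ∑ᴸ ys (λ y → f (x , y)))
  ∑ᴸ-cartesianProduct []       ys f = refl
  ∑ᴸ-cartesianProduct (x ∷ xs) ys f = trans (∑ᴸ-++-map (x ,_) ys _ f)
    (cong (∑ᴸ ys (λ y → f (x , y)) +_) (∑ᴸ-cartesianProduct xs ys f))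

  -- A repetition-free list makes sums plain recursion, and products and disjoint unions inherit the
  -- structure by instance search.
  record Finite {a} (A : Set a) : Set a where
    infix 4 _≟_
    field
      elements : List A
      unique   : Unique elements
      complete : ∀ x → x ∈ᴸ elements
      _≟_      : DecidableEquality A

  open Finite {{...}} public using (_≟_)
  open Finite using (elements; unique; complete)

  instance
    finite-Fin : ∀ {n} → Finite (Fin n)
    finite-Fin {n} = record
      { elements = allFin n ; unique = Unique.allFin⁺ n ; complete = ∈-allFin ; _≟_ = Fin._≟_ }

    finite-⊎ : ∀ {a b} {A : Set a} {B : Set b} {{_ : Finite A}} {{_ : Finite B}} → Finite (A ⊎ B)
    finite-⊎ {{FA}} {{FB}} = record
      { elements = map inj₁ (elements FA) ++ map inj₂ (elements FB)
      ; unique   = Unique.++⁺ (Unique.map⁺ inj₁-injective (unique FA)) (Unique.map⁺ inj₂-injective (unique FB))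
                     (λ (p , p′) → disjoint (∈-map⁻ inj₁ p) (∈-map⁻ inj₂ p′))
      ; complete = λ { (inj₁ x) → ∈-++⁺ˡ (∈-map⁺ inj₁ (complete FA x))
                     ; (inj₂ y) → ∈-++⁺ʳ _ (∈-map⁺ inj₂ (complete FB y)) }
      ; _≟_      = Sum.≡-dec _≟_ _≟_
      }
      where
      disjoint : ∀ {z} → (∃ λ x → x ∈ᴸ elements FA × z ≡ inj₁ x) → (∃ λ y → y ∈ᴸ elements FB × z ≡ inj₂ y) → ⊥
      disjoint (_ , _ , refl) (_ , _ , ())

    finite-× : ∀ {a b} {A : Set a} {B : Set b} {{_ : Finite A}} {{_ : Finite B}} → Finite (A × B)
    finite-× {{FA}} {{FB}} = record
      { elements = cartesianProduct (elements FA) (elements FB)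
      ; unique   = Unique.cartesianProduct⁺ (unique FA) (unique FB)
      ; complete = λ (x , y) → ∈-cartesianProduct⁺ (complete FA x) (complete FB y)
      ; _≟_      = ≡-dec _≟_ _≟_
      }

  opaque
    -- Opaque, so that conversion checking does not unfold sums over matrices; the lemmas that
    -- unfold it serve as its interface.
    ∑ : ∀ {a} {A : Set a} {{_ : Finite A}} → (A → ℕ) → ℕ
    ∑ {{FA}} = ∑ᴸ (elements FA)

  card : ∀ {a} (A : Set a) {{_ : Finite A}} → ℕ
  card A = ∑ {A = A} (λ _ → 1)

  module _ {a} {A : Set a} {{FA : Finite A}} where

    opaque
      unfolding ∑

      ∑-cong : {f g : A → ℕ} → (∀ x → f x ≡ g x) → ∑ f ≡ ∑ g
      ∑-cong = ∑ᴸ-cong (elements FA)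

      ∑-+ : (f g : A → ℕ) → ∑ (λ x → f x + g x) ≡ ∑ f + ∑ g
      ∑-+ = ∑ᴸ-+ (elements FA)

      ∑-*ˡ : ∀ k (f : A → ℕ) → ∑ (λ x → k * f x) ≡ k * ∑ f
      ∑-*ˡ = ∑ᴸ-*ˡ (elements FA)

      ∑-zero : {f : A → ℕ} → (∀ x → f x ≡ 0) → ∑ f ≡ 0
      ∑-zero h = ∑ᴸ-zero (elements FA) (λ {x} _ → h x)

      ∑-nonzero : (f : A → ℕ) → ∑ f ≢ 0 → ∃ λ x → f x ≢ 0
      ∑-nonzero = ∑ᴸ-nonzero (elements FA)

      ∑-δ : ∀ a (f : A → ℕ) → ∑ (λ x → ι (x ≟ a) * f x) ≡ f a
      ∑-δ a f = go (unique FA) (complete FA a)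
        where
        go : ∀ {xs} → Unique xs → a ∈ᴸ xs → ∑ᴸ xs (λ x → ι (x ≟ a) * f x) ≡ f a
        go {_ ∷ xs} (x∉ ∷ _) (here refl) = begin
          ι (a ≟ a) * f a + ∑ᴸ xs (λ x → ι (x ≟ a) * f x)
            ≡⟨ cong₂ (λ i s → i * f a + s) (ι-yes (a ≟ a) refl)
                 (∑ᴸ-zero xs (λ {x} x∈ → cong (_* f x) (ι-no (x ≟ a) (λ x≡a → All.lookup x∉ x∈ (sym x≡a))))) ⟩
          1 * f a + 0   ≡⟨ +-identityʳ _ ⟩
          1 * f a       ≡⟨ *-identityˡ _ ⟩
          f a           ∎
        go {x ∷ xs} (x∉ ∷ u) (there a∈) = begin
          ι (x ≟ a) * f x + ∑ᴸ xs (λ x → ι (x ≟ a) * f x)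
            ≡⟨ cong₂ (λ i s → i * f x + s) (ι-no (x ≟ a) (All.lookup x∉ a∈)) (go u a∈) ⟩
          f a ∎

    ∑-*ʳ : ∀ (f : A → ℕ) k → ∑ (λ x → f x * k) ≡ ∑ f * k
    ∑-*ʳ f k = trans (∑-cong (λ x → *-comm (f x) k)) (trans (∑-*ˡ k f) (*-comm k _))

    ∑-const : ∀ k → ∑ {A = A} (λ _ → k) ≡ card A * k
    ∑-const k = trans (∑-cong (λ _ → sym (*-identityˡ k))) (∑-*ʳ (λ _ → 1) k)

    ∑-ι-point : ∀ a → ∑ {A = A} (λ x → ι (x ≟ a)) ≡ 1
    ∑-ι-point a = trans (∑-cong (λ x → sym (*-identityʳ _))) (∑-δ a (λ _ → 1))

    module _ {p} {P : A → Set p} (P? : ∀ x → Dec (P x)) where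

      ∑-ι-unique : ∀ a → P a → (∀ x → P x → x ≡ a) → ∑ (λ x → ι (P? x)) ≡ 1
      ∑-ι-unique a Pa unique = trans
        (∑-cong (λ x → ι-cong (P? x) (x ≟ a) (unique x) (λ { refl → Pa }))) (∑-ι-point a)

      ∑-ι-none : (∀ x → ¬ P x) → ∑ (λ x → ι (P? x)) ≡ 0
      ∑-ι-none ¬P = ∑-zero (λ x → ι-no (P? x) (¬P x))

      ∑-ι-all : (∀ x → P x) → ∑ (λ x → ι (P? x)) ≡ card A
      ∑-ι-all all = ∑-cong (λ x → ι-yes (P? x) (all x))

  module _ {a b} {A : Set a} {B : Set b} {{FA : Finite A}} {{FB : Finite B}} where

    opaque
      unfolding ∑

      ∑-comm : (f : A → B → ℕ) → ∑ (λ x → ∑ (f x)) ≡ ∑ (λ y → ∑ (λ x → f x y))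
      ∑-comm = ∑ᴸ-comm (elements FA) (elements FB)

    -- The graph of `to` is summed in both orders: each `y` lies under exactly one `x`, and each `x`
    -- satisfying `P` over exactly one `y`.
    ∑-param : ∀ {p} {P : A → Set p} (P? : ∀ x → Dec (P x)) (to : B → A) (from : A → B) →
              (∀ y → P (to y)) → (∀ y → from (to y) ≡ y) → (∀ x → P x → to (from x) ≡ x) →
              (f : A → ℕ) → ∑ (λ x → ι (P? x) * f x) ≡ ∑ (λ y → f (to y))
    ∑-param {P = P} P? to from P-to from-to to-from f = begin
      ∑ (λ x → ι (P? x) * f x)
        ≡⟨ ∑-cong (λ x → sym (trans (∑-cong (λ y → point x y))
                             (∑-δ (from x) (λ y → ι (P? x) * f x)))) ⟩
      ∑ (λ x → ∑ (λ y → ι (x ≟ to y) * f x))   ≡⟨ ∑-comm _ ⟩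
      ∑ (λ y → ∑ (λ x → ι (x ≟ to y) * f x))   ≡⟨ ∑-cong (λ y → ∑-δ (to y) f) ⟩
      ∑ (λ y → f (to y))                       ∎
      where
      point : ∀ x y → ι (x ≟ to y) * f x ≡ ι (y ≟ from x) * (ι (P? x) * f x)
      point x y = begin
        ι (x ≟ to y) * f x                     ≡⟨ cong (_* f x) (ι-cong (x ≟ to y) ((y ≟ from x) ×-dec P? x)
                                                    (λ { refl → sym (from-to y) , P-to y })
                                                    (λ { (refl , p) → sym (to-from x p) })) ⟩
        ι ((y ≟ from x) ×-dec P? x) * f x      ≡⟨ cong (_* f x) (ι-× (y ≟ from x) (P? x)) ⟩
        ι (y ≟ from x) * ι (P? x) * f x        ≡⟨ *-assoc (ι (y ≟ from x)) _ _ ⟩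
        ι (y ≟ from x) * (ι (P? x) * f x)      ∎

    -- The subset is the whole type here; the always true equation `from x ≟ from x` plays the part
    -- of its membership test.
    ∑-reindex : (to : B → A) (from : A → B) →
                (∀ y → from (to y) ≡ y) → (∀ x → to (from x) ≡ x) →
                (f : A → ℕ) → ∑ f ≡ ∑ (λ y → f (to y))
    ∑-reindex to from from-to to-from f = trans
      (∑-cong (λ x → sym (trans (cong (_* f x) (ι-yes (from x ≟ from x) refl)) (*-identityˡ _))))
      (∑-param (λ x → from x ≟ from x) to from (λ _ → refl) from-to (λ x _ → to-from x) f)

    opaque
      unfolding ∑

      ∑-× : (f : A × B → ℕ) → ∑ f ≡ ∑ (λ x → ∑ (λ y → f (x , y)))
      ∑-× = ∑ᴸ-cartesianProduct (elements FA) (elements FB)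

  module _ {a b} {A : Set a} {B : Set b} {{FA : Finite A}} {{FB : Finite B}} where

    opaque
      unfolding ∑

      ∑-⊎ : (f : A ⊎ B → ℕ) → ∑ f ≡ ∑ (λ x → f (inj₁ x)) + ∑ (λ y → f (inj₂ y))
      ∑-⊎ f = trans (∑ᴸ-++-map inj₁ (elements FA) _ f) (cong (∑ (λ x → f (inj₁ x)) +_)
        (trans (cong (λ ys → ∑ᴸ ys f) (sym (List.++-identityʳ (map inj₂ (elements FB)))))
        (trans (∑ᴸ-++-map inj₂ (elements FB) [] f) (+-identityʳ _))))

  opaque
    unfolding ∑

    ∑-Fin₁ : (f : Fin 1 → ℕ) → ∑ f ≡ f zero
    ∑-Fin₁ f = +-identityʳ (f zero)

    card-Fin : ∀ n → card (Fin n) ≡ n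
    card-Fin n = trans (∑ᴸ-const (allFin n) 1) (trans (*-identityʳ _) (List.length-tabulate {n = n} (λ i → i)))

  card-× : ∀ {a b} {A : Set a} {B : Set b} {{_ : Finite A}} {{_ : Finite B}} →
           card (A × B) ≡ card A * card B
  card-× {A = A} {B = B} = trans (∑-× {A = A} {B = B} (λ _ → 1)) (∑-const {A = A} (card B))

  -- Links a sum of indicators to the bijection demanded by `HasSize`. Although `index` takes a
  -- membership proof, `at-injective` and `at-index` make its value depend on the element alone.
  record Enumeration {a p} {A : Set a} (P : A → Set p) (n : ℕ) : Set (a ⊔ p) where
    field
      at           : Fin n → A
      at-∈         : ∀ i → P (at i)
      at-injective : ∀ i j → at i ≡ at j → i ≡ j
      index        : ∀ x → P x → Fin n
      at-index     : ∀ x (p : P x) → at (index x p) ≡ x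

  opaque
    unfolding ∑

    enumeration : ∀ {a p} {A : Set a} {{_ : Finite A}} {P : A → Set p} (P? : ∀ x → Dec (P x)) →
                  Enumeration P (∑ (λ x → ι (P? x)))
    enumeration {A = A} {{FA}} {P = P} P? = subst (Enumeration P) (sym (∑ᴸ-filter P? (elements FA))) (record
      { at           = lookup xs
      ; at-∈         = λ i → proj₂ (∈-filter⁻ P? {xs = elements FA} (∈-lookup i))
      ; at-injective = lookup-injective (Unique.filter⁺ P? (unique FA))
      ; index        = λ x p → Any.index (∈-filter⁺ P? (complete FA x) p)
      ; at-index     = λ x p → sym (lookup-index (∈-filter⁺ P? (complete FA x) p))
      })
      where
      xs : List A
      xs = filter P? (elements FA)

-- Identities between polynomials in q over the natural numbers.

module CountingIdentities where

  open import Data.Nat.Base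
  open import Data.Nat.Properties using (+-cancelʳ-≡; *-cancelˡ-≡; suc-injective; +-comm; m+n∸n≡m)
  open import Data.Nat.Tactic.RingSolver using (solve-∀)
  open ≡

  all-rays : ∀ q → q * q + (q + 1) + q * (q * q) * 1 ≡ 1 + q * (q * q + (q + 1))
  all-rays = solve-∀

  -- `Z = 2q - 1` is the size of two lines through the origin. With kernel count `q^2 Z` and image
  -- count `q^2`, the ray contributes `q^3 - q^2`, exactly as a ray that is not an eigenvector.
  invertible-eigen : ∀ q {Z} → Z + 1 ≡ q + q → q * q * Z + q * q ≡ q * (q * q) + q * (q * q)
  invertible-eigen q {Z} e = trans (lhs q Z) (trans (cong (q * q *_) e) (rhs q))
    where
    lhs : ∀ q Z → q * q * Z + q * q ≡ q * q * (Z + 1)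
    lhs = solve-∀
    rhs : ∀ q → q * q * (q + q) ≡ q * (q * q) + q * (q * q)
    rhs = solve-∀

  -- This and the next two identities are the cases of `NilWeights`: the indicators of `kills?` and
  -- `corner?` are (0,0), (1,0), (1,1), with kernel counts `q^3`, `q^3`, `q^4` and image counts `q`,
  -- `q^2`, `q^2`.
  nil-noneigen : ∀ q → q * q * q + q * (q * q) * 0 + q * q + q * (q * q) * 0 ≡
                       q * q + q * q * 0 + q * (q * q) + q * (q * (q * q)) * 0
  nil-noneigen = solve-∀

  nil-eigen : ∀ q → q * q * q + q * (q * q) * 1 + q * q + q * (q * q) * 0 ≡
                    q * (q * q) + q * q * 1 + q * (q * q) + q * (q * (q * q)) * 0
  nil-eigen = solve-∀

  nil-corner : ∀ q → q * q * (q * q) + q * (q * q) * 1 + q * q + q * (q * q) * 1 ≡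
                     q * (q * q) + q * q * 1 + q * (q * q) + q * (q * (q * q)) * 1
  nil-corner = solve-∀

  -- `A` and `B` are the kernel and image counts summed over all `q^2 + q + 1` rays; both equations
  -- determine `A - q B`. The term `q B + q^4 + q^3` is added to both sides and cancelled, in place
  -- of subtraction.
  total-invertible : ∀ q {T A B} → T + q * B ≡ A + q * (q * q) →
    A + (q * q + (q + 1)) * (q * q) ≡ q * B + (q * q + (q + 1)) * (q * (q * q)) →
    T + q * q ≡ q * q * q * q * q + q * q * q
  total-invertible q {T} {A} {B} e₁ e₂ = +-cancelʳ-≡ (q * B + (q * q * q * q + q * q * q)) _ _ (begin
    T + q * q + (q * B + (q * q * q * q + q * q * q))   ≡⟨ s₁ q T B ⟩
    (T + q * B) + (q * q + (q + 1)) * (q * q)           ≡⟨ cong (_+ (q * q + (q + 1)) * (q * q)) e₁ ⟩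
    (A + q * (q * q)) + (q * q + (q + 1)) * (q * q)     ≡⟨ s₂ q A ⟩
    (A + (q * q + (q + 1)) * (q * q)) + q * (q * q)     ≡⟨ cong (_+ q * (q * q)) e₂ ⟩
    (q * B + (q * q + (q + 1)) * (q * (q * q))) + q * (q * q)   ≡⟨ s₃ q B ⟩
    q * q * q * q * q + q * q * q + (q * B + (q * q * q * q + q * q * q)) ∎)
    where
    open ≡-Reasoning
    s₁ : ∀ q T B → T + q * q + (q * B + (q * q * q * q + q * q * q)) ≡ (T + q * B) + (q * q + (q + 1)) * (q * q)
    s₁ = solve-∀
    s₂ : ∀ q A → (A + q * (q * q)) + (q * q + (q + 1)) * (q * q) ≡ (A + (q * q + (q + 1)) * (q * q)) + q * (q * q)
    s₂ = solve-∀
    s₃ : ∀ q B → (q * B + (q * q + (q + 1)) * (q * (q * q))) + q * (q * q) ≡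
                 q * q * q * q * q + q * q * q + (q * B + (q * q * q * q + q * q * q))
    s₃ = solve-∀

  -- `κ` and `μ` count the kernel and image rays of `P`. After the substitution of `1 + q μ` for
  -- `κ`, every term with `μ` occurs on both sides, so the rank of `P` leaves no trace in the
  -- result.
  total-nilpotent : ∀ q {T A B κ μ} → T + q * B ≡ A + q * (q * q) → κ ≡ 1 + q * μ →
    A + q * (q * q) * κ + (q * q + (q + 1)) * (q * q) + q * (q * q) * μ ≡
      q * B + q * q * κ + (q * q + (q + 1)) * (q * (q * q)) + q * (q * (q * q)) * μ →
    T ≡ q * q * q * q * q
  total-nilpotent q {T} {A} {B} {κ} {μ} e₁ refl e₂ = +-cancelʳ-≡ r _ _ (begin
    T + r
      ≡⟨ s₁ q T B μ ⟩
    (T + q * B) + ((q * q + (q + 1)) * (q * q) + q * (q * q) * μ + q * (q * (q * q)) * μ)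
      ≡⟨ cong (_+ ((q * q + (q + 1)) * (q * q) + q * (q * q) * μ + q * (q * (q * q)) * μ)) e₁ ⟩
    (A + q * (q * q)) + ((q * q + (q + 1)) * (q * q) + q * (q * q) * μ + q * (q * (q * q)) * μ)
      ≡⟨ s₂ q A μ ⟩
    A + q * (q * q) * (1 + q * μ) + (q * q + (q + 1)) * (q * q) + q * (q * q) * μ
      ≡⟨ e₂ ⟩
    q * B + q * q * (1 + q * μ) + (q * q + (q + 1)) * (q * (q * q)) + q * (q * (q * q)) * μ
      ≡⟨ s₃ q B μ ⟩
    q * q * q * q * q + r ∎)
    where
    open ≡-Reasoning
    r = q * B + ((q * q + (q + 1)) * (q * q) + q * (q * q) * μ + q * (q * (q * q)) * μ)
    s₁ : ∀ q T B μ → T + (q * B + ((q * q + (q + 1)) * (q * q) + q * (q * q) * μ + q * (q * (q * q)) * μ)) ≡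
         (T + q * B) + ((q * q + (q + 1)) * (q * q) + q * (q * q) * μ + q * (q * (q * q)) * μ)
    s₁ = solve-∀
    s₂ : ∀ q A μ → (A + q * (q * q)) + ((q * q + (q + 1)) * (q * q) + q * (q * q) * μ + q * (q * (q * q)) * μ) ≡
         A + q * (q * q) * (1 + q * μ) + (q * q + (q + 1)) * (q * q) + q * (q * q) * μ
    s₂ = solve-∀
    s₃ : ∀ q B μ → q * B + q * q * (1 + q * μ) + (q * q + (q + 1)) * (q * (q * q)) + q * (q * (q * q)) * μ ≡
         q * q * q * q * q + (q * B + ((q * q + (q + 1)) * (q * q) + q * (q * q) * μ + q * (q * (q * q)) * μ))
    s₃ = solve-∀

  weigh₁ : ∀ w q m → w + q * (w * m) ≡ w * (1 + q * m)
  weigh₁ = solve-∀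

  weigh₂ : ∀ w k c i → w * (k + c * i) ≡ w * k + i * (w * c)
  weigh₂ = solve-∀

  -- Each equation says that `T - 1` is `q - 1` times the unknown, and `q - 1` is positive.
  multiplicity-unique : ∀ {q T m n} → 1 < q → T + m ≡ 1 + q * m → T + n ≡ 1 + q * n → m ≡ n
  multiplicity-unique {suc (suc k)} {T} {m} {n} (s≤s (s≤s z≤n)) e f =
    *-cancelˡ-≡ m n (suc k) (suc-injective (trans (sym (strip m e)) (strip n f)))
    where
    strip : ∀ m → T + m ≡ 1 + suc (suc k) * m → T ≡ suc (suc k * m)
    strip m e = +-cancelʳ-≡ m T (suc (suc k * m)) (trans e (cong suc (+-comm m (suc k * m))))

  -- One summand `q^2 + 1` splits off from the product, so the subtraction does not truncate.
  count-nil : ∀ q → let θ = q ^ 2 + 1 in (q ^ 2 + q + 1) * θ ∸ θ + 1 ≡ (q * q + q) * (q * q + 1) + 1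
  count-nil q = cong (_+ 1) (trans (cong (_∸ (q ^ 2 + 1)) (expand q)) (m+n∸n≡m ((q * q + q) * (q * q + 1)) (q ^ 2 + 1)))
    where
    expand : ∀ q → (q * (q * 1) + q + 1) * (q * (q * 1) + 1) ≡ (q * q + q) * (q * q + 1) + (q * (q * 1) + 1)
    expand = solve-∀

  -- The quotient `(q^5 - 1)/(q - 1) = q^4 + q^3 + q^2 + q + 1`, grouped as `(q^2 + q)(q^2 + 1) +
  -- 1`.
  geometric-nil : ∀ q {T} → T ≡ q * q * q * q * q →
                  T + ((q * q + q) * (q * q + 1) + 1) ≡ 1 + q * ((q * q + q) * (q * q + 1) + 1)
  geometric-nil q refl = go q
    where
    go : ∀ q → q * q * q * q * q + ((q * q + q) * (q * q + 1) + 1) ≡ 1 + q * ((q * q + q) * (q * q + 1) + 1)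
    go = solve-∀

  -- The quotient `(q^5 + q^3 - q^2 - 1)/(q - 1)` is `q^4 + q^3 + 2 q^2 + q + 1`, which factors as
  -- shown.
  geometric-invertible : ∀ q {T} → T + q * q ≡ q * q * q * q * q + q * q * q →
    T + (q ^ 2 + q + 1) * (q ^ 2 + 1) ≡ 1 + q * ((q ^ 2 + q + 1) * (q ^ 2 + 1))
  geometric-invertible q {T} e = +-cancelʳ-≡ (q * q) _ _ (begin
    T + (q ^ 2 + q + 1) * (q ^ 2 + 1) + q * q                         ≡⟨ s₁ T q ((q ^ 2 + q + 1) * (q ^ 2 + 1)) ⟩
    (T + q * q) + (q ^ 2 + q + 1) * (q ^ 2 + 1)                       ≡⟨ cong (_+ (q ^ 2 + q + 1) * (q ^ 2 + 1)) e ⟩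
    (q * q * q * q * q + q * q * q) + (q ^ 2 + q + 1) * (q ^ 2 + 1)   ≡⟨ s₂ q ⟩
    1 + q * ((q ^ 2 + q + 1) * (q ^ 2 + 1)) + q * q                   ∎)
    where
    open ≡-Reasoning
    s₁ : ∀ T q n → T + n + q * q ≡ (T + q * q) + n
    s₁ = solve-∀
    s₂ : ∀ q → (q * q * q * q * q + q * q * q) + (q * (q * 1) + q + 1) * (q * (q * 1) + 1) ≡
               1 + q * ((q * (q * 1) + q + 1) * (q * (q * 1) + 1)) + q * q
    s₂ = solve-∀

  unfold-identity : ∀ w i s → w * (i + s) ≡ i * w + w * s
  unfold-identity = solve-∀

  nonzero-multiples : ∀ {s n q} → s + 1 ≡ q → 1 + s * n + n ≡ 1 + q * n
  nonzero-multiples {s} {n} refl = go s n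
    where
    go : ∀ s n → 1 + s * n + n ≡ 1 + (s + 1) * n
    go = solve-∀

-- A solver for commutative rings with integer coefficients.

module RingSolver {c ℓ} (R : CommutativeRing c ℓ) where

  open import Algebra.Solver.Ring.AlmostCommutativeRing using (_-Raw-AlmostCommutative⟶_; fromCommutativeRing)
  import Algebra.Solver.Ring as Solver
  open import Data.Integer.Base as ℤ using (ℤ; +_; -[1+_])
  import Data.Integer.Properties as ℤ
  open import Data.Maybe.Base using (Maybe; just; nothing)
  import Data.Nat.Base as ℕ
  open import Data.Nat.Base using (zero; suc)
  open CommutativeRing R
  open import Algebra.Properties.CommutativeSemigroup +-commutativeSemigroup using (interchange)
  open import Algebra.Properties.Ring ring using (-0#≈0#; -‿distribˡ-*; -‿distribʳ-*; -‿involutive; -‿+-comm)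
  open import Algebra.Properties.Semiring.Mult.TCOptimised semiring
    using (×-homo-+; ×1-homo-*; 1+×) renaming (_×_ to _×′_)
  open import Relation.Binary.Reasoning.Setoid setoid

  -- The canonical map from the integers. With coefficients there, cancellation is decided by
  -- computation, whatever the equality of the ring.
  ⟦_⟧ℤ : ℤ → Carrier
  ⟦ + n ⟧ℤ      = n ×′ 1#
  ⟦ -[1+ n ] ⟧ℤ = - (suc n ×′ 1#)

  private
    cancel : ∀ a x y → x - y ≈ (a + x) - (a + y)
    cancel a x y = sym (begin
      (a + x) + - (a + y)   ≈⟨ +-congˡ (sym (-‿+-comm a y)) ⟩
      (a + x) + (- a + - y) ≈⟨ interchange a x (- a) (- y) ⟩
      (a + - a) + (x + - y) ≈⟨ +-congʳ (-‿inverseʳ a) ⟩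
      0# + (x + - y)        ≈⟨ +-identityˡ _ ⟩
      x - y                 ∎)

    ⊖-homo : ∀ m n → ⟦ m ℤ.⊖ n ⟧ℤ ≈ m ×′ 1# - n ×′ 1#
    ⊖-homo zero    zero    = sym (trans (+-identityˡ _) -0#≈0#)
    ⊖-homo (suc m) zero    = sym (trans (+-congˡ -0#≈0#) (+-identityʳ _))
    ⊖-homo zero    (suc n) = sym (+-identityˡ _)
    ⊖-homo (suc m) (suc n) = begin
      ⟦ suc m ℤ.⊖ suc n ⟧ℤ                ≡⟨ ≡.cong ⟦_⟧ℤ (ℤ.[1+m]⊖[1+n]≡m⊖n m n) ⟩
      ⟦ m ℤ.⊖ n ⟧ℤ                        ≈⟨ ⊖-homo m n ⟩
      m ×′ 1# - n ×′ 1#                     ≈⟨ cancel 1# _ _ ⟩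
      (1# + m ×′ 1#) - (1# + n ×′ 1#)       ≈⟨ +-cong (sym (1+× m 1#)) (-‿cong (sym (1+× n 1#))) ⟩
      suc m ×′ 1# - suc n ×′ 1#             ∎

    -homo : ∀ i → ⟦ ℤ.- i ⟧ℤ ≈ - ⟦ i ⟧ℤ
    -homo (+ zero)   = sym -0#≈0#
    -homo (+ suc n)  = refl
    -homo -[1+ n ]   = sym (-‿involutive _)

    +homo : ∀ i j → ⟦ i ℤ.+ j ⟧ℤ ≈ ⟦ i ⟧ℤ + ⟦ j ⟧ℤ
    +homo (+ m)    (+ n)    = ×-homo-+ 1# m n
    +homo (+ m)    -[1+ n ] = ⊖-homo m (suc n)
    +homo -[1+ m ] (+ n)    = trans (⊖-homo n (suc m)) (+-comm _ _)
    +homo -[1+ m ] -[1+ n ] = begin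
      - (suc (suc (m ℕ.+ n)) ×′ 1#)      ≡⟨ ≡.cong (λ k → - (suc k ×′ 1#)) (≡.sym (+-suc′ m n)) ⟩
      - ((suc m ℕ.+ suc n) ×′ 1#)        ≈⟨ -‿cong (×-homo-+ 1# (suc m) (suc n)) ⟩
      - (suc m ×′ 1# + suc n ×′ 1#)       ≈⟨ sym (-‿+-comm _ _) ⟩
      - (suc m ×′ 1#) + - (suc n ×′ 1#)   ∎
      where open import Data.Nat.Properties using () renaming (+-suc to +-suc′)

    *homo-pos : ∀ m n → ⟦ + m ℤ.* + n ⟧ℤ ≈ (m ×′ 1#) * (n ×′ 1#)
    *homo-pos m n = trans (reflexive (≡.cong ⟦_⟧ℤ (≡.sym (ℤ.pos-* m n)))) (×1-homo-* m n)

    *homo : ∀ i j → ⟦ i ℤ.* j ⟧ℤ ≈ ⟦ i ⟧ℤ * ⟦ j ⟧ℤ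
    *homo (+ m)    (+ n)    = *homo-pos m n
    *homo (+ m)    -[1+ n ] = begin
      ⟦ + m ℤ.* (ℤ.- (+ suc n)) ⟧ℤ    ≡⟨ ≡.cong ⟦_⟧ℤ (≡.sym (ℤ.neg-distribʳ-* (+ m) (+ suc n))) ⟩
      ⟦ ℤ.- (+ m ℤ.* + suc n) ⟧ℤ      ≈⟨ -homo (+ m ℤ.* + suc n) ⟩
      - ⟦ + m ℤ.* + suc n ⟧ℤ          ≈⟨ -‿cong (*homo-pos m (suc n)) ⟩
      - ((m ×′ 1#) * (suc n ×′ 1#))     ≈⟨ -‿distribʳ-* _ _ ⟩
      (m ×′ 1#) * - (suc n ×′ 1#)       ∎
    *homo -[1+ m ] (+ n) = begin
      ⟦ (ℤ.- (+ suc m)) ℤ.* + n ⟧ℤ    ≡⟨ ≡.cong ⟦_⟧ℤ (≡.sym (ℤ.neg-distribˡ-* (+ suc m) (+ n))) ⟩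
      ⟦ ℤ.- (+ suc m ℤ.* + n) ⟧ℤ      ≈⟨ -homo (+ suc m ℤ.* + n) ⟩
      - ⟦ + suc m ℤ.* + n ⟧ℤ          ≈⟨ -‿cong (*homo-pos (suc m) n) ⟩
      - ((suc m ×′ 1#) * (n ×′ 1#))     ≈⟨ -‿distribˡ-* _ _ ⟩
      - (suc m ×′ 1#) * (n ×′ 1#)       ∎
    *homo -[1+ m ] -[1+ n ] = begin
      ⟦ + suc m ℤ.* + suc n ⟧ℤ            ≈⟨ *homo-pos (suc m) (suc n) ⟩
      (suc m ×′ 1#) * (suc n ×′ 1#)         ≈⟨ sym (-‿involutive _) ⟩
      - - ((suc m ×′ 1#) * (suc n ×′ 1#))   ≈⟨ -‿cong (-‿distribˡ-* _ _) ⟩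
      - (- (suc m ×′ 1#) * (suc n ×′ 1#))   ≈⟨ -‿distribʳ-* _ _ ⟩
      - (suc m ×′ 1#) * - (suc n ×′ 1#)     ∎

    morphism : ℤ.+-*-rawRing -Raw-AlmostCommutative⟶ fromCommutativeRing R
    morphism = record
      { ⟦_⟧ = ⟦_⟧ℤ ; +-homo = +homo ; *-homo = *homo ; -‿homo = -homo
      ; 0-homo = refl ; 1-homo = refl }

    _≟_ : ∀ i j → Maybe (⟦ i ⟧ℤ ≈ ⟦ j ⟧ℤ)
    i ≟ j with i ℤ.≟ j
    ... | yes ≡.refl = just refl
    ... | no _       = nothing

  open Solver ℤ.+-*-rawRing (fromCommutativeRing R) morphism _≟_ public

  0ₚ 1ₚ : ∀ {n} → Polynomial n
  0ₚ = con (+ 0)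
  1ₚ = con (+ 1)

-- Three by three matrices over an arbitrary carrier.

module Matrices where

  open import Data.Fin.Base using (zero; suc)
  open ≡ using (cong₂)

  V : ∀ {a} → Set a → Set a
  V A = A × A × A

  Mat : ∀ {a} → Set a → Set a
  Mat A = V (V A)

  -- The points of the projective plane, normalised to (a , b , 1), (a , 1 , 0) or (1 , 0 , 0).
  Ω : ∀ {a} → Set a → Set a
  Ω A = (A × A) ⊎ A ⊎ Fin 1

  infixl 10 _!_
  _!_ : ∀ {a} {A : Set a} → V A → Fin 3 → A
  (x , y , z) ! zero             = x
  (x , y , z) ! suc zero         = y
  (x , y , z) ! suc (suc zero)   = z

  mapV : ∀ {a b} {A : Set a} {B : Set b} → (A → B) → V A → V B
  mapV f (x , y , z) = f x , f y , f z

  transpose : ∀ {a} {A : Set a} → Mat A → Mat A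
  transpose ((a , b , c) , (d , e , f) , (g , h , i)) = (a , d , g) , (b , e , h) , (c , f , i)

  V-ext : ∀ {a} {A : Set a} {u v : V A} → (∀ i → u ! i ≡ v ! i) → u ≡ v
  V-ext h = cong₂ _,_ (h zero) (cong₂ _,_ (h (suc zero)) (h (suc (suc zero))))

  -- Operations without laws, because they are instantiated twice: at field elements, and at solver
  -- polynomials, where evaluating them on variables produces the syntax of both sides of a matrix
  -- identity.
  module MatrixOps {a} {A : Set a} (_+_ _*_ : A → A → A) (-_ : A → A) (0# 1# : A) where

    private
      infixl 6 _⊕_ _⊝_
      infixl 7 _⊛_
      _⊕_ = _+_
      _⊛_ = _*_
      _⊝_ : A → A → A
      x ⊝ y = x ⊕ (- y)

    dot : V A → V A → A
    dot (a , b , c) (x , y , z) = a ⊛ x ⊕ b ⊛ y ⊕ c ⊛ z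

    cross : V A → V A → V A
    cross (a , b , c) (x , y , z) = b ⊛ z ⊝ c ⊛ y , c ⊛ x ⊝ a ⊛ z , a ⊛ y ⊝ b ⊛ x

    scale : A → V A → V A
    scale t = mapV (t ⊛_)

    outer : V A → V A → Mat A
    outer u v = mapV (λ x → scale x v) u

    apply : Mat A → V A → V A
    apply M v = mapV (λ r → dot r v) M

    infixr 7 _·_
    _·_ : Mat A → Mat A → Mat A
    M · N = mapV (apply (transpose N)) M

    trace : Mat A → A
    trace ((a , _ , _) , (_ , e , _) , (_ , _ , i)) = a ⊕ e ⊕ i

    -- The form Q₈, which is minus the second invariant.
    quad : Mat A → A
    quad ((x₁ , x₂ , x₃) , (x₄ , x₅ , x₆) , (x₇ , x₈ , x₉)) =
      x₂ ⊛ x₄ ⊝ x₁ ⊛ x₅ ⊕ x₃ ⊛ x₇ ⊝ x₁ ⊛ x₉ ⊕ x₆ ⊛ x₈ ⊝ x₅ ⊛ x₉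

    det : Mat A → A
    det (r , s , t) = dot (cross r s) t

    𝟎 : V A
    𝟎 = 0# , 0# , 0#

    -- The third column of `frame p` is `ray p`, so conjugation by it moves that ray to the third
    -- basis vector.
    frame frame⁻¹ : Ω A → Mat A
    frame (inj₁ (a , b))      = (1# , 0# , a) , (0# , 1# , b) , (0# , 0# , 1#)
    frame (inj₂ (inj₁ a))     = (1# , 0# , a) , (0# , 0# , 1#) , (0# , 1# , 0#)
    frame (inj₂ (inj₂ zero))  = (0# , 0# , 1#) , (1# , 0# , 0#) , (0# , 1# , 0#)
    frame⁻¹ (inj₁ (a , b))     = (1# , 0# , - a) , (0# , 1# , - b) , (0# , 0# , 1#)
    frame⁻¹ (inj₂ (inj₁ a))    = (1# , - a , 0#) , (0# , 0# , 1#) , (0# , 1# , 0#)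
    frame⁻¹ (inj₂ (inj₂ zero)) = (0# , 1# , 0#) , (0# , 0# , 1#) , (1# , 0# , 0#)

    ray : Ω A → V A
    ray (inj₁ (a , b))     = a , b , 1#
    ray (inj₂ (inj₁ a))    = a , 1# , 0#
    ray (inj₂ (inj₂ zero)) = 1# , 0# , 0#

    conj unconj : Ω A → Mat A → Mat A
    conj p M   = frame⁻¹ p · M · frame p
    unconj p M = frame p · M · frame⁻¹ p

    col₃ : Mat A → V A
    col₃ ((_ , _ , c) , (_ , _ , f) , (_ , _ , i)) = c , f , i

-- Counting over a field whose elements are `Fin q`.

module FiniteFields {q : ℕ} {_⊕_ _⊛_ : Fin q → Fin q → Fin q} {⊝_ : Fin q → Fin q} {𝟘 𝟙 : Fin q}
  (isCR : IsCommutativeRing _≡_ _⊕_ _⊛_ ⊝_ 𝟘 𝟙)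
  (1≢0 : 𝟙 ≢ 𝟘) (inverse : ∀ x → x ≢ 𝟘 → ∃ λ y → x ⊛ y ≡ 𝟙)
  (q%3≡1 : q Data.Nat.Base.% 3 ≡ 1) where

  import Data.Fin.Base as Fin
  open import Data.Fin using (#_)
  open import Data.Fin.Patterns
  import Data.Fin.Properties as Fin
  import Data.Nat.Base as ℕ
  import Data.Nat.DivMod as ℕ
  import Data.Nat.Properties as ℕ
  import Data.Nat.Solver as ℕ
  open import Data.Vec.Base as Vec using (Vec; []; _∷_)
  open import Relation.Binary.Definitions using (tri<; tri≈; tri>)
  open ≡
  open ≡-Reasoning
  open FiniteSums
  open CountingIdentities
  open Matrices

  -- A primitive cube root of unity

  module _ {n : ℕ} (σ : Fin n → Fin n) (σ³≡id : ∀ x → σ (σ (σ x)) ≡ x) where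

    private
      first? : ∀ (a b c : Fin n) → Dec (a Fin.< b × a Fin.< c)
      first? a b c = (a Fin.<? b) ×-dec (a Fin.<? c)

      -- Marks one element in each orbit of length three. The comparison is strict, so fixed points
      -- are not marked.
      least : Fin n → ℕ
      least x = ι (first? x (σ x) (σ (σ x)))

      one-least : ∀ (a b c : Fin n) → a ≢ b → b ≢ c → c ≢ a →
                  ι (first? a b c) ℕ.+ (ι (first? b c a) ℕ.+ ι (first? c a b)) ≡ 1
      one-least a b c a≢b b≢c c≢a with Fin.<-cmp a b | Fin.<-cmp b c | Fin.<-cmp c a
      ... | tri≈ _ e _ | _ | _ = ⊥-elim (a≢b e)
      ... | _ | tri≈ _ e _ | _ = ⊥-elim (b≢c e)
      ... | _ | _ | tri≈ _ e _ = ⊥-elim (c≢a e)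
      ... | tri< x _ _ | tri< y _ _ | tri< z _ _ = ⊥-elim (ℕ.<-asym z (ℕ.<-trans x y))
      ... | tri> _ _ x | tri> _ _ y | tri> _ _ z = ⊥-elim (ℕ.<-asym z (ℕ.<-trans y x))
      ... | tri< x _ x″ | _ | tri> z _ z″ =
        cong₂ ℕ._+_ (ι-yes (first? a b c) (x , z″))
          (cong₂ ℕ._+_ (ι-no (first? b c a) (x″ ∘ proj₂)) (ι-no (first? c a b) (z ∘ proj₁)))
      ... | _ | tri> y _ y″ | tri< z _ z″ =
        cong₂ ℕ._+_ (ι-no (first? a b c) (z″ ∘ proj₂))
          (cong₂ ℕ._+_ (ι-no (first? b c a) (y ∘ proj₁)) (ι-yes (first? c a b) (z , y″)))
      ... | tri> x _ x″ | tri< y _ y″ | _ =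
        cong₂ ℕ._+_ (ι-no (first? a b c) (x ∘ proj₁))
          (cong₂ ℕ._+_ (ι-yes (first? b c a) (y , x″)) (ι-no (first? c a b) (y″ ∘ proj₂)))

      orbit : ∀ x → 1 ≡ ι (σ x ≟ x) ℕ.+ (least x ℕ.+ (least (σ x) ℕ.+ least (σ (σ x))))
      orbit x with σ x ≟ x
      ... | yes e = cong ℕ.suc (sym (cong₂ ℕ._+_ (none x e) (cong₂ ℕ._+_ (none _ (cong σ e)) (none _ (cong (σ ∘ σ) e)))))
        where
        none : ∀ y → σ y ≡ y → least y ≡ 0
        none y e = ι-no (first? y (σ y) (σ (σ y))) (λ (lt , _) → ℕ.<-irrefl (cong Fin.toℕ (sym e)) lt)
      ... | no ¬e = sym (trans
        (cong (least x ℕ.+_) (cong₂ ℕ._+_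
          (cong (λ z → ι (first? (σ x) (σ (σ x)) z)) (σ³≡id x))
          (cong₂ (λ z w → ι (first? (σ (σ x)) z w)) (σ³≡id x) (cong σ (σ³≡id x)))))
        (one-least x (σ x) (σ (σ x)) (¬e ∘ sym)
          (λ e → ¬e (sym (trans (sym (σ³≡id x)) (trans (cong (σ ∘ σ) e) (cong σ (σ³≡id x))))))
          (λ e → ¬e (trans (cong σ (sym e)) (σ³≡id x)))))

    -- A point that is not fixed has exactly one orbit minimum among `x`, `σ x`, `σ (σ x)`. Since
    -- `σ` is a permutation, the three shifted sums of `least` agree, and the points moved number
    -- three times the orbit minima.
    fixed-points-mod-3 : ∃ λ k → n ≡ ∑ (λ x → ι (σ x ≟ x)) ℕ.+ k ℕ.* 3
    fixed-points-mod-3 = ∑ least , (begin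
      n                  ≡⟨ sym (card-Fin n) ⟩
      card (Fin n)       ≡⟨ ∑-cong orbit ⟩
      ∑ (λ x → ι (σ x ≟ x) ℕ.+ (least x ℕ.+ (least (σ x) ℕ.+ least (σ (σ x)))))
        ≡⟨ trans (∑-+ (λ x → ι (σ x ≟ x)) _) (cong (∑ (λ x → ι (σ x ≟ x)) ℕ.+_)
             (trans (∑-+ least _) (cong (∑ least ℕ.+_) (∑-+ (least ∘ σ) (least ∘ σ ∘ σ))))) ⟩
      ∑ (λ x → ι (σ x ≟ x)) ℕ.+ (∑ least ℕ.+ (∑ (least ∘ σ) ℕ.+ ∑ (least ∘ σ ∘ σ)))
        ≡⟨ cong (λ s → ∑ (λ x → ι (σ x ≟ x)) ℕ.+ (∑ least ℕ.+ s))
             (cong₂ ℕ._+_ (sym (∑-reindex σ (σ ∘ σ) σ³≡id σ³≡id least))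
                          (sym (∑-reindex (σ ∘ σ) σ σ³≡id σ³≡id least))) ⟩
      ∑ (λ x → ι (σ x ≟ x)) ℕ.+ (∑ least ℕ.+ (∑ least ℕ.+ ∑ least))
        ≡⟨ cong (∑ (λ x → ι (σ x ≟ x)) ℕ.+_)
             (solve 1 (λ l → l :+ (l :+ l) := l :* con 3) refl (∑ least)) ⟩
      ∑ (λ x → ι (σ x ≟ x)) ℕ.+ ∑ least ℕ.* 3 ∎)
      where open ℕ.+-*-Solver

  K : Set
  K = Fin q

  KRing : CommutativeRing 0ℓ 0ℓ
  KRing = record { isCommutativeRing = isCR }

  open CommutativeRing KRing public
    using (_+_; _*_; -_; _-_; 0#; 1#; +-comm; +-identityʳ; *-comm; *-assoc; *-identityˡ; *-identityʳ; zeroˡ; zeroʳ; -‿inverseʳ)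
  open RingSolver KRing public

  -- x ≡ y is usually obtained from an identity x ≡ y + c₁ u₁ + … with all uᵢ ≡ 0.
  drop₁ : ∀ {x y u} c → u ≡ 0# → x ≡ y + (c * u) → x ≡ y
  drop₁ {y = y} c refl eq = trans eq (trans (cong (_+_ y) (zeroʳ c)) (+-identityʳ y))

  x-y≡0⇒x≡y : ∀ {x y} → x - y ≡ 0# → x ≡ y
  x-y≡0⇒x≡y {x} {y} h = drop₁ 1# h (solve 2 (λ x y → x := y :+ 1ₚ :* (x :- y)) refl x y)

  x≡y⇒x-y≡0 : ∀ {x y} → x ≡ y → x - y ≡ 0#
  x≡y⇒x-y≡0 {x} refl = -‿inverseʳ x

  -- Total, with the default value 0 at 0, so that it can occur in terms without a proof attached.
  inv : K → K
  inv x with x ≟ 0#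
  ... | yes _  = 0#
  ... | no x≢0 = proj₁ (inverse x x≢0)

  inv-r : ∀ {x} → x ≢ 0# → x * inv x ≡ 1#
  inv-r {x} x≢0 with x ≟ 0#
  ... | yes x≡0 = ⊥-elim (x≢0 x≡0)
  ... | no ¬p   = proj₂ (inverse x ¬p)

  *-cancel₀ : ∀ {x y} → x ≢ 0# → x * y ≡ 0# → y ≡ 0#
  *-cancel₀ {x} {y} x≢0 xy≡0 = begin
    y                   ≡⟨ sym (*-identityˡ y) ⟩
    1# * y              ≡⟨ cong (_* y) (sym (inv-r x≢0)) ⟩
    (x * inv x) * y     ≡⟨ solve 3 (λ x i y → x :* i :* y := i :* (x :* y)) refl x (inv x) y ⟩
    inv x * (x * y)     ≡⟨ cong (inv x *_) xy≡0 ⟩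
    inv x * 0#          ≡⟨ zeroʳ _ ⟩
    0#                  ∎

  *-cancelˡ : ∀ {x y z} → x ≢ 0# → x * y ≡ x * z → y ≡ z
  *-cancelˡ {x} {y} {z} x≢0 e = x-y≡0⇒x≡y (*-cancel₀ x≢0
    (trans (solve 3 (λ x y z → x :* (y :- z) := x :* y :- x :* z) refl x y z) (x≡y⇒x-y≡0 e)))

  *-zero : ∀ {x y} → x * y ≡ 0# → x ≡ 0# ⊎ y ≡ 0#
  *-zero {x} e with x ≟ 0#
  ... | yes x≡0 = inj₁ x≡0
  ... | no x≢0  = inj₂ (*-cancel₀ x≢0 e)

  *-nonzero : ∀ {x y} → x ≢ 0# → y ≢ 0# → x * y ≢ 0#
  *-nonzero x≢0 y≢0 e = y≢0 (*-cancel₀ x≢0 e)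

  unit≢0 : ∀ {x y} → x * y ≡ 1# → x ≢ 0#
  unit≢0 {y = y} e refl = 1≢0 (trans (sym e) (zeroˡ y))

  inv≢0 : ∀ {x} → x ≢ 0# → inv x ≢ 0#
  inv≢0 {x} x≢0 = unit≢0 (trans (*-comm (inv x) x) (inv-r x≢0))

  private
    -- A map of order three with `r` fixed points forces `q` and `r` to agree modulo 3, against
    -- `q % 3 ≡ 1`. The conclusion stands for absurdity, in the form in which the callers refute it.
    no-multiple : ∀ {m} r → (∃ λ k → q ≡ m ℕ.+ k ℕ.* 3) → m ≡ r → r ℕ.% 3 ≢ 1 → 1# ≡ 0#
    no-multiple {m} r (k , eq) m≡r r≢1 = ⊥-elim (r≢1 (trans (sym (ℕ.[m+kn]%n≡m%n r k 3))
      (trans (cong (λ m → (m ℕ.+ k ℕ.* 3) ℕ.% 3) (sym m≡r)) (trans (cong (ℕ._% 3) (sym eq)) q%3≡1))))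

  -- If 3 were 0, translation by 1 would have order three without fixed points, and 3 would divide
  -- `q`.
  3≢0 : (1# + 1#) + 1# ≢ 0#
  3≢0 3≡0 = 1≢0 (no-multiple 0 (fixed-points-mod-3 σ σ³) (∑-zero moved) (λ ()))
    where
    σ : K → K
    σ x = x + 1#
    σ³ : ∀ x → σ (σ (σ x)) ≡ x
    σ³ x = drop₁ 1# 3≡0 (solve 1 (λ x → x :+ 1ₚ :+ 1ₚ :+ 1ₚ :=
                                x :+ 1ₚ :* (1ₚ :+ 1ₚ :+ 1ₚ)) refl x)
    moved : ∀ x → ι (σ x ≟ x) ≡ 0
    moved x = ι-no (σ x ≟ x) (λ e → 1≢0 (trans
      (solve 1 (λ x → 1ₚ := x :+ 1ₚ :- x) refl x) (x≡y⇒x-y≡0 e)))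

  -- The map x ↦ 1/(1 - x) has order 3 on K ∖ {0,1}, and q - 2 is not divisible by 3,
  -- so it has a fixed point there: a root of x² - x + 1.
  private
    möbius′ : ∀ x → Dec (x ≡ 0#) → Dec (x ≡ 1#) → K
    möbius′ x (no _)  (no _) = inv (1# - x)
    möbius′ x _       _      = x

    möbius : K → K
    möbius x = möbius′ x (x ≟ 0#) (x ≟ 1#)

    möbius-0 : möbius 0# ≡ 0#
    möbius-0 with 0# ≟ 0# | 0# ≟ 1#
    ... | yes _ | yes _ = refl
    ... | yes _ | no _  = refl
    ... | no p  | _     = ⊥-elim (p refl)

    möbius-1 : möbius 1# ≡ 1#
    möbius-1 with 1# ≟ 0# | 1# ≟ 1#
    ... | yes _ | yes _ = refl
    ... | no _  | yes _ = refl
    ... | _     | no p  = ⊥-elim (p refl)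

    möbius-eq : ∀ {x} → x ≢ 0# → x ≢ 1# → (1# - x) * möbius x ≡ 1#
    möbius-eq {x} x≢0 x≢1 with x ≟ 0# | x ≟ 1#
    ... | yes p | _     = ⊥-elim (x≢0 p)
    ... | no _  | yes p = ⊥-elim (x≢1 p)
    ... | no _  | no _  = inv-r (λ e → x≢1 (sym (x-y≡0⇒x≡y e)))

    -- Keeps the whole orbit away from 0 and 1, so that the defining equation of `möbius` may be
    -- used at each of its points.
    regular : ∀ {x y} → x ≢ 0# → (1# - x) * y ≡ 1# → y ≢ 0# × y ≢ 1#
    regular {x} {y} x≢0 e = (λ { refl → 1≢0 (trans (sym e) (zeroʳ _)) }) ,
      (λ { refl → x≢0 (drop₁ (- 1#) (x≡y⇒x-y≡0 e)
        (solve 1 (λ x → x := 0ₚ :+ (:- 1ₚ) :* ((1ₚ :- x) :* 1ₚ :- 1ₚ)) refl x)) })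

    möbius³ : ∀ x → möbius (möbius (möbius x)) ≡ x
    möbius³ x = by-cases (x ≟ 0#) (x ≟ 1#)
      where
      by-cases : Dec (x ≡ 0#) → Dec (x ≡ 1#) → möbius (möbius (möbius x)) ≡ x
      by-cases (yes refl) _ = trans (cong (möbius ∘ möbius) möbius-0) (trans (cong möbius möbius-0) möbius-0)
      by-cases (no _) (yes refl) = trans (cong (möbius ∘ möbius) möbius-1) (trans (cong möbius möbius-1) möbius-1)
      -- The three defining equations of the orbit `x, y, z, w` combine to `y (w - x) = 0`, and `y`
      -- is nonzero.
      by-cases (no x≢0) (no x≢1) = x-y≡0⇒x≡y (*-cancel₀ y≢0 (begin
        y * (w - x)
          ≡⟨ solve 4 (λ x y z w → y :* (w :- x) :=
               (w :- w :* z) :* ((1ₚ :- x) :* y :- 1ₚ) :+ (x :* y) :* ((1ₚ :- z) :* w :- 1ₚ)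
               :- w :* ((1ₚ :- y) :* z :- 1ₚ)) refl x y z w ⟩
        ((w - w * z) * ((1# - x) * y - 1#) + (x * y) * ((1# - z) * w - 1#)) - w * ((1# - y) * z - 1#)
          ≡⟨ cong₂ _-_ (cong₂ _+_ (vanish (w - w * z) e₁) (vanish (x * y) e₃)) (vanish w e₂) ⟩
        (0# + 0#) - 0#
          ≡⟨ solve 0 (0ₚ :+ 0ₚ :- 0ₚ := 0ₚ) refl ⟩
        0# ∎))
        where
        y = möbius x
        z = möbius y
        w = möbius z
        vanish : ∀ c {s t} → s ≡ t → c * (s - t) ≡ 0#
        vanish c e = trans (cong (c *_) (x≡y⇒x-y≡0 e)) (zeroʳ c)
        e₁ = möbius-eq x≢0 x≢1
        y≢0 = proj₁ (regular x≢0 e₁)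
        e₂ = möbius-eq y≢0 (proj₂ (regular x≢0 e₁))
        e₃ = möbius-eq (proj₁ (regular y≢0 e₂)) (proj₂ (regular y≢0 e₂))

    hexagonal? : ∀ x → Dec (x * (1# - x) ≡ 1#)
    hexagonal? x = x * (1# - x) ≟ 1#

    fixed-split : ∀ x → ι (möbius x ≟ x) ≡ ι (x ≟ 0#) ℕ.+ (ι (x ≟ 1#) ℕ.+ ι (hexagonal? x))
    fixed-split x = by-cases (x ≟ 0#) (x ≟ 1#)
      where
      by-cases : Dec (x ≡ 0#) → Dec (x ≡ 1#) → ι (möbius x ≟ x) ≡ ι (x ≟ 0#) ℕ.+ (ι (x ≟ 1#) ℕ.+ ι (hexagonal? x))
      by-cases (yes refl) _ = trans (ι-yes (möbius 0# ≟ 0#) möbius-0) (sym (cong₂ ℕ._+_ (ι-yes (0# ≟ 0#) refl)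
        (cong₂ ℕ._+_ (ι-no (0# ≟ 1#) (1≢0 ∘ sym)) (ι-no (hexagonal? 0#) (λ e → 1≢0 (trans (sym e) (zeroˡ _)))))))
      by-cases (no _) (yes refl) = trans (ι-yes (möbius 1# ≟ 1#) möbius-1) (sym (cong₂ ℕ._+_ (ι-no (1# ≟ 0#) 1≢0)
        (cong₂ ℕ._+_ (ι-yes (1# ≟ 1#) refl) (ι-no (hexagonal? 1#) (λ e → 1≢0 (trans (sym e)
          (solve 0 (1ₚ :* (1ₚ :- 1ₚ) := 0ₚ) refl)))))))
      by-cases (no x≢0) (no x≢1) = trans
        (ι-cong (möbius x ≟ x) (hexagonal? x)
          (λ e → trans (*-comm x _) (trans (cong ((1# - x) *_) (sym e)) (möbius-eq x≢0 x≢1)))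
          (λ e → *-cancelˡ (λ 1-x≡0 → x≢1 (sym (x-y≡0⇒x≡y 1-x≡0)))
            (trans (möbius-eq x≢0 x≢1) (trans (sym e) (*-comm x _)))))
        (sym (cong₂ ℕ._+_ (ι-no (x ≟ 0#) x≢0) (cong (ℕ._+ ι (hexagonal? x)) (ι-no (x ≟ 1#) x≢1))))

  -- The map is extended by fixing 0 and 1. Without a root these would be its only fixed points, and
  -- `q` would be 2 modulo 3.
  hexagonal-root : ∃ λ x → x * (1# - x) ≡ 1#
  hexagonal-root with ∑ (λ x → ι (hexagonal? x)) ℕ.≟ 0
  ... | no s≢0 with ∑-nonzero _ s≢0
  ...   | x , ιx≢0 with hexagonal? x
  ...     | yes e = x , e
  ...     | no _  = ⊥-elim (ιx≢0 refl)
  hexagonal-root | yes s≡0 = ⊥-elim (1≢0 (no-multiple 2 (fixed-points-mod-3 möbius möbius³) (begin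
    ∑ (λ x → ι (möbius x ≟ x))  ≡⟨ ∑-cong fixed-split ⟩
    ∑ (λ x → ι (x ≟ 0#) ℕ.+ (ι (x ≟ 1#) ℕ.+ ι (hexagonal? x)))
      ≡⟨ trans (∑-+ (λ x → ι (x ≟ 0#)) _) (cong (∑ (λ x → ι (x ≟ 0#)) ℕ.+_) (∑-+ (λ x → ι (x ≟ 1#)) _)) ⟩
    ∑ (λ x → ι (x ≟ 0#)) ℕ.+ (∑ (λ x → ι (x ≟ 1#)) ℕ.+ ∑ (λ x → ι (hexagonal? x)))
      ≡⟨ cong₂ ℕ._+_ (∑-ι-point 0#) (cong₂ ℕ._+_ (∑-ι-point 1#) s≡0) ⟩
    2 ∎) (λ ())))

  -- Minus a root of `x^2 - x + 1` is a root of `x^2 + x + 1`.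
  ω : K
  ω = - proj₁ hexagonal-root

  -- Written as a polynomial in `ω`, so that the solver sees `1 + ω + ω² = 0`; only `ω ω² = 1` has
  -- to be supplied as a hypothesis.
  ω² : K
  ω² = - (1# + ω)

  ω*ω² : ω * ω² ≡ 1#
  ω*ω² = trans (solve 1 (λ x → :- x :* :- (1ₚ :+ :- x) := x :* (1ₚ :- x)) refl (proj₁ hexagonal-root))
               (proj₂ hexagonal-root)

  -- Because `(ω - ω²)^2 = -3`.
  ω≢ω² : ω - ω² ≢ 0#
  ω≢ω² e = 3≢0 (drop₁ ((1# + 1#) * (1# + 1#)) (x≡y⇒x-y≡0 (sym ω*ω²)) (drop₁ (ω² - ω) e
    (solve 1 (λ w → let w² = :- (1ₚ :+ w) in 1ₚ :+ 1ₚ :+ 1ₚ :=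
      0ₚ :+ ((1ₚ :+ 1ₚ) :* (1ₚ :+ 1ₚ)) :* (1ₚ :- w :* w²) :+ (w² :- w) :* (w :- w²)) refl ω)))

  -- Conjugation by frames of the projective plane

  private module KOps = MatrixOps _+_ _*_ -_ 0# 1#
  open KOps hiding (conj; unconj) public

  opaque
    -- Opaque, so that triple matrix products are not expanded during unification.
    conj unconj : Ω K → Mat K → Mat K
    conj   = KOps.conj
    unconj = KOps.unconj

  module Sym {n : ℕ} = MatrixOps (_:+_ {n}) _:*_ :-_ 0ₚ 1ₚ

  prove-V : ∀ {n} (ρ : Vec K n) (e e′ : V (Polynomial n)) →
            mapV (λ p → ⟦ p ⟧↓ ρ) e ≡ mapV (λ p → ⟦ p ⟧↓ ρ) e′ →
            mapV (λ p → ⟦ p ⟧ ρ) e ≡ mapV (λ p → ⟦ p ⟧ ρ) e′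
  prove-V ρ (e₁ , e₂ , e₃) (f₁ , f₂ , f₃) eq = cong₂ _,_ (prove ρ e₁ f₁ (cong proj₁ eq))
    (cong₂ _,_ (prove ρ e₂ f₂ (cong (λ v → proj₁ (proj₂ v)) eq)) (prove ρ e₃ f₃ (cong (λ v → proj₂ (proj₂ v)) eq)))

  prove-M : ∀ {n} (ρ : Vec K n) (e e′ : Mat (Polynomial n)) →
            mapV (mapV (λ p → ⟦ p ⟧↓ ρ)) e ≡ mapV (mapV (λ p → ⟦ p ⟧↓ ρ)) e′ →
            mapV (mapV (λ p → ⟦ p ⟧ ρ)) e ≡ mapV (mapV (λ p → ⟦ p ⟧ ρ)) e′
  prove-M ρ (e₁ , e₂ , e₃) (f₁ , f₂ , f₃) eq = cong₂ _,_ (prove-V ρ e₁ f₁ (cong proj₁ eq))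
    (cong₂ _,_ (prove-V ρ e₂ f₂ (cong (λ v → proj₁ (proj₂ v)) eq)) (prove-V ρ e₃ f₃ (cong (λ v → proj₂ (proj₂ v)) eq)))

  entries : Mat K → ∀ {n} → Vec K n → Vec K (9 ℕ.+ n)
  entries ((a , b , c) , (d , e , f) , (g , h , i)) ρ = a ∷ b ∷ c ∷ d ∷ e ∷ f ∷ g ∷ h ∷ i ∷ ρ

  Nₚ : ∀ {n} → Mat (Polynomial (9 ℕ.+ n))
  Nₚ = (var (# 0) , var (# 1) , var (# 2)) , (var (# 3) , var (# 4) , var (# 5)) , (var (# 6) , var (# 7) , var (# 8))

  aₚ bₚ : ∀ {n} → Polynomial (11 ℕ.+ n)
  aₚ = var (# 9)
  bₚ = var (# 10)

  -- Both kinds of ray use one list of variables; for a ray at infinity the slot of `bₚ` is filled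
  -- by a second copy of `a`, which the polynomials do not mention.
  affineₚ infinityₚ : ∀ {n} → Ω (Polynomial (11 ℕ.+ n))
  affineₚ   = inj₁ (aₚ , bₚ)
  infinityₚ = inj₂ (inj₁ aₚ)

  lastₚ : ∀ {n} → Ω (Polynomial n)
  lastₚ = inj₂ (inj₂ 0F)

  Pₚ : Mat (Polynomial 20)
  Pₚ = (var (# 11) , var (# 12) , var (# 13)) , (var (# 14) , var (# 15) , var (# 16)) , (var (# 17) , var (# 18) , var (# 19))

  opaque
    unfolding conj unconj

    trace-conj : ∀ p N → trace (conj p N) ≡ trace N
    trace-conj (inj₁ (a , b)) N =
      prove (entries N (a ∷ b ∷ [])) (Sym.trace (Sym.conj affineₚ Nₚ)) (Sym.trace Nₚ) refl
    trace-conj (inj₂ (inj₁ a)) N =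
      prove (entries N (a ∷ a ∷ [])) (Sym.trace (Sym.conj infinityₚ Nₚ)) (Sym.trace Nₚ) refl
    trace-conj (inj₂ (inj₂ 0F))   N = prove (entries N []) (Sym.trace (Sym.conj lastₚ Nₚ)) (Sym.trace Nₚ) refl

    quad-conj : ∀ p N → quad (conj p N) ≡ quad N
    quad-conj (inj₁ (a , b))     N = prove (entries N (a ∷ b ∷ [])) (Sym.quad (Sym.conj affineₚ Nₚ)) (Sym.quad Nₚ) refl
    quad-conj (inj₂ (inj₁ a)) N =
      prove (entries N (a ∷ a ∷ [])) (Sym.quad (Sym.conj infinityₚ Nₚ)) (Sym.quad Nₚ) refl
    quad-conj (inj₂ (inj₂ 0F))   N = prove (entries N []) (Sym.quad (Sym.conj lastₚ Nₚ)) (Sym.quad Nₚ) refl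

    det-conj : ∀ p N → det (conj p N) ≡ det N
    det-conj (inj₁ (a , b))     N = prove (entries N (a ∷ b ∷ [])) (Sym.det (Sym.conj affineₚ Nₚ)) (Sym.det Nₚ) refl
    det-conj (inj₂ (inj₁ a))    N = prove (entries N (a ∷ a ∷ [])) (Sym.det (Sym.conj infinityₚ Nₚ)) (Sym.det Nₚ) refl
    det-conj (inj₂ (inj₂ 0F))   N = prove (entries N []) (Sym.det (Sym.conj lastₚ Nₚ)) (Sym.det Nₚ) refl

    trace-unconj : ∀ p P N → trace (P · unconj p N) ≡ trace (conj p P · N)
    trace-unconj (inj₁ (a , b)) P N =
      prove (entries N (a ∷ b ∷ entries P [])) (Sym.trace (Pₚ Sym.· Sym.unconj affineₚ Nₚ)) (Sym.trace (Sym.conj affineₚ Pₚ Sym.· Nₚ)) refl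
    trace-unconj (inj₂ (inj₁ a)) P N =
      prove (entries N (a ∷ a ∷ entries P [])) (Sym.trace (Pₚ Sym.· Sym.unconj infinityₚ Nₚ)) (Sym.trace (Sym.conj infinityₚ Pₚ Sym.· Nₚ)) refl
    trace-unconj (inj₂ (inj₂ 0F)) P N =
      prove (entries N (0# ∷ 0# ∷ entries P [])) (Sym.trace (Pₚ Sym.· Sym.unconj lastₚ Nₚ)) (Sym.trace (Sym.conj lastₚ Pₚ Sym.· Nₚ)) refl

    conj-unconj : ∀ p N → conj p (unconj p N) ≡ N
    conj-unconj (inj₁ (a , b)) N =
      prove-M (entries N (a ∷ b ∷ [])) (Sym.conj affineₚ (Sym.unconj affineₚ Nₚ)) Nₚ refl
    conj-unconj (inj₂ (inj₁ a)) N =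
      prove-M (entries N (a ∷ a ∷ [])) (Sym.conj infinityₚ (Sym.unconj infinityₚ Nₚ)) Nₚ refl
    conj-unconj (inj₂ (inj₂ 0F))   N = prove-M (entries N []) (Sym.conj lastₚ (Sym.unconj lastₚ Nₚ)) Nₚ refl

    unconj-conj : ∀ p N → unconj p (conj p N) ≡ N
    unconj-conj (inj₁ (a , b)) N =
      prove-M (entries N (a ∷ b ∷ [])) (Sym.unconj affineₚ (Sym.conj affineₚ Nₚ)) Nₚ refl
    unconj-conj (inj₂ (inj₁ a)) N =
      prove-M (entries N (a ∷ a ∷ [])) (Sym.unconj infinityₚ (Sym.conj infinityₚ Nₚ)) Nₚ refl
    unconj-conj (inj₂ (inj₂ 0F))   N = prove-M (entries N []) (Sym.unconj lastₚ (Sym.conj lastₚ Nₚ)) Nₚ refl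

  -- Counting points of the projective plane

  card-K : card K ≡ q
  card-K = card-Fin q

  count-root : ∀ {α} β → α ≢ 0# → ∑ {A = K} (λ x → ι (α * x + β ≟ 0#)) ≡ 1
  count-root {α} β α≢0 = ∑-ι-unique (λ x → α * x + β ≟ 0#) (- (β * inv α))
    (drop₁ (- β) (x≡y⇒x-y≡0 (inv-r α≢0))
      (solve 3 (λ α β i → α :* :- (β :* i) :+ β := 0ₚ :+ :- β :* (α :* i :- 1ₚ)) refl α β (inv α)))
    (λ x e → *-cancelˡ α≢0 (drop₁ 1# e (drop₁ β (x≡y⇒x-y≡0 (inv-r α≢0))
      (solve 4 (λ α β i x → α :* x := α :* :- (β :* i) :+ 1ₚ :* (α :* x :+ β) :+ β :* (α :* i :- 1ₚ)) refl α β (inv α) x))))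

  count-line : ∀ {α β} γ → α ≢ 0# ⊎ β ≢ 0# →
               ∑ {A = K × K} (λ (x , y) → ι ((α * x + β * y) + γ ≟ 0#)) ≡ q
  count-line {α} {β} γ (inj₂ β≢0) = begin
    ∑ {A = K × K} (λ (x , y) → ι ((α * x + β * y) + γ ≟ 0#))
      ≡⟨ ∑-× {A = K} {B = K} _ ⟩
    ∑ {A = K} (λ x → ∑ {A = K} (λ y → ι ((α * x + β * y) + γ ≟ 0#)))
      ≡⟨ ∑-cong {A = K} (λ x → trans
           (∑-cong {A = K} (λ y → cong (λ z → ι (z ≟ 0#))
             (solve 5 (λ α x β y γ → α :* x :+ β :* y :+ γ := β :* y :+ (α :* x :+ γ)) refl α x β y γ)))
           (count-root (α * x + γ) β≢0)) ⟩
    card K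
      ≡⟨ card-K ⟩
    q ∎
  count-line {α} {β} γ (inj₁ α≢0) = begin
    ∑ {A = K × K} (λ (x , y) → ι ((α * x + β * y) + γ ≟ 0#))
      ≡⟨ trans (∑-× {A = K} {B = K} _) (∑-comm {A = K} {B = K} _) ⟩
    ∑ {A = K} (λ y → ∑ {A = K} (λ x → ι ((α * x + β * y) + γ ≟ 0#)))
      ≡⟨ ∑-cong {A = K} (λ y → trans
           (∑-cong {A = K} (λ x → cong (λ z → ι (z ≟ 0#))
             (solve 5 (λ α x β y γ → α :* x :+ β :* y :+ γ := α :* x :+ (β :* y :+ γ)) refl α x β y γ)))
           (count-root (β * y + γ) α≢0)) ⟩
    card K
      ≡⟨ card-K ⟩
    q ∎

  ∑-Ω : (f : Ω K → ℕ) → ∑ f ≡ ∑ (λ ab → f (inj₁ ab)) ℕ.+ (∑ (λ a → f (inj₂ (inj₁ a))) ℕ.+ f (inj₂ (inj₂ 0F)))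
  ∑-Ω f = trans (∑-⊎ {A = K × K} {B = K ⊎ Fin 1} f) (cong (∑ (λ ab → f (inj₁ ab)) ℕ.+_)
    (trans (∑-⊎ {A = K} {B = Fin 1} _) (cong (∑ (λ a → f (inj₂ (inj₁ a))) ℕ.+_) (∑-Fin₁ (λ i → f (inj₂ (inj₂ i)))))))

  card-Ω : card (Ω K) ≡ q ℕ.* q ℕ.+ (q ℕ.+ 1)
  card-Ω = trans (∑-Ω (λ _ → 1)) (cong₂ ℕ._+_ (trans (card-× {A = K} {B = K}) (cong₂ ℕ._*_ card-K card-K))
                                           (cong (ℕ._+ 1) card-K))

  -- A line has `q` affine points and one point at infinity, except the line at infinity, which
  -- consists of the `q + 1` points there.
  count-on-line : ∀ {r} → r ≢ 𝟎 → ∑ (λ p → ι (dot r (ray p) ≟ 0#)) ≡ q ℕ.+ 1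
  count-on-line {r@(α , β , γ)} r≢𝟎 = trans (∑-Ω _) (by-cases (α ≟ 0#) (β ≟ 0#))
    where
    affine = ∑ {A = K × K} (λ ab → ι (dot r (ray (inj₁ ab)) ≟ 0#))
    affine′ : α ≢ 0# ⊎ β ≢ 0# → affine ≡ q
    affine′ h = trans (∑-cong {A = K × K} (λ (a , b) → cong (λ z → ι (z ≟ 0#))
      (solve 5 (λ α a β b γ → α :* a :+ β :* b :+ γ :* 1ₚ := α :* a :+ β :* b :+ γ) refl α a β b γ)))
      (count-line γ h)
    at-infinity : ∀ a → dot r (ray (inj₂ (inj₁ a))) ≡ α * a + β
    at-infinity a = solve 4 (λ α a β γ → α :* a :+ β :* 1ₚ :+ γ :* 0ₚ := α :* a :+ β) refl α a β γ
    last-point : dot r (ray (inj₂ (inj₂ 0F))) ≡ α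
    last-point = solve 3 (λ α β γ → α :* 1ₚ :+ β :* 0ₚ :+ γ :* 0ₚ := α) refl α β γ
    by-cases : Dec (α ≡ 0#) → Dec (β ≡ 0#) → affine ℕ.+
               (∑ {A = K} (λ a → ι (dot r (ray (inj₂ (inj₁ a))) ≟ 0#)) ℕ.+ ι (dot r (ray (inj₂ (inj₂ 0F))) ≟ 0#)) ≡ q ℕ.+ 1
    by-cases (no α≢0) _ = cong₂ ℕ._+_ (affine′ (inj₁ α≢0)) (cong₂ ℕ._+_
      (trans (∑-cong {A = K} (λ a → cong (λ z → ι (z ≟ 0#)) (at-infinity a))) (count-root β α≢0))
      (ι-no (_ ≟ 0#) (λ e → α≢0 (trans (sym last-point) e))))
    by-cases (yes refl) (no β≢0) = cong₂ ℕ._+_ (affine′ (inj₂ β≢0)) (cong₂ ℕ._+_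
      (∑-ι-none (λ a → dot r (ray (inj₂ (inj₁ a))) ≟ 0#) (λ a e → β≢0 (trans
        (solve 2 (λ a β → β := 0ₚ :* a :+ β) refl a β) (trans (sym (at-infinity a)) e))))
      (ι-yes (dot r (ray (inj₂ (inj₂ 0F))) ≟ 0#) last-point))
    by-cases (yes refl) (yes refl) = cong₂ ℕ._+_
      (∑-ι-none (λ ab → dot r (ray (inj₁ ab)) ≟ 0#) (λ (a , b) e → r≢𝟎 (cong (λ z → 0# , 0# , z) (trans
        (solve 3 (λ a b γ → γ := 0ₚ :* a :+ 0ₚ :* b :+ γ :* 1ₚ) refl a b γ) e))))
      (cong₂ ℕ._+_ (trans (∑-ι-all (λ a → dot r (ray (inj₂ (inj₁ a))) ≟ 0#)
          (λ a → trans (at-infinity a) (solve 1 (λ a → 0ₚ :* a :+ 0ₚ := 0ₚ) refl a))) card-K)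
        (ι-yes (dot r (ray (inj₂ (inj₂ 0F))) ≟ 0#) last-point))

  div : ∀ {w a b c} → w ≢ 0# → w * b ≡ c * a → b ≡ (a * inv w) * c
  div {w} {a} {b} {c} w≢0 e = *-cancelˡ w≢0 (trans e (drop₁ (- (c * a)) (x≡y⇒x-y≡0 (inv-r w≢0))
    (solve 4 (λ w a c i → c :* a := w :* (a :* i :* c) :+ :- (c :* a) :* (w :* i :- 1ₚ)) refl w a c (inv w))))

  cross-zero : ∀ {r s} → cross r s ≡ 𝟎 → ∀ j l → r ! j * s ! l ≡ r ! l * s ! j
  cross-zero e 0F 0F = refl
  cross-zero e 1F 1F = refl
  cross-zero e 2F 2F = refl
  cross-zero e 1F 2F = x-y≡0⇒x≡y (cong proj₁ e)
  cross-zero e 2F 1F = sym (x-y≡0⇒x≡y (cong proj₁ e))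
  cross-zero e 2F 0F = x-y≡0⇒x≡y (cong (proj₁ ∘ proj₂) e)
  cross-zero e 0F 2F = sym (x-y≡0⇒x≡y (cong (proj₁ ∘ proj₂) e))
  cross-zero e 0F 1F = x-y≡0⇒x≡y (cong (proj₂ ∘ proj₂) e)
  cross-zero e 1F 0F = sym (x-y≡0⇒x≡y (cong (proj₂ ∘ proj₂) e))

  zero-cross : ∀ {r s} → (∀ j l → r ! j * s ! l ≡ r ! l * s ! j) → cross r s ≡ 𝟎
  zero-cross h = cong₂ _,_ (x≡y⇒x-y≡0 (h 1F 2F)) (cong₂ _,_ (x≡y⇒x-y≡0 (h 2F 0F)) (x≡y⇒x-y≡0 (h 0F 1F)))

  nonzero-entry : ∀ {w : V K} → w ≢ 𝟎 → ∃ λ i → w ! i ≢ 0#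
  nonzero-entry {w} w≢𝟎 = Fin.¬∀⟶∃¬ 3 (λ i → w ! i ≡ 0#) (λ i → w ! i ≟ 0#)
    (λ h → w≢𝟎 (cong₂ _,_ (h 0F) (cong₂ _,_ (h 1F) (h 2F))))

  scale-! : ∀ t u i → scale t u ! i ≡ t * u ! i
  scale-! t u 0F = refl
  scale-! t u 1F = refl
  scale-! t u 2F = refl

  parallel : ∀ {w a} → w ≢ 𝟎 → cross w a ≡ 𝟎 → ∃ λ t → a ≡ scale t w
  parallel {w} {a} w≢𝟎 e with nonzero-entry w≢𝟎
  ... | i , wᵢ≢0 = a ! i * inv (w ! i) , V-ext (λ j → trans (div wᵢ≢0 (cross-zero e i j)) (sym (scale-! _ w j)))

  scale-cross : ∀ t w → cross w (scale t w) ≡ 𝟎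
  scale-cross t w = zero-cross (λ j l → trans (cong (w ! j *_) (scale-! t w l)) (trans
    (solve 3 (λ x y t → x :* (t :* y) := y :* (t :* x)) refl (w ! j) (w ! l) t)
    (cong (w ! l *_) (sym (scale-! t w j)))))

  cross-sym : ∀ {u v} → cross u v ≡ 𝟎 → cross v u ≡ 𝟎
  cross-sym {u} {v} e = zero-cross (λ j l → trans (*-comm (v ! j) (u ! l)) (trans (cross-zero e l j) (*-comm (u ! j) (v ! l))))

  ray-multiple? : ∀ w p → Dec (cross w (ray p) ≡ 𝟎)
  ray-multiple? w p = cross w (ray p) ≟ 𝟎

  private
    1≢t0 : ∀ {t} → 1# ≢ t * 0#
    1≢t0 {t} e = 1≢0 (trans e (zeroʳ t))

    t≡inv : ∀ {t z} → 1# ≡ t * z → t ≡ inv z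
    t≡inv {t} {z} e = *-cancelˡ z≢0 (trans (*-comm z t) (trans (sym e) (sym (inv-r z≢0))))
      where z≢0 = unit≢0 (trans (*-comm z t) (sym e))

    0≢t : ∀ {t z x} → z ≢ 0# → 0# ≡ t * z → 1# ≢ t * x
    0≢t {t} {z} {x} z≢0 e e′ = 1≢0 (trans e′ (trans (cong (_* x)
      (*-cancel₀ z≢0 (trans (*-comm z t) (sym e)))) (zeroˡ x)))

  count-parallel : ∀ {w} → w ≢ 𝟎 → ∑ (λ p → ι (ray-multiple? w p)) ≡ 1
  count-parallel {w@(x , y , z)} w≢𝟎 = by-cases (z ≟ 0#) (y ≟ 0#)
    where
    solution : ∀ p t → scale t w ≡ ray p → cross w (ray p) ≡ 𝟎
    solution p t e = subst (λ v → cross w v ≡ 𝟎) e (scale-cross t w)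
    inv-l : ∀ {u} → u ≢ 0# → inv u * u ≡ 1#
    inv-l {u} u≢0 = trans (*-comm (inv u) u) (inv-r u≢0)
    by-cases : Dec (z ≡ 0#) → Dec (y ≡ 0#) → ∑ (λ p → ι (ray-multiple? w p)) ≡ 1
    by-cases (no z≢0) _ = ∑-ι-unique (ray-multiple? w) (inj₁ (inv z * x , inv z * y))
      (solution (inj₁ (inv z * x , inv z * y)) (inv z) (cong (λ u → inv z * x , inv z * y , u) (inv-l z≢0))) (λ p e → uniq p (parallel {w} {ray p} w≢𝟎 e))
      where
      uniq : ∀ p → (∃ λ t → ray p ≡ scale t w) → p ≡ inj₁ (inv z * x , inv z * y)
      uniq (inj₁ (a , b)) (t , e) = cong₂ (λ u v → inj₁ (u , v))
        (trans (cong proj₁ e) (cong (_* x) t≡)) (trans (cong (proj₁ ∘ proj₂) e) (cong (_* y) t≡))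
        where t≡ = t≡inv (cong (proj₂ ∘ proj₂) e)
      uniq (inj₂ (inj₁ a))  (t , e) = ⊥-elim (0≢t z≢0 (cong (proj₂ ∘ proj₂) e) (cong (proj₁ ∘ proj₂) e))
      uniq (inj₂ (inj₂ 0F)) (t , e) = ⊥-elim (0≢t z≢0 (cong (proj₂ ∘ proj₂) e) (cong proj₁ e))
    by-cases (yes refl) (no y≢0) = ∑-ι-unique (ray-multiple? w) (inj₂ (inj₁ (inv y * x)))
      (solution (inj₂ (inj₁ (inv y * x))) (inv y) (cong₂ (λ u v → inv y * x , u , v) (inv-l y≢0) (zeroʳ _))) (λ p e → uniq p (parallel {w} {ray p} w≢𝟎 e))
      where
      uniq : ∀ p → (∃ λ t → ray p ≡ scale t w) → p ≡ inj₂ (inj₁ (inv y * x))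
      uniq (inj₁ (a , b))   (t , e) = ⊥-elim (1≢t0 (cong (proj₂ ∘ proj₂) e))
      uniq (inj₂ (inj₁ a))  (t , e) = cong (λ u → inj₂ (inj₁ u))
        (trans (cong proj₁ e) (cong (_* x) (t≡inv (cong (proj₁ ∘ proj₂) e))))
      uniq (inj₂ (inj₂ 0F)) (t , e) = ⊥-elim (0≢t y≢0 (cong (proj₁ ∘ proj₂) e) (cong proj₁ e))
    by-cases (yes refl) (yes refl) = ∑-ι-unique (ray-multiple? w) (inj₂ (inj₂ 0F))
      (solution (inj₂ (inj₂ 0F)) (inv x) (cong₂ _,_ (inv-l x≢0) (cong₂ _,_ (zeroʳ _) (zeroʳ _)))) (λ p e → uniq p (parallel {w} {ray p} w≢𝟎 e))
      where
      x≢0 : x ≢ 0#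
      x≢0 x≡0 = w≢𝟎 (cong (_, 0# , 0#) x≡0)
      uniq : ∀ p → (∃ λ t → ray p ≡ scale t w) → p ≡ inj₂ (inj₂ 0F)
      uniq (inj₁ (a , b))   (t , e) = ⊥-elim (1≢t0 (cong (proj₂ ∘ proj₂) e))
      uniq (inj₂ (inj₁ a))  (t , e) = ⊥-elim (1≢t0 (cong (proj₁ ∘ proj₂) e))
      uniq (inj₂ (inj₂ 0F)) (t , e) = refl

  -- The triple product expansion `(r × s) × a = (r · a) s - (s · a) r`: a vector killed by two rows
  -- is parallel to their cross product.
  kernel-line : ∀ {r s a} → dot r a ≡ 0# → dot s a ≡ 0# → cross (cross r s) a ≡ 𝟎
  kernel-line {r} {s} {a} e₁ e₂ = V-ext {u = cross (cross r s) a} {v = 𝟎} λ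
    { 0F → drop (s ! 0F) (r ! 0F) (cong proj₁ (expand r s a))
    ; 1F → drop (s ! 1F) (r ! 1F) (cong (proj₁ ∘ proj₂) (expand r s a))
    ; 2F → drop (s ! 2F) (r ! 2F) (cong (proj₂ ∘ proj₂) (expand r s a)) }
    where
    drop : ∀ {x} b c → x ≡ (0# + b * dot r a) + c * (- dot s a) → x ≡ 0#
    drop b c e = drop₁ b e₁ (drop₁ c (trans (cong -_ e₂) (solve 0 (:- 0ₚ := 0ₚ) refl)) e)
    expand : ∀ r s a → cross (cross r s) a ≡
             mapV (λ x → x) (((0# + proj₁ s * dot r a) + proj₁ r * (- dot s a)) ,
               ((0# + proj₁ (proj₂ s) * dot r a) + proj₁ (proj₂ r) * (- dot s a)) ,
               ((0# + proj₂ (proj₂ s) * dot r a) + proj₂ (proj₂ r) * (- dot s a)))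
    expand r s a = prove-V (entries (r , s , a) [])
      (Sym.cross (Sym.cross rₚ sₚ) tₚ)
      ((0ₚ :+ proj₁ sₚ :* Sym.dot rₚ tₚ :+ proj₁ rₚ :* (:- Sym.dot sₚ tₚ)) ,
       (0ₚ :+ proj₁ (proj₂ sₚ) :* Sym.dot rₚ tₚ :+ proj₁ (proj₂ rₚ) :* (:- Sym.dot sₚ tₚ)) ,
       (0ₚ :+ proj₂ (proj₂ sₚ) :* Sym.dot rₚ tₚ :+ proj₂ (proj₂ rₚ) :* (:- Sym.dot sₚ tₚ))) refl
      where
      rₚ sₚ tₚ : V (Polynomial 9)
      rₚ = proj₁ Nₚ
      sₚ = proj₁ (proj₂ Nₚ)
      tₚ = proj₂ (proj₂ Nₚ)

  -- Rays in the kernel of a matrix, and rays containing its image.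

  Nil : Mat K → Set
  Nil N = trace N ≡ 0# × quad N ≡ 0# × det N ≡ 0#

  Kills : Mat K → V K → Set
  Kills N a = apply N a ≡ 𝟎

  -- Encodes `N a = 0` together with `im N ⊆ ⟨a⟩` for nonzero `a`: the second condition makes `N` a
  -- product `a ⊗ s`, and then the first one is `s · a = 0`.
  Squeezes : Mat K → V K → Set
  Squeezes N a = ∃ λ s → N ≡ outer a s × dot s a ≡ 0#

  outer-! : ∀ u v i j → outer u v ! i ! j ≡ u ! i * v ! j
  outer-! u v 0F j = scale-! (u ! 0F) v j
  outer-! u v 1F j = scale-! (u ! 1F) v j
  outer-! u v 2F j = scale-! (u ! 2F) v j

  apply-! : ∀ N a i → apply N a ! i ≡ dot (N ! i) a
  apply-! N a 0F = refl
  apply-! N a 1F = refl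
  apply-! N a 2F = refl

  𝟎-! : ∀ i → 𝟎 ! i ≡ 0#
  𝟎-! 0F = refl
  𝟎-! 1F = refl
  𝟎-! 2F = refl

  dot-scaleˡ : ∀ t u a → dot (scale t u) a ≡ t * dot u a
  dot-scaleˡ t (u₁ , u₂ , u₃) (a₁ , a₂ , a₃) = solve 7 (λ t u₁ u₂ u₃ a₁ a₂ a₃ →
    t :* u₁ :* a₁ :+ t :* u₂ :* a₂ :+ t :* u₃ :* a₃ := t :* (u₁ :* a₁ :+ u₂ :* a₂ :+ u₃ :* a₃))
    refl t u₁ u₂ u₃ a₁ a₂ a₃

  dot-comm : ∀ u a → dot u a ≡ dot a u
  dot-comm (u₁ , u₂ , u₃) (a₁ , a₂ , a₃) =
    cong₂ _+_ (cong₂ _+_ (*-comm u₁ a₁) (*-comm u₂ a₂)) (*-comm u₃ a₃)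

  dot-𝟎 : ∀ u → dot u 𝟎 ≡ 0#
  dot-𝟎 (u₁ , u₂ , u₃) = solve 3 (λ u₁ u₂ u₃ → u₁ :* 0ₚ :+ u₂ :* 0ₚ :+ u₃ :* 0ₚ := 0ₚ) refl u₁ u₂ u₃

  apply-𝟎 : ∀ M → apply M 𝟎 ≡ 𝟎
  apply-𝟎 (r , s , t) = cong₂ _,_ (dot-𝟎 r) (cong₂ _,_ (dot-𝟎 s) (dot-𝟎 t))

  scale-!≡ : ∀ t w {a} → a ≡ scale t w → ∀ i → a ! i ≡ t * w ! i
  scale-!≡ t w refl = scale-! t w

  ray≢𝟎 : ∀ p → ray p ≢ 𝟎
  ray≢𝟎 (inj₁ (a , b))     e = 1≢0 (cong (proj₂ ∘ proj₂) e)
  ray≢𝟎 (inj₂ (inj₁ a))    e = 1≢0 (cong (proj₁ ∘ proj₂) e)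
  ray≢𝟎 (inj₂ (inj₂ 0F))   e = 1≢0 (cong proj₁ e)

  -- `Squeezes` at the third basis vector; only the first two entries of the last row remain free.
  Corner : Mat K → Set
  Corner (r , s , t) = r ≡ 𝟎 × s ≡ 𝟎 × t ! 2F ≡ 0#

  corner? : ∀ N → Dec (Corner N)
  corner? (r , s , t) = (r ≟ 𝟎) ×-dec (s ≟ 𝟎) ×-dec (t ! 2F ≟ 0#)

  kills? : ∀ N → Dec (col₃ N ≡ 𝟎)
  kills? N = col₃ N ≟ 𝟎

  opaque
    unfolding conj unconj

    col₃-conj : ∀ p N → col₃ (conj p N) ≡ apply (frame⁻¹ p) (apply N (ray p))
    col₃-conj (inj₁ (a , b)) N =
      prove-V (entries N (a ∷ b ∷ [])) (Sym.col₃ (Sym.conj affineₚ Nₚ)) (Sym.apply (Sym.frame⁻¹ affineₚ) (Sym.apply Nₚ (Sym.ray affineₚ))) refl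
    col₃-conj (inj₂ (inj₁ a)) N =
      prove-V (entries N (a ∷ a ∷ [])) (Sym.col₃ (Sym.conj infinityₚ Nₚ)) (Sym.apply (Sym.frame⁻¹ infinityₚ) (Sym.apply Nₚ (Sym.ray infinityₚ))) refl
    col₃-conj (inj₂ (inj₂ 0F)) N =
      prove-V (entries N []) (Sym.col₃ (Sym.conj lastₚ Nₚ)) (Sym.apply (Sym.frame⁻¹ lastₚ) (Sym.apply Nₚ (Sym.ray lastₚ))) refl

    apply-ray : ∀ p N → apply N (ray p) ≡ apply (frame p) (col₃ (conj p N))
    apply-ray (inj₁ (a , b)) N =
      prove-V (entries N (a ∷ b ∷ [])) (Sym.apply Nₚ (Sym.ray affineₚ)) (Sym.apply (Sym.frame affineₚ) (Sym.col₃ (Sym.conj affineₚ Nₚ))) refl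
    apply-ray (inj₂ (inj₁ a)) N =
      prove-V (entries N (a ∷ a ∷ [])) (Sym.apply Nₚ (Sym.ray infinityₚ)) (Sym.apply (Sym.frame infinityₚ) (Sym.col₃ (Sym.conj infinityₚ Nₚ))) refl
    apply-ray (inj₂ (inj₂ 0F)) N =
      prove-V (entries N []) (Sym.apply Nₚ (Sym.ray lastₚ)) (Sym.apply (Sym.frame lastₚ) (Sym.col₃ (Sym.conj lastₚ Nₚ))) refl

  kills⇒ : ∀ p N → col₃ (conj p N) ≡ 𝟎 → Kills N (ray p)
  kills⇒ p N e = trans (apply-ray p N) (trans (cong (apply (frame p)) e) (apply-𝟎 (frame p)))

  kills⇐ : ∀ p N → Kills N (ray p) → col₃ (conj p N) ≡ 𝟎
  kills⇐ p N e = trans (col₃-conj p N) (trans (cong (apply (frame⁻¹ p)) e) (apply-𝟎 (frame⁻¹ p)))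

  opaque
    unfolding conj unconj

    conj-outer : ∀ p s → conj p (outer (ray p) s) ≡ (𝟎 , 𝟎 , apply (transpose (frame p)) s)
    conj-outer (inj₁ (a , b)) s = prove-M (entries (s , s , s) (a ∷ b ∷ []))
      (Sym.conj affineₚ (Sym.outer (Sym.ray affineₚ) (proj₁ Nₚ)))
      (Sym.𝟎 , Sym.𝟎 , Sym.apply (transpose (Sym.frame affineₚ)) (proj₁ Nₚ)) refl
    conj-outer (inj₂ (inj₁ a)) s = prove-M (entries (s , s , s) (a ∷ a ∷ []))
      (Sym.conj infinityₚ (Sym.outer (Sym.ray infinityₚ) (proj₁ Nₚ)))
      (Sym.𝟎 , Sym.𝟎 , Sym.apply (transpose (Sym.frame infinityₚ)) (proj₁ Nₚ)) refl
    conj-outer (inj₂ (inj₂ 0F)) s = prove-M (entries (s , s , s) [])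
      (Sym.conj lastₚ (Sym.outer (Sym.ray lastₚ) (proj₁ Nₚ)))
      (Sym.𝟎 , Sym.𝟎 , Sym.apply (transpose (Sym.frame lastₚ)) (proj₁ Nₚ)) refl

    unconj-corner : ∀ p c → unconj p (𝟎 , 𝟎 , c) ≡ outer (ray p) (apply (transpose (frame⁻¹ p)) c)
    unconj-corner (inj₁ (a , b)) s = prove-M (entries (s , s , s) (a ∷ b ∷ []))
      (Sym.unconj affineₚ (Sym.𝟎 , Sym.𝟎 , proj₁ Nₚ)) (Sym.outer (Sym.ray affineₚ) (Sym.apply (transpose (Sym.frame⁻¹ affineₚ)) (proj₁ Nₚ))) refl
    unconj-corner (inj₂ (inj₁ a)) s = prove-M (entries (s , s , s) (a ∷ a ∷ []))
      (Sym.unconj infinityₚ (Sym.𝟎 , Sym.𝟎 , proj₁ Nₚ)) (Sym.outer (Sym.ray infinityₚ) (Sym.apply (transpose (Sym.frame⁻¹ infinityₚ)) (proj₁ Nₚ))) refl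
    unconj-corner (inj₂ (inj₂ 0F)) s = prove-M (entries (s , s , s) [])
      (Sym.unconj lastₚ (Sym.𝟎 , Sym.𝟎 , proj₁ Nₚ)) (Sym.outer (Sym.ray lastₚ) (Sym.apply (transpose (Sym.frame⁻¹ lastₚ)) (proj₁ Nₚ))) refl

  frame-ray : ∀ p → proj₂ (proj₂ (transpose (frame p))) ≡ ray p
  frame-ray (inj₁ _)         = refl
  frame-ray (inj₂ (inj₁ _))  = refl
  frame-ray (inj₂ (inj₂ 0F)) = refl

  squeezes⇐ : ∀ p {N} → Squeezes N (ray p) → Corner (conj p N)
  squeezes⇐ p (s , refl , e) = subst Corner (sym (conj-outer p s))
    (refl , refl , trans (dot-comm (proj₂ (proj₂ (transpose (frame p)))) s) (trans (cong (dot s) (frame-ray p)) e))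

  squeezes⇒ : ∀ p N → Corner (conj p N) → Squeezes N (ray p)
  squeezes⇒ p N (e₁ , e₂ , e₃) = s , N≡ , (begin
      dot s (ray p)                             ≡⟨ cong (dot s) (sym (frame-ray p)) ⟩
      dot s (proj₂ (proj₂ (transpose (frame p))))   ≡⟨ dot-comm s _ ⟩
      dot (proj₂ (proj₂ (transpose (frame p)))) s   ≡⟨ cong (λ M → M ! 2F ! 2F) (sym (trans (cong (conj p) N≡) (conj-outer p s))) ⟩
      conj p N ! 2F ! 2F                        ≡⟨ e₃ ⟩
      0#                                        ∎)
    where
    s = apply (transpose (frame⁻¹ p)) (conj p N ! 2F)
    N≡ : N ≡ outer (ray p) s
    N≡ = trans (sym (unconj-conj p N)) (trans
      (cong (unconj p) (cong₂ (λ u v → u , v , conj p N ! 2F) e₁ e₂)) (unconj-corner p (conj p N ! 2F)))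

  trace-outer : ∀ u v → trace (outer u v) ≡ dot v u
  trace-outer (u₁ , u₂ , u₃) (v₁ , v₂ , v₃) =
    cong₂ _+_ (cong₂ _+_ (*-comm u₁ v₁) (*-comm u₂ v₂)) (*-comm u₃ v₃)

  apply-outer : ∀ u v a → apply (outer u v) a ≡ scale (dot v a) u
  apply-outer (u₁ , u₂ , u₃) v a = cong₂ _,_ (comm u₁) (cong₂ _,_ (comm u₂) (comm u₃))
    where
    comm : ∀ u → dot (scale u v) a ≡ dot v a * u
    comm u = trans (dot-scaleˡ u v a) (*-comm u _)

  M-ext : ∀ {M N : Mat K} → (∀ i j → M ! i ! j ≡ N ! i ! j) → M ≡ N
  M-ext h = V-ext (λ i → V-ext (h i))

  -- The kernel of `u ⊗ v` is the line with coordinates `v`, of `q + 1` points, while its image is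
  -- the single ray of `u`, which the vanishing trace puts on that line.
  module RankOne {u v : V K} (u≢𝟎 : u ≢ 𝟎) (v≢𝟎 : v ≢ 𝟎) (v·u≡0 : dot v u ≡ 0#) where

    kills-count : ∑ (λ p → ι (kills? (conj p (outer u v)))) ≡ q ℕ.+ 1
    kills-count = trans (∑-cong {A = Ω K} (λ p → ι-cong (kills? (conj p (outer u v))) (dot v (ray p) ≟ 0#)
      (λ e → zero-dot (trans (sym (apply-outer u v (ray p))) (kills⇒ p (outer u v) e)))
      (λ e → kills⇐ p (outer u v) (trans (apply-outer u v (ray p)) (trans (cong (λ t → scale t u) e)
        (cong₂ _,_ (zeroˡ _) (cong₂ _,_ (zeroˡ _) (zeroˡ _))))))))
      (count-on-line v≢𝟎)
      where
      zero-dot : ∀ {t} → scale t u ≡ 𝟎 → t ≡ 0#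
      zero-dot {t} e with nonzero-entry u≢𝟎
      ... | i , uᵢ≢0 = *-cancel₀ uᵢ≢0 (trans (*-comm _ t) (trans (sym (scale-! t u i)) (trans (cong (_! i) e) (𝟎-! i))))

    squeezes⇒parallel : ∀ {a} → Squeezes (outer u v) a → cross u a ≡ 𝟎
    squeezes⇒parallel {a} (s , e , _) with nonzero-entry v≢𝟎
    ... | l , vₗ≢0 = zero-cross {u} {a} λ j k → *-cancelˡ vₗ≢0 (begin
        v ! l * (u ! j * a ! k)  ≡⟨ swap (v ! l) (u ! j) (a ! k) ⟩
        (u ! j * v ! l) * a ! k  ≡⟨ cong (_* a ! k) (at j l) ⟩
        (a ! j * s ! l) * a ! k  ≡⟨ solve 3 (λ x y z → x :* y :* z := z :* y :* x) refl (a ! j) (s ! l) (a ! k) ⟩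
        (a ! k * s ! l) * a ! j  ≡⟨ cong (_* a ! j) (sym (at k l)) ⟩
        (u ! k * v ! l) * a ! j  ≡⟨ sym (swap (v ! l) (u ! k) (a ! j)) ⟩
        v ! l * (u ! k * a ! j)  ∎)
      where
      at : ∀ j l → u ! j * v ! l ≡ a ! j * s ! l
      at j l = trans (sym (outer-! u v j l)) (trans (cong (λ M → M ! j ! l) e) (outer-! a s j l))
      swap : ∀ x y z → x * (y * z) ≡ (y * x) * z
      swap x y z = solve 3 (λ x y z → x :* (y :* z) := y :* x :* z) refl x y z

    parallel⇒squeezes : ∀ {a} → a ≢ 𝟎 → cross u a ≡ 𝟎 → Squeezes (outer u v) a
    parallel⇒squeezes {a} a≢𝟎 e = scale t v ,
      M-ext {outer u v} {outer a (scale t v)} (λ i j → trans (outer-! u v i j) (trans (trans (cong (_* v ! j) (scale-!≡ t a u≡ta i))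
        (solve 3 (λ t x y → t :* x :* y := x :* (t :* y)) refl t (a ! i) (v ! j)))
        (sym (trans (outer-! a (scale t v) i j) (cong (a ! i *_) (scale-! t v j)))))) ,
      (begin
        dot (scale t v) a   ≡⟨ dot-scaleˡ t v a ⟩
        t * dot v a         ≡⟨ cong (t *_) (dot-comm v a) ⟩
        t * dot a v         ≡⟨ sym (dot-scaleˡ t a v) ⟩
        dot (scale t a) v   ≡⟨ cong (λ z → dot z v) (sym u≡ta) ⟩
        dot u v             ≡⟨ dot-comm u v ⟩
        dot v u             ≡⟨ v·u≡0 ⟩
        0#                  ∎)
      where
      t    = proj₁ (parallel {a} {u} a≢𝟎 (cross-sym {u} {a} e))
      u≡ta = proj₂ (parallel {a} {u} a≢𝟎 (cross-sym {u} {a} e))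

    squeezes-count : ∑ (λ p → ι (corner? (conj p (outer u v)))) ≡ 1
    squeezes-count = trans (∑-cong {A = Ω K} (λ p → ι-cong (corner? (conj p (outer u v))) (ray-multiple? u p)
      (λ c → squeezes⇒parallel (squeezes⇒ p (outer u v) c))
      (λ e → squeezes⇐ p (parallel⇒squeezes (ray≢𝟎 p) e))))
      (count-parallel u≢𝟎)

  det-repeat : ∀ r s → dot (cross r s) r ≡ 0# × dot (cross r s) s ≡ 0#
  det-repeat (a , b , c) (d , e , f) =
    prove (a ∷ b ∷ c ∷ d ∷ e ∷ f ∷ []) (Sym.dot (Sym.cross r s) r) 0ₚ refl ,
    prove (a ∷ b ∷ c ∷ d ∷ e ∷ f ∷ []) (Sym.dot (Sym.cross r s) s) 0ₚ refl
    where
    r s : V (Polynomial 6)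
    r = var (# 0) , var (# 1) , var (# 2)
    s = var (# 3) , var (# 4) , var (# 5)

  on-kernel : ∀ {r w} → w ≢ 𝟎 → dot w r ≡ 0# → ∀ {a} → cross w a ≡ 𝟎 → dot r a ≡ 0#
  on-kernel {r} {w} w≢𝟎 e {a} e′ = begin
    dot r a               ≡⟨ cong (dot r) (proj₂ a∥w) ⟩
    dot r (scale t w)     ≡⟨ dot-comm r (scale t w) ⟩
    dot (scale t w) r     ≡⟨ dot-scaleˡ t w r ⟩
    t * dot w r           ≡⟨ cong (t *_) e ⟩
    t * 0#                ≡⟨ zeroʳ t ⟩
    0#                    ∎
    where
    a∥w = parallel {w} {a} w≢𝟎 e′
    t   = proj₁ a∥w

  squeezes-rows : ∀ {N a} → Squeezes N a → ∀ i j → cross (N ! i) (N ! j) ≡ 𝟎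
  squeezes-rows {a = a} (s , refl , _) i j = zero-cross {outer a s ! i} {outer a s ! j} λ k l → begin
    outer a s ! i ! k * outer a s ! j ! l   ≡⟨ cong₂ _*_ (outer-! a s i k) (outer-! a s j l) ⟩
    (a ! i * s ! k) * (a ! j * s ! l)
      ≡⟨ solve 4 (λ x y z w → x :* y :* (z :* w) := x :* w :* (z :* y)) refl (a ! i) (s ! k) (a ! j) (s ! l) ⟩
    (a ! i * s ! l) * (a ! j * s ! k)       ≡⟨ sym (cong₂ _*_ (outer-! a s i l) (outer-! a s j k)) ⟩
    outer a s ! i ! l * outer a s ! j ! k   ∎

  -- Two independent rows leave only the ray of their cross product `w` as a candidate for the
  -- kernel, and `det₀` says that the remaining row kills it too. A squeezed matrix has proportional
  -- rows, so there is none here.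
  module RankTwo {N : Mat K} {w : V K} (w≢𝟎 : w ≢ 𝟎) (i j : Fin 3) (w≡ : w ≡ cross (N ! i) (N ! j))
                 (det₀ : ∀ k → dot w (N ! k) ≡ 0#) where

    kills-count : ∑ (λ p → ι (kills? (conj p N))) ≡ 1
    kills-count = trans (∑-cong {A = Ω K} (λ p → ι-cong (kills? (conj p N)) (ray-multiple? w p)
      (λ e → let k = kills⇒ p N e in subst (λ w → cross w (ray p) ≡ 𝟎) (sym w≡) (kernel-line {N ! i} {N ! j} {ray p} (at {ray p} k i) (at {ray p} k j)))
      (λ e → kills⇐ p N (V-ext {u = apply N (ray p)} {v = 𝟎} (λ k → trans (apply-! N (ray p) k)
               (trans (on-kernel {N ! k} {w} w≢𝟎 (det₀ k) {ray p} e) (sym (𝟎-! k))))))))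
      (count-parallel w≢𝟎)
      where
      at : ∀ {a} → Kills N a → ∀ k → dot (N ! k) a ≡ 0#
      at {a} e k = trans (sym (apply-! N a k)) (trans (cong (_! k) e) (𝟎-! k))

    squeezes-count : ∑ (λ p → ι (corner? (conj p N))) ≡ 0
    squeezes-count = ∑-ι-none (λ p → corner? (conj p N))
      (λ p c → w≢𝟎 (trans w≡ (squeezes-rows {N} {ray p} (squeezes⇒ p N c) i j)))

  -- The kernel identity

  O : Mat K
  O = 𝟎 , 𝟎 , 𝟎

  scale-zeroˡ : ∀ v → scale 0# v ≡ 𝟎
  scale-zeroˡ (x , y , z) = cong₂ _,_ (zeroˡ x) (cong₂ _,_ (zeroˡ y) (zeroˡ z))

  scale-zeroʳ : ∀ t → scale t 𝟎 ≡ 𝟎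
  scale-zeroʳ t = cong₂ _,_ (zeroʳ t) (cong₂ _,_ (zeroʳ t) (zeroʳ t))

  dot-𝟎ˡ : ∀ a → dot 𝟎 a ≡ 0#
  dot-𝟎ˡ a = trans (dot-comm 𝟎 a) (dot-𝟎 a)

  outer-𝟎 : ∀ a → outer a 𝟎 ≡ O
  outer-𝟎 (a₁ , a₂ , a₃) = cong₂ _,_ (scale-zeroʳ a₁) (cong₂ _,_ (scale-zeroʳ a₂) (scale-zeroʳ a₃))

  kernelRays imageRays : Mat K → ℕ
  kernelRays N = ∑ (λ p → ι (kills? (conj p N)))
  imageRays N  = ∑ (λ p → ι (corner? (conj p N)))

  KernelIdentity : Mat K → Set
  KernelIdentity N = kernelRays N ℕ.+ q ℕ.* (q ℕ.* q) ℕ.* ι (N ≟ O) ≡ 1 ℕ.+ q ℕ.* imageRays N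

  private
    identity-O : KernelIdentity O
    identity-O = begin
      kernelRays O ℕ.+ q ℕ.* (q ℕ.* q) ℕ.* ι (O ≟ O)
        ≡⟨ cong₂ (λ s i → s ℕ.+ q ℕ.* (q ℕ.* q) ℕ.* i)
             (trans (∑-ι-all (λ p → kills? (conj p O)) (λ p → kills⇐ p O
               (cong₂ _,_ (dot-𝟎ˡ (ray p)) (cong₂ _,_ (dot-𝟎ˡ (ray p)) (dot-𝟎ˡ (ray p)))))) card-Ω)
             (ι-yes (O ≟ O) refl) ⟩
      q ℕ.* q ℕ.+ (q ℕ.+ 1) ℕ.+ q ℕ.* (q ℕ.* q) ℕ.* 1
        ≡⟨ all-rays q ⟩
      1 ℕ.+ q ℕ.* (q ℕ.* q ℕ.+ (q ℕ.+ 1))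
        ≡⟨ cong (λ s → 1 ℕ.+ q ℕ.* s) (sym (trans (∑-ι-all (λ p → corner? (conj p O))
             (λ p → squeezes⇐ p {O} (𝟎 , sym (outer-𝟎 (ray p)) , dot-𝟎ˡ (ray p)))) card-Ω)) ⟩
      1 ℕ.+ q ℕ.* imageRays O ∎

    finish : ∀ {N k m} → N ≢ O → kernelRays N ≡ k → imageRays N ≡ m → k ≡ 1 ℕ.+ q ℕ.* m → KernelIdentity N
    finish {N} {k} {m} N≢O e₁ e₂ e = begin
      kernelRays N ℕ.+ q ℕ.* (q ℕ.* q) ℕ.* ι (N ≟ O)
        ≡⟨ cong₂ (λ s i → s ℕ.+ q ℕ.* (q ℕ.* q) ℕ.* i) e₁ (ι-no (N ≟ O) N≢O) ⟩
      k ℕ.+ q ℕ.* (q ℕ.* q) ℕ.* 0    ≡⟨ trans (cong (k ℕ.+_) (ℕ.*-zeroʳ (q ℕ.* (q ℕ.* q)))) (ℕ.+-identityʳ k) ⟩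
      k                              ≡⟨ e ⟩
      1 ℕ.+ q ℕ.* m                  ≡⟨ cong (λ s → 1 ℕ.+ q ℕ.* s) (sym e₂) ⟩
      1 ℕ.+ q ℕ.* imageRays N        ∎

    identity-rank2 : ∀ {N w} → N ≢ O → w ≢ 𝟎 → ∀ i j → w ≡ cross (N ! i) (N ! j) →
                     (∀ k → dot w (N ! k) ≡ 0#) → KernelIdentity N
    identity-rank2 {N} {w} N≢O w≢𝟎 i j w≡ det₀ =
      finish N≢O R.kills-count R.squeezes-count (cong ℕ.suc (sym (ℕ.*-zeroʳ q)))
      where module R = RankTwo {N} {w} w≢𝟎 i j w≡ det₀

    column : Mat K → Fin 3 → V K
    column N j = mapV (_! j) N

    column-! : ∀ N j i → column N j ! i ≡ N ! i ! j
    column-! N j 0F = refl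
    column-! N j 1F = refl
    column-! N j 2F = refl

    -- With a nonzero entry `c` in row `i` and column `j`, the vanishing minors make `N` the product
    -- of column `j` and row `i`, divided by `c`.
    identity-rank1 : ∀ {N} → N ≢ O → trace N ≡ 0# → (∀ i k → cross (N ! i) (N ! k) ≡ 𝟎) → KernelIdentity N
    identity-rank1 {N} N≢O tr₀ minors = subst KernelIdentity (sym N≡)
      (finish (N≢O ∘ trans N≡) R.kills-count R.squeezes-count
        (trans (ℕ.+-comm q 1) (cong ℕ.suc (sym (ℕ.*-identityʳ q)))))
      where
      nonzero-row : ∃ λ i → N ! i ≢ 𝟎
      nonzero-row = Fin.¬∀⟶∃¬ 3 (λ i → N ! i ≡ 𝟎) (λ i → N ! i ≟ 𝟎)
        (λ h → N≢O (cong₂ _,_ (h 0F) (cong₂ _,_ (h 1F) (h 2F))))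
      i = proj₁ nonzero-row
      entry = nonzero-entry {N ! i} (proj₂ nonzero-row)
      j = proj₁ entry
      c≢0 = proj₂ entry
      c = N ! i ! j
      u v : V K
      u = column N j
      v = scale (inv c) (N ! i)
      N≡ : N ≡ outer u v
      N≡ = M-ext {N} {outer u v} λ k l → begin
        N ! k ! l                           ≡⟨ div c≢0 (trans (cross-zero {N ! i} {N ! k} (minors i k) j l) (*-comm (N ! i ! l) (N ! k ! j))) ⟩
        (N ! i ! l * inv c) * N ! k ! j     ≡⟨ solve 3 (λ x y z → x :* y :* z := z :* (y :* x)) refl (N ! i ! l) (inv c) (N ! k ! j) ⟩
        N ! k ! j * (inv c * N ! i ! l)     ≡⟨ cong₂ _*_ (sym (column-! N j k)) (sym (scale-! (inv c) (N ! i) l)) ⟩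
        u ! k * v ! l                       ≡⟨ sym (outer-! u v k l) ⟩
        outer u v ! k ! l                   ∎
      u≢𝟎 : u ≢ 𝟎
      u≢𝟎 e = c≢0 (trans (sym (column-! N j i)) (trans (cong (_! i) e) (𝟎-! i)))
      v≢𝟎 : v ≢ 𝟎
      v≢𝟎 e = *-nonzero (inv≢0 c≢0) c≢0 (trans (sym (scale-! (inv c) (N ! i) j)) (trans (cong (_! j) e) (𝟎-! j)))
      module R = RankOne {u} {v} u≢𝟎 v≢𝟎 (trans (sym (trace-outer u v)) (trans (cong trace (sym N≡)) tr₀))

  det-rotate : ∀ r s t → dot (cross s t) r ≡ dot (cross r s) t
  det-rotate r s t = prove (entries (r , s , t) [])
    (Sym.dot (Sym.cross (proj₁ (proj₂ Nₚ)) (proj₂ (proj₂ Nₚ))) (proj₁ Nₚ)) (Sym.det Nₚ) refl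

  -- The rank is read off the cross products of rows: a nonzero one means rank two, as the
  -- determinant is zero; if all vanish the rank is at most one. The identity then compares 1 with
  -- 0, `q + 1` with 1, or `q^2 + q + 1` with itself.
  kernel-identity : ∀ N → trace N ≡ 0# → det N ≡ 0# → KernelIdentity N
  kernel-identity N@(r , s , t) tr₀ det₀ = by-cases (N ≟ O) (cross r s ≟ 𝟎) (cross s t ≟ 𝟎) (cross t r ≟ 𝟎)
    where
    self : ∀ r → cross r r ≡ 𝟎
    self r = zero-cross {r} {r} (λ j l → *-comm (r ! j) (r ! l))
    by-cases : Dec (N ≡ O) → Dec (cross r s ≡ 𝟎) → Dec (cross s t ≡ 𝟎) → Dec (cross t r ≡ 𝟎) → KernelIdentity N
    by-cases (yes N≡O) _ _ _ = subst KernelIdentity (sym N≡O) identity-O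
    by-cases (no N≢O) (no w≢𝟎) _ _ = identity-rank2 {N} {cross r s} N≢O w≢𝟎 0F 1F refl λ
      { 0F → proj₁ (det-repeat r s) ; 1F → proj₂ (det-repeat r s) ; 2F → det₀ }
    by-cases (no N≢O) _ (no w≢𝟎) _ = identity-rank2 {N} {cross s t} N≢O w≢𝟎 1F 2F refl λ
      { 0F → trans (det-rotate r s t) det₀ ; 1F → proj₁ (det-repeat s t) ; 2F → proj₂ (det-repeat s t) }
    by-cases (no N≢O) _ _ (no w≢𝟎) = identity-rank2 {N} {cross t r} N≢O w≢𝟎 2F 0F refl λ
      { 0F → proj₂ (det-repeat t r) ; 1F → trans (det-rotate s t r) (trans (det-rotate r s t) det₀)
      ; 2F → proj₁ (det-repeat t r) }
    by-cases (no N≢O) (yes e₁) (yes e₂) (yes e₃) = identity-rank1 {N} N≢O tr₀ λ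
      { 0F 0F → self r ; 1F 1F → self s ; 2F 2F → self t
      ; 0F 1F → e₁ ; 1F 0F → cross-sym {r} {s} e₁
      ; 1F 2F → e₂ ; 2F 1F → cross-sym {s} {t} e₂
      ; 2F 0F → e₃ ; 0F 2F → cross-sym {t} {r} e₃ }

  -- Plane sections of the cone

  -- Inclusion and exclusion for two lines meeting only in the origin, which is the 1 on the left.
  -- The summands `0#` match the shape of `count-line`.
  count-two-lines : ∀ {a b c d} → a * d - b * c ≢ 0# →
    ∑ {A = K × K} (λ (x , y) → ι (((a * x + b * y) + 0#) * ((c * x + d * y) + 0#) ≟ 0#)) ℕ.+ 1 ≡ q ℕ.+ q
  count-two-lines {a} {b} {c} {d} δ≢0 = begin
    ∑ (λ xy → ι (A xy * B xy ≟ 0#)) ℕ.+ 1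
      ≡⟨ cong (∑ (λ xy → ι (A xy * B xy ≟ 0#)) ℕ.+_) (sym common) ⟩
    ∑ (λ xy → ι (A xy * B xy ≟ 0#)) ℕ.+ ∑ (λ xy → ι ((A xy ≟ 0#) ×-dec (B xy ≟ 0#)))
      ≡⟨ sym (∑-+ {A = K × K} _ _) ⟩
    ∑ (λ xy → ι (A xy * B xy ≟ 0#) ℕ.+ ι ((A xy ≟ 0#) ×-dec (B xy ≟ 0#)))
      ≡⟨ ∑-cong {A = K × K} (λ xy → product-ι (A xy) (B xy)) ⟩
    ∑ (λ xy → ι (A xy ≟ 0#) ℕ.+ ι (B xy ≟ 0#))
      ≡⟨ ∑-+ {A = K × K} _ _ ⟩
    ∑ (λ xy → ι (A xy ≟ 0#)) ℕ.+ ∑ (λ xy → ι (B xy ≟ 0#))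
      ≡⟨ cong₂ ℕ._+_ (count-line 0# (nonzero-pair a b λ { refl refl → δ≢0 (solve 2 (λ d c → 0ₚ :* d :- 0ₚ :* c := 0ₚ) refl d c) }))
                     (count-line 0# (nonzero-pair c d λ { refl refl → δ≢0 (solve 2 (λ a b → a :* 0ₚ :- b :* 0ₚ := 0ₚ) refl a b) })) ⟩
    q ℕ.+ q ∎
    where
    A B : K × K → K
    A (x , y) = (a * x + b * y) + 0#
    B (x , y) = (c * x + d * y) + 0#
    nonzero-pair : ∀ x y → (x ≡ 0# → ¬ (y ≡ 0#)) → x ≢ 0# ⊎ y ≢ 0#
    nonzero-pair x y h with x ≟ 0# | y ≟ 0#
    ... | no x≢0  | _       = inj₁ x≢0
    ... | yes _   | no y≢0  = inj₂ y≢0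
    ... | yes x≡0 | yes y≡0 = ⊥-elim (h x≡0 y≡0)
    product-ι : ∀ x y → ι (x * y ≟ 0#) ℕ.+ ι ((x ≟ 0#) ×-dec (y ≟ 0#)) ≡ ι (x ≟ 0#) ℕ.+ ι (y ≟ 0#)
    product-ι x y with x ≟ 0# | y ≟ 0#
    ... | yes refl | yes refl = cong (ℕ._+ 1) (ι-yes (0# * 0# ≟ 0#) (zeroˡ _))
    ... | yes refl | no _     = cong (ℕ._+ 0) (ι-yes (0# * y ≟ 0#) (zeroˡ _))
    ... | no _     | yes refl = cong (ℕ._+ 0) (ι-yes (x * 0# ≟ 0#) (zeroʳ _))
    ... | no x≢0   | no y≢0   = cong (ℕ._+ 0) (ι-no (x * y ≟ 0#) (*-nonzero x≢0 y≢0))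
    common : ∑ (λ xy → ι ((A xy ≟ 0#) ×-dec (B xy ≟ 0#))) ≡ 1
    common = ∑-ι-unique {A = K × K} (λ xy → (A xy ≟ 0#) ×-dec (B xy ≟ 0#)) (0# , 0#)
      (origin a b , origin c d)
      (λ (x , y) (e , f) → cong₂ _,_
        (*-cancel₀ δ≢0 (drop₁ d e (drop₁ (- b) f
          (solve 6 (λ a b c d x y → (a :* d :- b :* c) :* x :=
            0ₚ :+ d :* (a :* x :+ b :* y :+ 0ₚ) :+ :- b :* (c :* x :+ d :* y :+ 0ₚ)) refl a b c d x y))))
        (*-cancel₀ δ≢0 (drop₁ (- c) e (drop₁ a f
          (solve 6 (λ a b c d x y → (a :* d :- b :* c) :* y :=
            0ₚ :+ :- c :* (a :* x :+ b :* y :+ 0ₚ) :+ a :* (c :* x :+ d :* y :+ 0ₚ)) refl a b c d x y)))))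
      where
      origin : ∀ a b → (a * 0# + b * 0#) + 0# ≡ 0#
      origin = solve 2 (λ a b → a :* 0ₚ :+ b :* 0ₚ :+ 0ₚ := 0ₚ) refl

  -- The nilpotent blocks `((x , y) , (z , - x))`, whose determinant is `-(x^2 + y z)`.
  OnCone : V K → Set
  OnCone (x , y , z) = x * x + y * z ≡ 0#

  onCone? : ∀ v → Dec (OnCone v)
  onCone? (x , y , z) = x * x + y * z ≟ 0#

  -- Each fibre over `y` has `q` points: for nonzero `y` the value of `x` determines `z`, and for
  -- `y = 0` also `x = 0` while `z` is free.
  cone-count : ∑ (λ v → ι (onCone? v)) ≡ q ℕ.* q
  cone-count = begin
    ∑ (λ v → ι (onCone? v))
      ≡⟨ trans (∑-× {A = K} {B = K × K} _) (∑-cong {A = K} (λ x → ∑-× {A = K} {B = K} _)) ⟩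
    ∑ (λ x → ∑ (λ y → ∑ (λ z → ι (onCone? (x , y , z)))))
      ≡⟨ ∑-comm {A = K} {B = K} _ ⟩
    ∑ (λ y → ∑ (λ x → ∑ (λ z → ι (onCone? (x , y , z)))))
      ≡⟨ ∑-cong {A = K} fibre ⟩
    ∑ {A = K} (λ y → q)
      ≡⟨ trans (∑-const {A = K} q) (cong (ℕ._* q) card-K) ⟩
    q ℕ.* q ∎
    where
    fibre : ∀ y → ∑ {A = K} (λ x → ∑ {A = K} (λ z → ι (onCone? (x , y , z)))) ≡ q
    fibre y with y ≟ 0#
    ... | no y≢0 = trans (∑-cong {A = K} (λ x → trans (∑-cong {A = K} (λ z → cong (λ w → ι (w ≟ 0#)) (+-comm (x * x) (y * z))))
                                                      (count-root (x * x) y≢0))) card-K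
    ... | yes refl = begin
      ∑ {A = K} (λ x → ∑ {A = K} (λ z → ι (onCone? (x , 0# , z))))
        ≡⟨ ∑-cong {A = K} (λ x → trans (∑-cong {A = K} (λ z → ι-cong (onCone? (x , 0# , z)) (x ≟ 0#)
             (λ e → [ (λ h → h) , (λ h → h) ]′ (*-zero (trans (sym (square x z)) e)))
             (λ { refl → trans (square 0# z) (zeroˡ 0#) }))) (∑-const {A = K} (ι (x ≟ 0#)))) ⟩
      ∑ {A = K} (λ x → card K ℕ.* ι (x ≟ 0#))
        ≡⟨ ∑-*ˡ {A = K} (card K) _ ⟩
      card K ℕ.* ∑ {A = K} (λ x → ι (x ≟ 0#))
        ≡⟨ cong₂ ℕ._*_ card-K (∑-ι-point {A = K} 0#) ⟩
      q ℕ.* 1 ≡⟨ ℕ.*-identityʳ q ⟩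
      q ∎
      where
      square : ∀ x z → x * x + 0# * z ≡ x * x
      square = solve 2 (λ x z → x :* x :+ 0ₚ :* z := x :* x) refl

  -- The linear equation is the trace of the product of the blocks `((s , t) , (u , v))` and
  -- `((x , y) , (z , - x))`.
  OnSection : (s t u v : K) → V K → Set
  OnSection s t u v (x , y , z) = OnCone (x , y , z) × ((s - v) * x + t * z) + u * y ≡ 0#

  onSection? : ∀ s t u v w → Dec (OnSection s t u v w)
  onSection? s t u v (x , y , z) = onCone? (x , y , z) ×-dec (((s - v) * x + t * z) + u * y ≟ 0#)

  sectionSize : (s t u v : K) → ℕ
  sectionSize s t u v = ∑ (λ w → ι (onSection? s t u v w))

  -- Transposing both blocks. It reduces `u = 0`, `t` nonzero to the case of nonzero `u`.
  sectionSize-swap : ∀ s t u v → sectionSize s t u v ≡ sectionSize s u t v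
  sectionSize-swap s t u v = trans
    (∑-reindex {A = V K} {B = V K} swap swap (λ _ → refl) (λ _ → refl) (λ w → ι (onSection? s t u v w)))
    (∑-cong {A = V K} (λ (x , y , z) → ι-cong (onSection? s t u v (x , z , y)) (onSection? s u t v (x , y , z))
      (λ (e , f) → trans (cong (x * x +_) (*-comm y z)) e , trans (swap-sum ((s - v) * x) (u * z) (t * y)) f)
      (λ (e , f) → trans (cong (x * x +_) (*-comm z y)) e , trans (swap-sum ((s - v) * x) (t * y) (u * z)) f)))
    where
    swap : V K → V K
    swap (x , y , z) = x , z , y
    swap-sum : ∀ a b c → (a + b) + c ≡ (a + c) + b
    swap-sum = solve 3 (λ a b c → a :+ b :+ c := a :+ c :+ b) refl

  -- `l` is the eigenvalue of `P` at the ray. The block induced on the quotient has trace `- l` and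
  -- determinant `l^2`, so its eigenvalues are `ω l` and `ω² l`.
  module Eigen (s t u v l : K) (trace₀ : (s + v) + l ≡ 0#) (quad₀ : (t * u - s * v) + l * l ≡ 0#) where

    private
      α β : K
      α = s - ω * l
      β = s - ω² * l

    -- u² times the equation of the cone on the plane of the section factors over K.
    section-factors : u ≢ 0# → sectionSize s t u v ≡
      ∑ {A = K × K} (λ (x , z) → ι (((u * x + (- α) * z) + 0#) * ((u * x + (- β) * z) + 0#) ≟ 0#))
    section-factors u≢0 = begin
      ∑ (λ w → ι (onSection? s t u v w))
        ≡⟨ ∑-cong {A = V K} (λ (x , y , z) → trans (ι-× (onCone? (x , y , z)) (plane? (x , y , z))) (ℕ.*-comm (ι (onCone? (x , y , z))) _)) ⟩
      ∑ (λ w → ι (plane? w) ℕ.* ι (onCone? w))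
        ≡⟨ ∑-param {A = V K} {B = K × K} plane? to (λ (x , y , z) → x , z)
             (λ (x , z) → drop₁ (- ((s - v) * x + t * z)) (x≡y⇒x-y≡0 (inv-r u≢0))
               (solve 3 (λ a u i → a :+ u :* :- (a :* i) := 0ₚ :+ :- a :* (u :* i :- 1ₚ)) refl ((s - v) * x + t * z) u (inv u)))
             (λ _ → refl)
             (λ (x , y , z) e → cong (λ y → x , y , z) (*-cancelˡ u≢0
               (drop₁ (- 1#) e (drop₁ (- ((s - v) * x + t * z)) (x≡y⇒x-y≡0 (inv-r u≢0))
                 (solve 4 (λ a u i y → u :* :- (a :* i) := u :* y :+ :- 1ₚ :* (a :+ u :* y) :+ :- a :* (u :* i :- 1ₚ))
                   refl ((s - v) * x + t * z) u (inv u) y)))))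
             (λ w → ι (onCone? w)) ⟩
      ∑ (λ xz → ι (onCone? (to xz)))
        ≡⟨ ∑-cong {A = K × K} (λ (x , z) → ι-cong (onCone? (to (x , z))) (_ ≟ 0#)
             (λ e → trans (sym (factor x z)) (trans (cong ((u * u) *_) e) (zeroʳ _)))
             (λ e → *-cancel₀ (*-nonzero u≢0 u≢0) (trans (factor x z) e))) ⟩
      ∑ (λ (x , z) → ι (((u * x + (- α) * z) + 0#) * ((u * x + (- β) * z) + 0#) ≟ 0#)) ∎
      where
      plane? : ∀ w → Dec (((s - v) * proj₁ w + t * proj₂ (proj₂ w)) + u * proj₁ (proj₂ w) ≡ 0#)
      plane? (x , y , z) = ((s - v) * x + t * z) + u * y ≟ 0#
      to : K × K → V K
      to (x , z) = x , - (((s - v) * x + t * z) * inv u) , z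
      factor : ∀ x z → (u * u) * (x * x + (- (((s - v) * x + t * z) * inv u)) * z) ≡
                       ((u * x + (- α) * z) + 0#) * ((u * x + (- β) * z) + 0#)
      -- The product expands correctly because `α + β = s - v` and `α β = - t u`; both follow from
      -- the trace, the block equation and the relations of `ω`.
      factor x z =
        drop₁ (- ((u * z) * ((s - v) * x + t * z))) (x≡y⇒x-y≡0 (inv-r u≢0))
        (drop₁ ((u * x) * z - (s * z) * z) trace₀
        (drop₁ (- (z * z)) quad₀
        (drop₁ (- ((l * z) * (l * z))) (x≡y⇒x-y≡0 ω*ω²)
        (solve 9 (λ s t u v l x z i w → let w² = :- (1ₚ :+ w) ; a = s :- w :* l ; b = s :- w² :* l ; p = (s :- v) :* x :+ t :* z in
          u :* u :* (x :* x :+ :- (p :* i) :* z) :=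
          (u :* x :+ :- a :* z :+ 0ₚ) :* (u :* x :+ :- b :* z :+ 0ₚ)
            :+ :- (u :* z :* p) :* (u :* i :- 1ₚ)
            :+ (u :* x :* z :- s :* z :* z) :* (s :+ v :+ l)
            :+ :- (z :* z) :* (t :* u :- s :* v :+ l :* l)
            :+ :- (l :* z :* (l :* z)) :* (w :* w² :- 1ₚ)) refl s t u v l x z (inv u) ω))))

  -- The two linear factors are independent: up to sign their determinant is `u l (ω - ω²)`.
  section-split-u : ∀ {s t u v l} → (s + v) + l ≡ 0# → (t * u - s * v) + l * l ≡ 0# → l ≢ 0# → u ≢ 0# →
                    sectionSize s t u v ℕ.+ 1 ≡ q ℕ.+ q
  section-split-u {s} {t} {u} {v} {l} e₁ e₂ l≢0 u≢0 = trans
    (cong (ℕ._+ 1) (Eigen.section-factors s t u v l e₁ e₂ u≢0))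
    (count-two-lines {u} { - (s - ω * l)} {u} { - (s - ω² * l)} λ e →
      *-nonzero (*-nonzero u≢0 l≢0) ω≢ω² (drop₁ (- 1#) e
        (solve 4 (λ s u l w → let w² = :- (1ₚ :+ w) in u :* l :* (w :- w²) :=
          0ₚ :+ :- 1ₚ :* (u :* :- (s :- w² :* l) :- :- (s :- w :* l) :* u)) refl s u l ω)))

  -- For eigenvalue 0 the two factors coincide, so the plane touches the cone along one line.
  section-nil-u : ∀ {s t u v} → s + v ≡ 0# → t * u - s * v ≡ 0# → u ≢ 0# → sectionSize s t u v ≡ q
  section-nil-u {s} {t} {u} {v} e₁ e₂ u≢0 = trans
    (Eigen.section-factors s t u v 0# (trans (+-identityʳ _) e₁)
      (trans (solve 1 (λ x → x :+ 0ₚ :* 0ₚ := x) refl (t * u - s * v)) e₂) u≢0)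
    (trans (∑-cong {A = K × K} (λ (x , z) → let k = (u * x + (- s) * z) + 0# in
      ι-cong (((u * x + (- (s - ω * 0#)) * z) + 0#) * ((u * x + (- (s - ω² * 0#)) * z) + 0#) ≟ 0#) (k ≟ 0#)
        (λ e → [ (λ h → h) , (λ h → h) ]′ (*-zero {k} {k} (trans (sym (square x z)) e)))
        (λ e → trans (square x z) (trans (cong (_* k) e) (zeroˡ k)))))
      (count-line { u} { - s} 0# (inj₁ u≢0)))
    where
    square : ∀ x z → ((u * x + (- (s - ω * 0#)) * z) + 0#) * ((u * x + (- (s - ω² * 0#)) * z) + 0#) ≡
                     ((u * x + (- s) * z) + 0#) * ((u * x + (- s) * z) + 0#)
    square x z = solve 6 (λ u s x z w w² →
      (u :* x :+ :- (s :- w :* 0ₚ) :* z :+ 0ₚ) :* (u :* x :+ :- (s :- w² :* 0ₚ) :* z :+ 0ₚ) :=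
      (u :* x :+ :- s :* z :+ 0ₚ) :* (u :* x :+ :- s :* z :+ 0ₚ)) refl u s x z ω ω²

  -- For a diagonal block with distinct entries the plane is `x = 0`, and it meets the cone in the
  -- two lines `y z = 0`.
  section-split-diagonal : ∀ {s v l} → (s + v) + l ≡ 0# → (0# * 0# - s * v) + l * l ≡ 0# → l ≢ 0# →
                           sectionSize s 0# 0# v ℕ.+ 1 ≡ q ℕ.+ q
  section-split-diagonal {s} {v} {l} e₁ e₂ l≢0 = trans (cong (ℕ._+ 1) (begin
    ∑ (λ w → ι (onSection? s 0# 0# v w))
      ≡⟨ ∑-cong {A = V K} (λ (x , y , z) → trans
           (ι-cong (onSection? s 0# 0# v (x , y , z)) ((x ≟ 0#) ×-dec (((1# * y + 0# * z) + 0#) * ((0# * y + 1# * z) + 0#) ≟ 0#))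
             (λ (e , f) → let x≡0 = *-cancel₀ s-v≢0 (trans (sym (line x y z)) f) in
               x≡0 , trans (sym (cone y z)) (subst (λ x → x * x + y * z ≡ 0#) x≡0 e))
             (λ { (refl , e) → trans (cone y z) e , trans (line 0# y z) (zeroʳ _) }))
           (ι-× (x ≟ 0#) (((1# * y + 0# * z) + 0#) * ((0# * y + 1# * z) + 0#) ≟ 0#))) ⟩
    ∑ {A = V K} (λ (x , y , z) → ι (x ≟ 0#) ℕ.* ι (((1# * y + 0# * z) + 0#) * ((0# * y + 1# * z) + 0#) ≟ 0#))
      ≡⟨ ∑-param {A = V K} {B = K × K} (λ (x , y , z) → x ≟ 0#) (λ yz → 0# , yz) proj₂ (λ _ → refl) (λ _ → refl)
           (λ { (x , yz) refl → refl })
           (λ (x , y , z) → ι (((1# * y + 0# * z) + 0#) * ((0# * y + 1# * z) + 0#) ≟ 0#)) ⟩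
    ∑ {A = K × K} (λ (y , z) → ι (((1# * y + 0# * z) + 0#) * ((0# * y + 1# * z) + 0#) ≟ 0#)) ∎))
    (count-two-lines {1#} {0#} {0#} {1#}
      (λ e → 1≢0 (trans (solve 0 (1ₚ := 1ₚ :* 1ₚ :- 0ₚ :* 0ₚ) refl) e)))
    where
    cone : ∀ y z → 0# * 0# + y * z ≡ ((1# * y + 0# * z) + 0#) * ((0# * y + 1# * z) + 0#)
    cone = solve 2 (λ y z → 0ₚ :* 0ₚ :+ y :* z := (1ₚ :* y :+ 0ₚ :* z :+ 0ₚ) :* (0ₚ :* y :+ 1ₚ :* z :+ 0ₚ)) refl
    line : ∀ x y z → ((s - v) * x + 0# * z) + 0# * y ≡ (s - v) * x
    line = solve 5 (λ s v x y z → (s :- v) :* x :+ 0ₚ :* z :+ 0ₚ :* y := (s :- v) :* x) refl s v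
    -- The discriminant (s - v)² of the diagonal block is - 3 l².
    s-v≢0 : s - v ≢ 0#
    s-v≢0 e = *-nonzero 3≢0 (*-nonzero l≢0 l≢0) (drop₁ ((s + v) - l) e₁ (drop₁ ((1# + 1#) + (1# + 1#)) e₂ (drop₁ (- (s - v)) e
      (solve 3 (λ s v l → (1ₚ :+ 1ₚ :+ 1ₚ) :* (l :* l) :=
        0ₚ :+ (s :+ v :- l) :* (s :+ v :+ l) :+ (1ₚ :+ 1ₚ :+ (1ₚ :+ 1ₚ)) :* (0ₚ :* 0ₚ :- s :* v :+ l :* l) :+ :- (s :- v) :* (s :- v)) refl s v l))))

  section-split : ∀ {s t u v l} → (s + v) + l ≡ 0# → (t * u - s * v) + l * l ≡ 0# → l ≢ 0# →
                  sectionSize s t u v ℕ.+ 1 ≡ q ℕ.+ q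
  section-split {s} {t} {u} {v} {l} e₁ e₂ l≢0 = by-cases (u ≟ 0#) (t ≟ 0#)
    where
    by-cases : Dec (u ≡ 0#) → Dec (t ≡ 0#) → sectionSize s t u v ℕ.+ 1 ≡ q ℕ.+ q
    by-cases (no u≢0) _ = section-split-u {s} {t} {u} {v} e₁ e₂ l≢0 u≢0
    by-cases (yes _) (no t≢0) = trans (cong (ℕ._+ 1) (sectionSize-swap s t u v))
      (section-split-u {s} {u} {t} {v} e₁ (trans (cong (λ x → (x - s * v) + l * l) (*-comm u t)) e₂) l≢0 t≢0)
    by-cases (yes refl) (yes refl) = section-split-diagonal e₁ e₂ l≢0

  section-nil : ∀ {s t u v} → s + v ≡ 0# → t * u - s * v ≡ 0# → ¬ (s ≡ 0# × t ≡ 0# × u ≡ 0# × v ≡ 0#) →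
                sectionSize s t u v ≡ q
  section-nil {s} {t} {u} {v} e₁ e₂ nonzero = by-cases (u ≟ 0#) (t ≟ 0#)
    where
    by-cases : Dec (u ≡ 0#) → Dec (t ≡ 0#) → sectionSize s t u v ≡ q
    by-cases (no u≢0) _ = section-nil-u {s} {t} {u} {v} e₁ e₂ u≢0
    by-cases (yes _) (no t≢0) = trans (sectionSize-swap s t u v)
      (section-nil-u {s} {u} {t} {v} e₁ (trans (cong (λ x → x - s * v) (*-comm u t)) e₂) t≢0)
    by-cases (yes refl) (yes refl) = ⊥-elim (nonzero (s≡0 , refl , refl , v≡0))
      where
      s≡0 : s ≡ 0#
      s≡0 = [ (λ h → h) , (λ h → h) ]′ (*-zero (drop₁ s e₁ (drop₁ 1# e₂
        (solve 2 (λ s v → s :* s := 0ₚ :+ s :* (s :+ v) :+ 1ₚ :* (0ₚ :* 0ₚ :- s :* v)) refl s v))))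
      v≡0 : v ≡ 0#
      v≡0 = drop₁ 1# e₁ (drop₁ (- 1#) s≡0 (solve 2 (λ s v → v := 0ₚ :+ 1ₚ :* (s :+ v) :+ :- 1ₚ :* s) refl s v))

  section-zero : sectionSize 0# 0# 0# 0# ≡ q ℕ.* q
  section-zero = trans (∑-cong {A = V K} (λ (x , y , z) → ι-cong (onSection? 0# 0# 0# 0# (x , y , z)) (onCone? (x , y , z))
    proj₁ (λ e → e , solve 3 (λ x y z → (0ₚ :- 0ₚ) :* x :+ 0ₚ :* z :+ 0ₚ :* y := 0ₚ) refl x y z))) cone-count

  -- Nilpotent matrices in a hyperplane

  perp? : ∀ P N → Dec (trace (P · N) ≡ 0#)
  perp? P N = trace (P · N) ≟ 0#

  nil? : ∀ N → Dec (Nil N)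
  nil? N = (trace N ≟ 0#) ×-dec (quad N ≟ 0#) ×-dec (det N ≟ 0#)

  weight : Mat K → Mat K → ℕ
  weight P N = ι (nil? N ×-dec perp? P N)

  weightedKernel weightedImage : Mat K → ℕ
  weightedKernel P = ∑ (λ N → ι (kills? N) ℕ.* weight P N)
  weightedImage P  = ∑ (λ N → ι (corner? N) ℕ.* weight P N)

  -- The value of `trace (P · N)` for the traceless `N` that kills the third basis vector, has block
  -- `(x , y , z)` and last row `(c , d)`.
  linear : Mat K → V K → K × K → K
  linear ((s , t , e) , (u , v , f) , _) (x , y , z) (c , d) = (e * c + f * d) + (((s - v) * x + t * z) + u * y)

  -- When the third column of `N` is zero, so is its determinant, and `quad` involves the block
  -- alone. What remains is the cone condition and one condition linear in `(c , d)`.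
  weightedKernel-sum : ∀ P → weightedKernel P ≡ ∑ {A = V K} (λ w → ι (onCone? w) ℕ.* ∑ {A = K × K} (λ cd → ι (linear P w cd ≟ 0#)))
  weightedKernel-sum P@((s , t , e) , (u , v , f) , (g , h , k)) = begin
    ∑ (λ N → ι (kills? N) ℕ.* weight P N)
      ≡⟨ ∑-cong {A = Mat K} (λ N → trans (sym (ι-× (kills? N) (nil? N ×-dec perp? P N)))
           (trans (ι-cong (kills? N ×-dec (nil? N ×-dec perp? P N)) (P? N ×-dec rest? N)
             (λ (a , (b , c , _) , d) → (a , b) , (c , d))
             (λ ((a , b) , (c , d)) → a , (b , c , kills⇒det N a) , d))
             (ι-× (P? N) (rest? N)))) ⟩
    ∑ (λ N → ι (P? N) ℕ.* ι (rest? N))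
      ≡⟨ ∑-param {A = Mat K} {B = V K × (K × K)} P? to from
           (λ ((x , y , z) , (c , d)) → refl , trans (+-identityʳ _) (-‿inverseʳ x)) (λ _ → refl)
           (λ N (a , b) → to-from N a b) (λ N → ι (rest? N)) ⟩
    ∑ {A = V K × (K × K)} (λ wcd → ι (rest? (to wcd)))
      ≡⟨ ∑-cong {A = V K × (K × K)} (λ (w@(x , y , z) , cd@(c , d)) → trans
           (ι-cong (rest? (to (w , cd))) (onCone? w ×-dec (linear P w cd ≟ 0#))
             (λ (a , b) → trans (sym (quad-to x y z c d)) a , trans (sym (trace-to x y z c d)) b)
             (λ (a , b) → trans (quad-to x y z c d) a , trans (trace-to x y z c d) b))
           (ι-× (onCone? w) (linear P w cd ≟ 0#))) ⟩
    ∑ {A = V K × (K × K)} (λ (w , cd) → ι (onCone? w) ℕ.* ι (linear P w cd ≟ 0#))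
      ≡⟨ trans (∑-× {A = V K} {B = K × K} _) (∑-cong {A = V K} (λ w → ∑-*ˡ {A = K × K} (ι (onCone? w)) _)) ⟩
    ∑ {A = V K} (λ w → ι (onCone? w) ℕ.* ∑ {A = K × K} (λ cd → ι (linear P w cd ≟ 0#))) ∎
    where
    P? : ∀ N → Dec (col₃ N ≡ 𝟎 × trace N ≡ 0#)
    P? N = kills? N ×-dec (trace N ≟ 0#)
    rest? : ∀ N → Dec (quad N ≡ 0# × trace (P · N) ≡ 0#)
    rest? N = (quad N ≟ 0#) ×-dec perp? P N
    to : V K × (K × K) → Mat K
    to ((x , y , z) , (c , d)) = (x , y , 0#) , (z , - x , 0#) , (c , d , 0#)
    from : Mat K → V K × (K × K)
    from ((x , y , _) , (z , _ , _) , (c , d , _)) = (x , y , z) , (c , d)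
    to-from : ∀ N → col₃ N ≡ 𝟎 → trace N ≡ 0# → to (from N) ≡ N
    to-from ((x , y , _) , (z , w , _) , (c , d , _)) refl e =
      cong (λ w → (x , y , 0#) , (z , w , 0#) , (c , d , 0#))
        (drop₁ (- 1#) e (solve 2 (λ x w → :- x := w :+ :- 1ₚ :* (x :+ w :+ 0ₚ)) refl x w))
    kills⇒det : ∀ N → col₃ N ≡ 𝟎 → det N ≡ 0#
    kills⇒det ((x , y , _) , (z , w , _) , (c , d , _)) refl =
      solve 6 (λ x y z w c d → (y :* 0ₚ :- 0ₚ :* w) :* c :+ (0ₚ :* z :- x :* 0ₚ) :* d :+ (x :* w :- y :* z) :* 0ₚ := 0ₚ)
        refl x y z w c d
    quad-to : ∀ x y z c d → quad (to ((x , y , z) , (c , d))) ≡ x * x + y * z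
    quad-to = solve 5 (λ x y z c d → Sym.quad ((x , y , 0ₚ) , (z , :- x , 0ₚ) , (c , d , 0ₚ)) := x :* x :+ y :* z) refl
    trace-to : ∀ x y z c d → trace (P · to ((x , y , z) , (c , d))) ≡ linear P (x , y , z) (c , d)
    trace-to x y z c d = prove (entries P (x ∷ y ∷ z ∷ c ∷ d ∷ []))
      (Sym.trace (Nₚ Sym.· ((xₚ , yₚ , 0ₚ) , (zₚ , :- xₚ , 0ₚ) , (cₚ , dₚ , 0ₚ))))
      (var (# 2) :* cₚ :+ var (# 5) :* dₚ :+ ((var (# 0) :- var (# 4)) :* xₚ :+ var (# 1) :* zₚ :+ var (# 3) :* yₚ)) refl
      where
      xₚ yₚ zₚ cₚ dₚ : Polynomial 14
      xₚ = var (# 9)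
      yₚ = var (# 10)
      zₚ = var (# 11)
      cₚ = var (# 12)
      dₚ = var (# 13)

  weightedImage-sum : ∀ P → weightedImage P ≡ ∑ {A = K × K} (λ cd → ι (linear P 𝟎 cd ≟ 0#))
  weightedImage-sum P = trans
    (∑-param {A = Mat K} {B = K × K} corner? to from (λ _ → refl , refl , refl) (λ _ → refl)
      (λ { N@(_ , _ , (c , d , _)) (refl , refl , refl) → refl }) (weight P))
    (∑-cong {A = K × K} (λ cd → ι-cong (nil? (to cd) ×-dec perp? P (to cd)) (linear P 𝟎 cd ≟ 0#)
      (λ (_ , b) → trans (sym (trace-to cd)) b) (λ b → nil cd , trans (trace-to cd) b)))
    where
    to : K × K → Mat K
    to (c , d) = 𝟎 , 𝟎 , (c , d , 0#)
    from : Mat K → K × K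
    from (_ , _ , (c , d , _)) = c , d
    nil : ∀ cd → Nil (to cd)
    nil (c , d) = prove (c ∷ d ∷ []) (Sym.trace N) 0ₚ refl , prove (c ∷ d ∷ []) (Sym.quad N) 0ₚ refl , prove (c ∷ d ∷ []) (Sym.det N) 0ₚ refl
      where
      N : Mat (Polynomial 2)
      N = Sym.𝟎 , Sym.𝟎 , (var (# 0) , var (# 1) , 0ₚ)
    trace-to : ∀ cd → trace (P · to cd) ≡ linear P 𝟎 cd
    trace-to (c , d) = prove (entries P (c ∷ d ∷ []))
      (Sym.trace (Nₚ Sym.· (Sym.𝟎 , Sym.𝟎 , (var (# 9) , var (# 10) , 0ₚ))))
      (var (# 2) :* var (# 9) :+ var (# 5) :* var (# 10) :+ ((var (# 0) :- var (# 4)) :* 0ₚ :+ var (# 1) :* 0ₚ :+ var (# 3) :* 0ₚ)) refl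

  -- The coefficients of `(c , d)` are not both zero, so over every block the linear condition cuts
  -- out a line of `q` pairs.
  noneigen : ∀ P → col₃ P ! 0F ≢ 0# ⊎ col₃ P ! 1F ≢ 0# →
             weightedKernel P ≡ q ℕ.* q ℕ.* q × weightedImage P ≡ q
  noneigen P@((s , t , e) , (u , v , f) , _) h =
    trans (weightedKernel-sum P) (trans
      (∑-cong {A = V K} (λ (x , y , z) → cong (ι (onCone? (x , y , z)) ℕ.*_) (count-line (((s - v) * x + t * z) + u * y) h)))
      (trans (∑-*ʳ {A = V K} (λ w → ι (onCone? w)) q) (cong (ℕ._* q) cone-count))) ,
    trans (weightedImage-sum P) (count-line (((s - v) * 0# + t * 0#) + u * 0#) h)

  eigen : ∀ {s t u v g h l} → let P = (s , t , 0#) , (u , v , 0#) , (g , h , l) in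
          weightedKernel P ≡ q ℕ.* q ℕ.* sectionSize s t u v × weightedImage P ≡ q ℕ.* q
  eigen {s} {t} {u} {v} {g} {h} {l} = kernel , image
    where
    P = (s , t , 0#) , (u , v , 0#) , (g , h , l)
    form : V K → K
    form (x , y , z) = ((s - v) * x + t * z) + u * y
    drop : ∀ w cd → linear P w cd ≡ form w
    drop w (c , d) = solve 3 (λ c d x → 0ₚ :* c :+ 0ₚ :* d :+ x := x) refl c d (form w)
    card-K² : card (K × K) ≡ q ℕ.* q
    card-K² = trans (card-× {A = K} {B = K}) (cong₂ ℕ._*_ card-K card-K)
    kernel : weightedKernel P ≡ q ℕ.* q ℕ.* sectionSize s t u v
    kernel = begin
      weightedKernel P
        ≡⟨ weightedKernel-sum P ⟩
      ∑ (λ w → ι (onCone? w) ℕ.* ∑ (λ cd → ι (linear P w cd ≟ 0#)))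
        ≡⟨ ∑-cong {A = V K} (λ w → trans (cong (ι (onCone? w) ℕ.*_)
             (trans (∑-cong {A = K × K} (λ cd → cong (λ x → ι (x ≟ 0#)) (drop w cd)))
               (trans (∑-const {A = K × K} (ι (form w ≟ 0#))) (cong (ℕ._* ι (form w ≟ 0#)) card-K²))))
             (trans (x∙yz≈y∙xz (ι (onCone? w)) (q ℕ.* q) (ι (form w ≟ 0#))) (cong (q ℕ.* q ℕ.*_) (sym (ι-× (onCone? w) (form w ≟ 0#)))))) ⟩
      ∑ (λ w → q ℕ.* q ℕ.* ι (onSection? s t u v w))
        ≡⟨ ∑-*ˡ {A = V K} (q ℕ.* q) _ ⟩
      q ℕ.* q ℕ.* sectionSize s t u v ∎
      where open import Algebra.Properties.CommutativeSemigroup ℕ.*-commutativeSemigroup using (x∙yz≈y∙xz)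
    image : weightedImage P ≡ q ℕ.* q
    image = trans (weightedImage-sum P) (trans (∑-ι-all {A = K × K} (λ cd → linear P 𝟎 cd ≟ 0#)
      (λ (c , d) → solve 5 (λ c d x t u → 0ₚ :* c :+ 0ₚ :* d :+ (x :* 0ₚ :+ t :* 0ₚ :+ u :* 0ₚ) := 0ₚ) refl c d (s - v) t u)) card-K²)

  data EigenView : Mat K → Set where
    noneigenray : ∀ {P} → col₃ P ! 0F ≢ 0# ⊎ col₃ P ! 1F ≢ 0# → EigenView P
    eigenray    : ∀ s t u v g h l → EigenView ((s , t , 0#) , (u , v , 0#) , (g , h , l))

  eigenView : ∀ P → EigenView P
  eigenView P@((s , t , e) , (u , v , f) , (g , h , l)) = by-cases (e ≟ 0#) (f ≟ 0#)
    where
    by-cases : Dec (e ≡ 0#) → Dec (f ≡ 0#) → EigenView P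
    by-cases (no e≢0) _ = noneigenray (inj₁ e≢0)
    by-cases _ (no f≢0) = noneigenray (inj₂ f≢0)
    by-cases (yes refl) (yes refl) = eigenray s t u v g h l

  module _ (s t u v g h l : K) where

    private
      P = (s , t , 0#) , (u , v , 0#) , (g , h , l)

    block-quad : trace P ≡ 0# → quad P ≡ 0# → (t * u - s * v) + l * l ≡ 0#
    block-quad e₁ e₂ = drop₁ l e₁ (drop₁ 1# e₂
      (solve 7 (λ s t u v g h l → t :* u :- s :* v :+ l :* l := 0ₚ :+ l :* (s :+ v :+ l)
        :+ 1ₚ :* Sym.quad ((s , t , 0ₚ) , (u , v , 0ₚ) , (g , h , l))) refl s t u v g h l))

    -- The block has determinant `l^2`. Hence `l` vanishes exactly when `det P` does, which
    -- separates the two kinds of cone section.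
    block-det : trace P ≡ 0# → quad P ≡ 0# → det P ≡ l * (l * l)
    block-det e₁ e₂ = drop₁ (- l) (block-quad e₁ e₂)
      (solve 7 (λ s t u v g h l → Sym.det ((s , t , 0ₚ) , (u , v , 0ₚ) , (g , h , l)) :=
        l :* (l :* l) :+ :- l :* (t :* u :- s :* v :+ l :* l)) refl s t u v g h l)

  invertible-weights : ∀ P → trace P ≡ 0# → quad P ≡ 0# → det P ≢ 0# →
    weightedKernel P ℕ.+ q ℕ.* q ≡ q ℕ.* weightedImage P ℕ.+ q ℕ.* (q ℕ.* q)
  invertible-weights P tr₀ quad₀ det≢0 with eigenView P
  ... | noneigenray h = trans (cong (ℕ._+ q ℕ.* q) (proj₁ (noneigen P h)))
    (trans (ℕ.+-comm (q ℕ.* q ℕ.* q) (q ℕ.* q))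
      (cong₂ ℕ._+_ (cong (q ℕ.*_) (sym (proj₂ (noneigen P h)))) (ℕ.*-assoc q q q)))
  ... | eigenray s t u v g h l = trans (cong (ℕ._+ q ℕ.* q) (proj₁ (eigen {s} {t} {u} {v} {g} {h} {l})))
    (trans (invertible-eigen q (section-split {s} {t} {u} {v} {l} tr₀ (block-quad s t u v g h l tr₀ quad₀) l≢0))
      (cong (λ m → q ℕ.* m ℕ.+ q ℕ.* (q ℕ.* q)) (sym (proj₂ (eigen {s} {t} {u} {v} {g} {h} {l})))))
    where
    l≢0 : l ≢ 0#
    l≢0 l≡0 = det≢0 (trans (block-det s t u v g h l tr₀ quad₀) (trans (cong (_* (l * l)) l≡0) (zeroˡ _)))

  -- The deviation of a ray from `q^3 - q^2`, with negative terms moved across. It is linear in the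
  -- two indicators, so summation over the conjugates of `P` turns them into `kernelRays P` and
  -- `imageRays P`.
  NilWeights : Mat K → Set
  NilWeights P =
    weightedKernel P ℕ.+ q ℕ.* (q ℕ.* q) ℕ.* ι (kills? P) ℕ.+ q ℕ.* q ℕ.+ q ℕ.* (q ℕ.* q) ℕ.* ι (corner? P) ≡
    q ℕ.* weightedImage P ℕ.+ q ℕ.* q ℕ.* ι (kills? P) ℕ.+ q ℕ.* (q ℕ.* q) ℕ.+ q ℕ.* (q ℕ.* (q ℕ.* q)) ℕ.* ι (corner? P)

  private
    nil-weights-from : ∀ {P A B κ μ} → weightedKernel P ≡ A → weightedImage P ≡ B → ι (kills? P) ≡ κ → ι (corner? P) ≡ μ →
      A ℕ.+ q ℕ.* (q ℕ.* q) ℕ.* κ ℕ.+ q ℕ.* q ℕ.+ q ℕ.* (q ℕ.* q) ℕ.* μ ≡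
      q ℕ.* B ℕ.+ q ℕ.* q ℕ.* κ ℕ.+ q ℕ.* (q ℕ.* q) ℕ.+ q ℕ.* (q ℕ.* (q ℕ.* q)) ℕ.* μ →
      NilWeights P
    nil-weights-from refl refl refl refl e = e

  nil-weights : ∀ P → Nil P → NilWeights P
  nil-weights P (tr₀ , quad₀ , det₀) with eigenView P
  ... | noneigenray h = nil-weights-from {P} (proj₁ (noneigen P h)) (proj₂ (noneigen P h))
    (ι-no (kills? P) (λ k → [ (λ e≢0 → e≢0 (cong proj₁ k)) , (λ f≢0 → f≢0 (cong (proj₁ ∘ proj₂) k)) ]′ h))
    (ι-no (corner? P) (λ (e , f , _) → [ (λ e≢0 → e≢0 (cong (proj₂ ∘ proj₂) e)) , (λ f≢0 → f≢0 (cong (proj₂ ∘ proj₂) f)) ]′ h))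
    (nil-noneigen q)
  ... | eigenray s t u v g h l = by-cases (corner? P)
    where
    l≡0 : l ≡ 0#
    l≡0 = [ (λ e → e) , (λ e → [ (λ e → e) , (λ e → e) ]′ (*-zero e)) ]′
      (*-zero (trans (sym (block-det s t u v g h l tr₀ quad₀)) det₀))
    kernel = proj₁ (eigen {s} {t} {u} {v} {g} {h} {l})
    image  = proj₂ (eigen {s} {t} {u} {v} {g} {h} {l})
    kills : ι (kills? P) ≡ 1
    kills = ι-yes (kills? P) (cong (λ l → 0# , 0# , l) l≡0)
    by-cases : Dec (Corner P) → NilWeights P
    by-cases (yes c@(refl , refl , _)) = nil-weights-from {P} (trans kernel (cong (q ℕ.* q ℕ.*_) section-zero)) image kills
      (ι-yes (corner? P) c) (nil-corner q)
    by-cases (no ¬c) = nil-weights-from {P} (trans kernel (cong (q ℕ.* q ℕ.*_)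
      (section-nil {s} {t} {u} {v}
        (trans (solve 2 (λ x l → x := x :+ l :- l) refl (s + v) l) (trans (cong₂ _-_ tr₀ l≡0) (-‿inverseʳ 0#)))
        (drop₁ 1# (block-quad s t u v g h l tr₀ quad₀) (drop₁ (- l) l≡0
          (solve 2 (λ x l → x := 0ₚ :+ 1ₚ :* (x :+ l :* l) :+ :- l :* l) refl (t * u - s * v) l)))
        (λ { (refl , refl , refl , refl) → ¬c (refl , refl , l≡0) }))))
      image kills (ι-no (corner? P) ¬c) (nil-eigen q)

  total : Mat K → ℕ
  total P = ∑ (weight P)

  weight-unconj : ∀ p P N → weight P (unconj p N) ≡ weight (conj p P) N
  weight-unconj p P N = ι-cong (nil? (unconj p N) ×-dec perp? P (unconj p N)) (nil? N ×-dec perp? (conj p P) N)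
    (λ ((a , b , c) , d) → (trans (sym (tr p N)) a , trans (sym (qu p N)) b , trans (sym (de p N)) c) , trans (sym (trace-unconj p P N)) d)
    (λ ((a , b , c) , d) → (trans (tr p N) a , trans (qu p N) b , trans (de p N) c) , trans (trace-unconj p P N) d)
    where
    tr : ∀ p N → trace (unconj p N) ≡ trace N
    tr p N = trans (sym (trace-conj p (unconj p N))) (cong trace (conj-unconj p N))
    qu : ∀ p N → quad (unconj p N) ≡ quad N
    qu p N = trans (sym (quad-conj p (unconj p N))) (cong quad (conj-unconj p N))
    de : ∀ p N → det (unconj p N) ≡ det N
    de p N = trans (sym (det-conj p (unconj p N))) (cong det (conj-unconj p N))

  -- The substitution of `unconj p N` for `N` moves the ray `p` to the third basis vector; by
  -- invariance of the trace it replaces `P` by `conj p P`.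
  sum-over-rays : ∀ {r} {R : Mat K → Set r} (R? : ∀ N → Dec (R N)) P →
    ∑ (λ N → weight P N ℕ.* ∑ (λ p → ι (R? (conj p N)))) ≡
    ∑ {A = Ω K} (λ p → ∑ (λ N → ι (R? N) ℕ.* weight (conj p P) N))
  sum-over-rays R? P = begin
    ∑ (λ N → weight P N ℕ.* ∑ (λ p → ι (R? (conj p N))))
      ≡⟨ ∑-cong {A = Mat K} (λ N → sym (∑-*ˡ {A = Ω K} (weight P N) _)) ⟩
    ∑ (λ N → ∑ (λ p → weight P N ℕ.* ι (R? (conj p N))))
      ≡⟨ ∑-comm {A = Mat K} {B = Ω K} _ ⟩
    ∑ (λ p → ∑ (λ N → weight P N ℕ.* ι (R? (conj p N))))
      ≡⟨ ∑-cong {A = Ω K} (λ p → trans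
           (∑-reindex {A = Mat K} {B = Mat K} (unconj p) (conj p) (conj-unconj p) (unconj-conj p) (λ N → weight P N ℕ.* ι (R? (conj p N))))
           (∑-cong {A = Mat K} (λ N → trans (cong₂ (λ w M → w ℕ.* ι (R? M)) (weight-unconj p P N) (conj-unconj p N))
                                            (ℕ.*-comm (weight (conj p P) N) _)))) ⟩
    ∑ {A = Ω K} (λ p → ∑ (λ N → ι (R? N) ℕ.* weight (conj p P) N)) ∎

  weight-O : ∀ P → weight P O ≡ 1
  weight-O P = ι-yes (nil? O ×-dec perp? P O)
    ((prove [] (Sym.trace Oₚ) 0ₚ refl , prove [] (Sym.quad Oₚ) 0ₚ refl , prove [] (Sym.det Oₚ) 0ₚ refl) ,
     prove (entries P []) (Sym.trace (Nₚ Sym.· (Sym.𝟎 , Sym.𝟎 , Sym.𝟎))) 0ₚ refl)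
    where
    Oₚ : Mat (Polynomial 0)
    Oₚ = Sym.𝟎 , Sym.𝟎 , Sym.𝟎

  -- The kernel identity weighted by membership and summed over `N`. Its term with `q^3` survives
  -- only at `O`, whose weight is 1.
  total-identity : ∀ P → total P ℕ.+ q ℕ.* ∑ {A = Ω K} (λ p → weightedImage (conj p P)) ≡
                         ∑ {A = Ω K} (λ p → weightedKernel (conj p P)) ℕ.+ q ℕ.* (q ℕ.* q)
  total-identity P = begin
    total P ℕ.+ q ℕ.* ∑ (λ p → weightedImage (conj p P))
      ≡⟨ cong (λ s → total P ℕ.+ q ℕ.* s) (sym (sum-over-rays corner? P)) ⟩
    total P ℕ.+ q ℕ.* ∑ (λ N → weight P N ℕ.* imageRays N)
      ≡⟨ trans (cong (total P ℕ.+_) (sym (∑-*ˡ {A = Mat K} q _))) (sym (∑-+ {A = Mat K} _ _)) ⟩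
    ∑ (λ N → weight P N ℕ.+ q ℕ.* (weight P N ℕ.* imageRays N))
      ≡⟨ ∑-cong {A = Mat K} pointwise ⟩
    ∑ (λ N → weight P N ℕ.* kernelRays N ℕ.+ ι (N ≟ O) ℕ.* (weight P N ℕ.* q³))
      ≡⟨ ∑-+ {A = Mat K} _ _ ⟩
    ∑ (λ N → weight P N ℕ.* kernelRays N) ℕ.+ ∑ (λ N → ι (N ≟ O) ℕ.* (weight P N ℕ.* q³))
      ≡⟨ cong₂ ℕ._+_ (sum-over-rays kills? P) (trans (∑-δ {A = Mat K} O (λ N → weight P N ℕ.* q³))
           (trans (cong (ℕ._* q³) (weight-O P)) (ℕ.*-identityˡ q³))) ⟩
    ∑ {A = Ω K} (λ p → weightedKernel (conj p P)) ℕ.+ q ℕ.* (q ℕ.* q) ∎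
    where
    q³ = q ℕ.* (q ℕ.* q)
    pointwise : ∀ N → weight P N ℕ.+ q ℕ.* (weight P N ℕ.* imageRays N) ≡
                      weight P N ℕ.* kernelRays N ℕ.+ ι (N ≟ O) ℕ.* (weight P N ℕ.* q³)
    pointwise N = begin
      w ℕ.+ q ℕ.* (w ℕ.* imageRays N)           ≡⟨ weigh₁ w q (imageRays N) ⟩
      w ℕ.* (1 ℕ.+ q ℕ.* imageRays N)
        ≡⟨ ι-case (nil? N ×-dec perp? P N) (λ ((tr₀ , _ , det₀) , _) → sym (kernel-identity N tr₀ det₀)) ⟩
      w ℕ.* (kernelRays N ℕ.+ q³ ℕ.* ι (N ≟ O))   ≡⟨ weigh₂ w (kernelRays N) q³ (ι (N ≟ O)) ⟩
      w ℕ.* kernelRays N ℕ.+ ι (N ≟ O) ℕ.* (w ℕ.* q³) ∎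
      where w = weight P N

  ∑-invertible : ∀ P → trace P ≡ 0# → quad P ≡ 0# → det P ≢ 0# →
    ∑ {A = Ω K} (λ p → weightedKernel (conj p P)) ℕ.+ (q ℕ.* q ℕ.+ (q ℕ.+ 1)) ℕ.* (q ℕ.* q) ≡
    q ℕ.* ∑ {A = Ω K} (λ p → weightedImage (conj p P)) ℕ.+ (q ℕ.* q ℕ.+ (q ℕ.+ 1)) ℕ.* (q ℕ.* (q ℕ.* q))
  ∑-invertible P tr₀ quad₀ det≢0 = begin
    ∑ {A = Ω K} A ℕ.+ (q ℕ.* q ℕ.+ (q ℕ.+ 1)) ℕ.* (q ℕ.* q)
      ≡⟨ trans (cong (∑ A ℕ.+_) (const (q ℕ.* q))) (sym (∑-+ {A = Ω K} A _)) ⟩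
    ∑ (λ p → A p ℕ.+ q ℕ.* q)
      ≡⟨ ∑-cong {A = Ω K} (λ p → invertible-weights (conj p P) (trans (trace-conj p P) tr₀) (trans (quad-conj p P) quad₀)
           (λ e → det≢0 (trans (sym (det-conj p P)) e))) ⟩
    ∑ (λ p → q ℕ.* B p ℕ.+ q ℕ.* (q ℕ.* q))
      ≡⟨ ∑-+ {A = Ω K} _ _ ⟩
    ∑ (λ p → q ℕ.* B p) ℕ.+ ∑ {A = Ω K} (λ p → q ℕ.* (q ℕ.* q))
      ≡⟨ cong₂ ℕ._+_ (∑-*ˡ {A = Ω K} q B) (sym (const (q ℕ.* (q ℕ.* q)))) ⟩
    q ℕ.* ∑ B ℕ.+ (q ℕ.* q ℕ.+ (q ℕ.+ 1)) ℕ.* (q ℕ.* (q ℕ.* q)) ∎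
    where
    A B : Ω K → ℕ
    A p = weightedKernel (conj p P)
    B p = weightedImage (conj p P)
    const : ∀ k → (q ℕ.* q ℕ.+ (q ℕ.+ 1)) ℕ.* k ≡ ∑ {A = Ω K} (λ _ → k)
    const k = trans (cong (ℕ._* k) (sym card-Ω)) (sym (∑-const {A = Ω K} k))

  ∑-nil : ∀ P → Nil P →
    ∑ {A = Ω K} (λ p → weightedKernel (conj p P)) ℕ.+ q ℕ.* (q ℕ.* q) ℕ.* kernelRays P
      ℕ.+ (q ℕ.* q ℕ.+ (q ℕ.+ 1)) ℕ.* (q ℕ.* q) ℕ.+ q ℕ.* (q ℕ.* q) ℕ.* imageRays P ≡
    q ℕ.* ∑ {A = Ω K} (λ p → weightedImage (conj p P)) ℕ.+ q ℕ.* q ℕ.* kernelRays P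
      ℕ.+ (q ℕ.* q ℕ.+ (q ℕ.+ 1)) ℕ.* (q ℕ.* (q ℕ.* q)) ℕ.+ q ℕ.* (q ℕ.* (q ℕ.* q)) ℕ.* imageRays P
  ∑-nil P (tr₀ , quad₀ , det₀) = begin
    ∑ A ℕ.+ q³ ℕ.* ∑ κ ℕ.+ (q ℕ.* q ℕ.+ (q ℕ.+ 1)) ℕ.* (q ℕ.* q) ℕ.+ q³ ℕ.* ∑ μ
      ≡⟨ sym (∑-+₄ A (q³) κ (q ℕ.* q) q³ μ) ⟩
    ∑ (λ p → A p ℕ.+ q³ ℕ.* κ p ℕ.+ q ℕ.* q ℕ.+ q³ ℕ.* μ p)
      ≡⟨ ∑-cong {A = Ω K} (λ p → nil-weights (conj p P)
           (trans (trace-conj p P) tr₀ , trans (quad-conj p P) quad₀ , trans (det-conj p P) det₀)) ⟩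
    ∑ (λ p → q ℕ.* B p ℕ.+ q ℕ.* q ℕ.* κ p ℕ.+ q³ ℕ.+ q ℕ.* q³ ℕ.* μ p)
      ≡⟨ ∑-+₄ (λ p → q ℕ.* B p) (q ℕ.* q) κ q³ (q ℕ.* q³) μ ⟩
    ∑ (λ p → q ℕ.* B p) ℕ.+ q ℕ.* q ℕ.* ∑ κ ℕ.+ (q ℕ.* q ℕ.+ (q ℕ.+ 1)) ℕ.* q³ ℕ.+ q ℕ.* q³ ℕ.* ∑ μ
      ≡⟨ cong (λ s → s ℕ.+ q ℕ.* q ℕ.* ∑ κ ℕ.+ (q ℕ.* q ℕ.+ (q ℕ.+ 1)) ℕ.* q³ ℕ.+ q ℕ.* q³ ℕ.* ∑ μ) (∑-*ˡ {A = Ω K} q B) ⟩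
    q ℕ.* ∑ B ℕ.+ q ℕ.* q ℕ.* ∑ κ ℕ.+ (q ℕ.* q ℕ.+ (q ℕ.+ 1)) ℕ.* q³ ℕ.+ q ℕ.* q³ ℕ.* ∑ μ ∎
    where
    q³ = q ℕ.* (q ℕ.* q)
    A B κ μ : Ω K → ℕ
    A p = weightedKernel (conj p P)
    B p = weightedImage (conj p P)
    κ p = ι (kills? (conj p P))
    μ p = ι (corner? (conj p P))
    ∑-+₄ : ∀ (f : Ω K → ℕ) a g b c h → ∑ (λ p → f p ℕ.+ a ℕ.* g p ℕ.+ b ℕ.+ c ℕ.* h p) ≡
           ∑ f ℕ.+ a ℕ.* ∑ g ℕ.+ (q ℕ.* q ℕ.+ (q ℕ.+ 1)) ℕ.* b ℕ.+ c ℕ.* ∑ h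
    ∑-+₄ f a g b c h = trans (∑-+ {A = Ω K} _ (λ p → c ℕ.* h p)) (cong₂ ℕ._+_
      (trans (∑-+ {A = Ω K} _ (λ _ → b)) (cong₂ ℕ._+_
        (trans (∑-+ {A = Ω K} f (λ p → a ℕ.* g p)) (cong (∑ f ℕ.+_) (∑-*ˡ {A = Ω K} a g)))
        (trans (∑-const {A = Ω K} b) (cong (ℕ._* b) card-Ω))))
      (∑-*ˡ {A = Ω K} c h))

  total-of-invertible : ∀ P → trace P ≡ 0# → quad P ≡ 0# → det P ≢ 0# →
                        total P ℕ.+ q ℕ.* q ≡ q ℕ.* q ℕ.* q ℕ.* q ℕ.* q ℕ.+ q ℕ.* q ℕ.* q
  total-of-invertible P tr₀ quad₀ det≢0 = total-invertible q (total-identity P) (∑-invertible P tr₀ quad₀ det≢0)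

  total-of-nil : ∀ P → Nil P → P ≢ O → total P ≡ q ℕ.* q ℕ.* q ℕ.* q ℕ.* q
  total-of-nil P nil@(tr₀ , _ , det₀) P≢O = total-nilpotent q {κ = kernelRays P} {μ = imageRays P} (total-identity P)
    (trans (sym (trans (cong (λ i → kernelRays P ℕ.+ q ℕ.* (q ℕ.* q) ℕ.* i) (ι-no (P ≟ O) P≢O))
                       (trans (cong (kernelRays P ℕ.+_) (ℕ.*-zeroʳ (q ℕ.* (q ℕ.* q)))) (ℕ.+-identityʳ _))))
           (kernel-identity P tr₀ det₀))
    (∑-nil P nil)

  -- Projective representatives

  -- The first nonzero entry; the default 0 is attained by zero vectors only. Requiring the value 1
  -- selects one vector from each projective point.
  lead : ∀ {n} → Vec K n → K
  lead []       = 0#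
  lead (x ∷ xs) with x ≟ 0#
  ... | yes _ = lead xs
  ... | no _  = x

  lead-scale : ∀ {n t} → t ≢ 0# → (xs : Vec K n) → lead (Vec.map (t *_) xs) ≡ t * lead xs
  lead-scale {t = t} t≢0 [] = sym (zeroʳ t)
  lead-scale {t = t} t≢0 (x ∷ xs) with x ≟ 0# | t * x ≟ 0#
  ... | yes _    | yes _    = lead-scale t≢0 xs
  ... | no _     | no _     = refl
  ... | yes refl | no tx≢0  = ⊥-elim (tx≢0 (zeroʳ t))
  ... | no x≢0   | yes tx≡0 = ⊥-elim (*-nonzero t≢0 x≢0 tx≡0)

  lead-zero : ∀ {n} (xs : Vec K n) → lead xs ≡ 0# → xs ≡ Vec.replicate n 0#
  lead-zero []       _ = refl
  lead-zero (x ∷ xs) e with x ≟ 0#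
  ... | yes refl = cong (0# ∷_) (lead-zero xs e)
  ... | no x≢0   = ⊥-elim (x≢0 e)

  leading : Mat K → K
  leading N = lead (entries N [])

  scaleM : K → Mat K → Mat K
  scaleM t = mapV (scale t)

  leading-scale : ∀ {t} → t ≢ 0# → ∀ N → leading (scaleM t N) ≡ t * leading N
  leading-scale t≢0 N = lead-scale t≢0 (entries N [])

  leading≡0 : ∀ N → leading N ≡ 0# → N ≡ O
  leading≡0 N e = cong matrix {x = entries N []} {y = Vec.replicate 9 0#} (lead-zero (entries N []) e)
    where
    matrix : Vec K 9 → Mat K
    matrix (a ∷ b ∷ c ∷ d ∷ e ∷ f ∷ g ∷ h ∷ i ∷ []) = (a , b , c) , (d , e , f) , (g , h , i)

  leading-O : leading O ≡ 0#
  leading-O = zeros 9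
    where
    zeros : ∀ n → lead (Vec.replicate n 0#) ≡ 0#
    zeros ℕ.zero = refl
    zeros (ℕ.suc n) with 0# ≟ 0#
    ... | yes _  = zeros n
    ... | no 0≢0 = ⊥-elim (0≢0 refl)

  Normalised : Mat K → Set
  Normalised N = leading N ≡ 1#

  normalised? : ∀ N → Dec (Normalised N)
  normalised? N = leading N ≟ 1#

  scaleM-! : ∀ t N i j → scaleM t N ! i ! j ≡ t * N ! i ! j
  scaleM-! t N 0F j = scale-! t (N ! 0F) j
  scaleM-! t N 1F j = scale-! t (N ! 1F) j
  scaleM-! t N 2F j = scale-! t (N ! 2F) j

  scaleM-scaleM : ∀ {s t} → s * t ≡ 1# → ∀ N → scaleM s (scaleM t N) ≡ N
  scaleM-scaleM {s} {t} e N = M-ext {scaleM s (scaleM t N)} {N} λ i j → begin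
    scaleM s (scaleM t N) ! i ! j   ≡⟨ scaleM-! s (scaleM t N) i j ⟩
    s * scaleM t N ! i ! j          ≡⟨ cong (s *_) (scaleM-! t N i j) ⟩
    s * (t * N ! i ! j)             ≡⟨ sym (*-assoc s t _) ⟩
    (s * t) * N ! i ! j             ≡⟨ cong (_* N ! i ! j) e ⟩
    1# * N ! i ! j                  ≡⟨ *-identityˡ _ ⟩
    N ! i ! j                       ∎

  trace-scale : ∀ t N → trace (scaleM t N) ≡ t * trace N
  trace-scale t N = prove (entries N (t ∷ [])) (Sym.trace (mapV (Sym.scale (var (# 9))) Nₚ)) (var (# 9) :* Sym.trace Nₚ) refl

  quad-scale : ∀ t N → quad (scaleM t N) ≡ (t * t) * quad N
  quad-scale t N = prove (entries N (t ∷ [])) (Sym.quad (mapV (Sym.scale (var (# 9))) Nₚ)) (var (# 9) :* var (# 9) :* Sym.quad Nₚ) refl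

  det-scale : ∀ t N → det (scaleM t N) ≡ (t * (t * t)) * det N
  det-scale t N = prove (entries N (t ∷ [])) (Sym.det (mapV (Sym.scale (var (# 9))) Nₚ)) (var (# 9) :* (var (# 9) :* var (# 9)) :* Sym.det Nₚ) refl

  perp-scale : ∀ t P N → trace (P · scaleM t N) ≡ t * trace (P · N)
  perp-scale t P N = prove (entries N (t ∷ t ∷ entries P [])) (Sym.trace (Pₚ Sym.· mapV (Sym.scale aₚ) Nₚ)) (aₚ :* Sym.trace (Pₚ Sym.· Nₚ)) refl

  weight-scale : ∀ {t} → t ≢ 0# → ∀ P N → weight P (scaleM t N) ≡ weight P N
  weight-scale {t} t≢0 P N = ι-cong (nil? (scaleM t N) ×-dec perp? P (scaleM t N)) (nil? N ×-dec perp? P N)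
    (λ ((a , b , c) , d) → (*-cancel₀ t≢0 (trans (sym (trace-scale t N)) a) ,
       *-cancel₀ (*-nonzero t≢0 t≢0) (trans (sym (quad-scale t N)) b) ,
       *-cancel₀ (*-nonzero t≢0 (*-nonzero t≢0 t≢0)) (trans (sym (det-scale t N)) c)) ,
       *-cancel₀ t≢0 (trans (sym (perp-scale t P N)) d))
    (λ ((a , b , c) , d) → (zero (trace-scale t N) a , zero (quad-scale t N) b , zero (det-scale t N) c) , zero (perp-scale t P N) d)
    where
    zero : ∀ {x y z} → x ≡ y * z → z ≡ 0# → x ≡ 0#
    zero {y = y} e refl = trans e (zeroʳ y)

  unit? : (t : K) → Dec (t ≢ 0#)
  unit? t = ¬? (t ≟ 0#)

  count-units : ∑ {A = K} (λ t → ι (unit? t)) ℕ.+ 1 ≡ q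
  count-units = begin
    ∑ (λ t → ι (unit? t)) ℕ.+ 1                          ≡⟨ cong (∑ (λ t → ι (unit? t)) ℕ.+_) (sym (∑-ι-point {A = K} 0#)) ⟩
    ∑ (λ t → ι (unit? t)) ℕ.+ ∑ (λ t → ι (t ≟ 0#))       ≡⟨ sym (∑-+ {A = K} _ _) ⟩
    ∑ (λ t → ι (unit? t) ℕ.+ ι (t ≟ 0#))                 ≡⟨ ∑-cong {A = K} split ⟩
    card K                                               ≡⟨ card-K ⟩
    q                                                    ∎
    where
    split : ∀ t → ι (unit? t) ℕ.+ ι (t ≟ 0#) ≡ 1
    split t with t ≟ 0#
    ... | yes _ = refl
    ... | no _  = refl

  normaliser? : ∀ N t → Dec (t ≢ 0# × Normalised (scaleM t N))
  normaliser? N t = unit? t ×-dec normalised? (scaleM t N)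

  -- A partition of unity: a matrix is zero, or exactly one nonzero scalar normalises it. Inserted
  -- under `total`, it groups the vectors by points.
  normalisers : ∀ N → ι (N ≟ O) ℕ.+ ∑ {A = K} (λ t → ι (normaliser? N t)) ≡ 1
  normalisers N = by-cases (N ≟ O)
    where
    by-cases : Dec (N ≡ O) → ι (N ≟ O) ℕ.+ ∑ {A = K} (λ t → ι (normaliser? N t)) ≡ 1
    by-cases (yes refl) = cong₂ ℕ._+_ (ι-yes (O ≟ O) refl) (∑-ι-none {A = K} (normaliser? O)
      (λ t (t≢0 , e) → 1≢0 (trans (sym e) (trans (leading-scale t≢0 O) (trans (cong (t *_) leading-O) (zeroʳ t))))))
    by-cases (no N≢O) = cong₂ ℕ._+_ (ι-no (N ≟ O) N≢O) (∑-ι-unique {A = K} (normaliser? N) (inv (leading N))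
      (inv≢0 l≢0 , trans (leading-scale (inv≢0 l≢0) N) (trans (*-comm _ _) (inv-r l≢0)))
      (λ t (t≢0 , e) → *-cancelˡ l≢0 (trans (*-comm (leading N) t) (trans (trans (sym (leading-scale t≢0 N)) e) (sym (inv-r l≢0))))))
      where
      l≢0 : leading N ≢ 0#
      l≢0 = N≢O ∘ leading≡0 N

  representatives : Mat K → ℕ
  representatives P = ∑ (λ N → ι (normalised? N ×-dec (nil? N ×-dec perp? P N)))

  -- The zero matrix accounts for the 1. For each of the `q - 1` units `t`, scaling by `t` is a
  -- bijection from the matrices normalised by `t` onto the representatives.
  total-representatives : ∀ P → total P ℕ.+ representatives P ≡ 1 ℕ.+ q ℕ.* representatives P
  total-representatives P = trans (cong (ℕ._+ n) (begin
    ∑ (λ N → weight P N)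
      ≡⟨ ∑-cong {A = Mat K} (λ N → trans (sym (ℕ.*-identityʳ _)) (trans (cong (weight P N ℕ.*_) (sym (normalisers N)))
           (unfold-identity (weight P N) (ι (N ≟ O)) _))) ⟩
    ∑ (λ N → ι (N ≟ O) ℕ.* weight P N ℕ.+ weight P N ℕ.* ∑ {A = K} (λ t → ι (normaliser? N t)))
      ≡⟨ ∑-+ {A = Mat K} _ _ ⟩
    ∑ (λ N → ι (N ≟ O) ℕ.* weight P N) ℕ.+ ∑ (λ N → weight P N ℕ.* ∑ {A = K} (λ t → ι (normaliser? N t)))
      ≡⟨ cong₂ ℕ._+_ (trans (∑-δ {A = Mat K} O (weight P)) (weight-O P)) by-scalar ⟩
    1 ℕ.+ ∑ {A = K} (λ t → ι (unit? t)) ℕ.* n ∎))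
    (nonzero-multiples {∑ {A = K} (λ t → ι (unit? t))} {n} count-units)
    where
    n = representatives P
    at-scalar : ∀ t → ∑ {A = Mat K} (λ N → weight P N ℕ.* ι (normaliser? N t)) ≡ ι (unit? t) ℕ.* n
    at-scalar t = begin
      ∑ {A = Mat K} (λ N → weight P N ℕ.* ι (normaliser? N t))
        ≡⟨ ∑-cong {A = Mat K} (λ N → trans (cong (weight P N ℕ.*_) (ι-× (unit? t) (normalised? (scaleM t N))))
             (trans (x∙yz≈y∙xz (weight P N) (ι (unit? t)) _)
               (ι-case (unit? t) (λ t≢0 → trans (ℕ.*-comm (weight P N) _) (trans
                 (cong (ι (normalised? (scaleM t N)) ℕ.*_) (sym (weight-scale t≢0 P N)))
                 (sym (ι-× (normalised? (scaleM t N)) (nil? (scaleM t N) ×-dec perp? P (scaleM t N))))))))) ⟩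
      ∑ {A = Mat K} (λ N → ι (unit? t) ℕ.* f (scaleM t N))
        ≡⟨ ∑-*ˡ {A = Mat K} (ι (unit? t)) _ ⟩
      ι (unit? t) ℕ.* ∑ {A = Mat K} (λ N → f (scaleM t N))
        ≡⟨ ι-case (unit? t) (λ t≢0 → sym (∑-reindex {A = Mat K} {B = Mat K} (scaleM t) (scaleM (inv t))
             (scaleM-scaleM (trans (*-comm (inv t) t) (inv-r t≢0))) (scaleM-scaleM (inv-r t≢0)) f)) ⟩
      ι (unit? t) ℕ.* n ∎
      where
      open import Algebra.Properties.CommutativeSemigroup ℕ.*-commutativeSemigroup using (x∙yz≈y∙xz)
      f : Mat K → ℕ
      f N = ι (normalised? N ×-dec (nil? N ×-dec perp? P N))
    by-scalar : ∑ (λ N → weight P N ℕ.* ∑ {A = K} (λ t → ι (normaliser? N t))) ≡ ∑ {A = K} (λ t → ι (unit? t)) ℕ.* n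
    by-scalar = begin
      ∑ (λ N → weight P N ℕ.* ∑ {A = K} (λ t → ι (normaliser? N t)))
        ≡⟨ trans (∑-cong {A = Mat K} (λ N → sym (∑-*ˡ {A = K} (weight P N) _))) (∑-comm {A = Mat K} {B = K} _) ⟩
      ∑ {A = K} (λ t → ∑ (λ N → weight P N ℕ.* ι (normaliser? N t)))
        ≡⟨ trans (∑-cong {A = K} at-scalar) (∑-*ʳ {A = K} _ n) ⟩
      ∑ {A = K} (λ t → ι (unit? t)) ℕ.* n ∎

  1<q : 1 ℕ.< q
  1<q = two-elements 1≢0
    where
    two-elements : ∀ {n} {x y : Fin n} → x ≢ y → 1 ℕ.< n
    two-elements {ℕ.suc ℕ.zero}    {0F} {0F} x≢y = ⊥-elim (x≢y refl)
    two-elements {ℕ.suc (ℕ.suc _)} _             = ℕ.s≤s (ℕ.s≤s ℕ.z≤n)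

  representatives-of-nil : ∀ P → Nil P → P ≢ O →
    representatives P ≡ (q ℕ.^ 2 ℕ.+ q ℕ.+ 1) ℕ.* (q ℕ.^ 2 ℕ.+ 1) ℕ.∸ (q ℕ.^ 2 ℕ.+ 1) ℕ.+ 1
  representatives-of-nil P nil P≢O = trans
    (multiplicity-unique 1<q (total-representatives P) (geometric-nil q (total-of-nil P nil P≢O)))
    (sym (count-nil q))

  representatives-of-invertible : ∀ P → trace P ≡ 0# → quad P ≡ 0# → det P ≢ 0# →
    representatives P ≡ (q ℕ.^ 2 ℕ.+ q ℕ.+ 1) ℕ.* (q ℕ.^ 2 ℕ.+ 1)
  representatives-of-invertible P tr₀ quad₀ det≢0 =
    multiplicity-unique 1<q (total-representatives P) (geometric-invertible q (total-of-invertible P tr₀ quad₀ det≢0))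

  -- The planes π_x

  zipV : ∀ {a} {A B C : Set a} → (A → B → C) → V A → V B → V C
  zipV f (a , b , c) (x , y , z) = f a x , f b y , f c z

  comb : K → K → V K → V K → V K
  comb s t = zipV (λ x y → s * x + t * y)

  lin : K → K → Mat K → Mat K → Mat K
  lin s t = zipV (comb s t)

  comb-! : ∀ s t u v i → comb s t u v ! i ≡ s * u ! i + t * v ! i
  comb-! s t u v 0F = refl
  comb-! s t u v 1F = refl
  comb-! s t u v 2F = refl

  lin-! : ∀ s t M N i j → lin s t M N ! i ! j ≡ s * M ! i ! j + t * N ! i ! j
  lin-! s t M N 0F j = comb-! s t (M ! 0F) (N ! 0F) j
  lin-! s t M N 1F j = comb-! s t (M ! 1F) (N ! 1F) j
  lin-! s t M N 2F j = comb-! s t (M ! 2F) (N ! 2F) j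

  dot-comb : ∀ s t u v a → dot (comb s t u v) a ≡ s * dot u a + t * dot v a
  dot-comb s t u v a = prove (entries (u , v , a) (s ∷ t ∷ []))
    ((aₚ :* u₁ :+ bₚ :* v₁) :* a₁ :+ (aₚ :* u₂ :+ bₚ :* v₂) :* a₂ :+ (aₚ :* u₃ :+ bₚ :* v₃) :* a₃)
    (aₚ :* (u₁ :* a₁ :+ u₂ :* a₂ :+ u₃ :* a₃) :+ bₚ :* (v₁ :* a₁ :+ v₂ :* a₂ :+ v₃ :* a₃)) refl
    where
    u₁ u₂ u₃ v₁ v₂ v₃ a₁ a₂ a₃ : Polynomial 11
    u₁ = var (# 0)
    u₂ = var (# 1)
    u₃ = var (# 2)
    v₁ = var (# 3)
    v₂ = var (# 4)
    v₃ = var (# 5)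
    a₁ = var (# 6)
    a₂ = var (# 7)
    a₃ = var (# 8)

  zero-comb : ∀ s t {x y} → x ≡ 0# → y ≡ 0# → s * x + t * y ≡ 0#
  zero-comb s t refl refl = solve 2 (λ s t → s :* 0ₚ :+ t :* 0ₚ := 0ₚ) refl s t

  -- The plane π_x of the point x = a⊗b of Γ.
  record Tangent (a b : V K) (M : Mat K) : Set where
    constructor tangent
    field
      u v   : V K
      entry : ∀ i j → M ! i ! j ≡ a ! i * u ! j + v ! i * b ! j
      u·a   : dot u a ≡ 0#
      b·v   : dot b v ≡ 0#

  tangent-lin : ∀ {a b M N} s t → Tangent a b M → Tangent a b N → Tangent a b (lin s t M N)
  tangent-lin {a} {b} {M} {N} s t (tangent u v e e₁ e₂) (tangent u′ v′ e′ e₁′ e₂′) = tangent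
    (comb s t u u′) (comb s t v v′)
    (λ i j → begin
      lin s t M N ! i ! j
        ≡⟨ trans (lin-! s t M N i j) (cong₂ (λ x y → s * x + t * y) (e i j) (e′ i j)) ⟩
      s * (a ! i * u ! j + v ! i * b ! j) + t * (a ! i * u′ ! j + v′ ! i * b ! j)
        ≡⟨ solve 8 (λ s t a u v b u′ v′ → s :* (a :* u :+ v :* b) :+ t :* (a :* u′ :+ v′ :* b) :=
             a :* (s :* u :+ t :* u′) :+ (s :* v :+ t :* v′) :* b) refl s t (a ! i) (u ! j) (v ! i) (b ! j) (u′ ! j) (v′ ! i) ⟩
      a ! i * (s * u ! j + t * u′ ! j) + (s * v ! i + t * v′ ! i) * b ! j
        ≡⟨ sym (cong₂ (λ x y → a ! i * x + y * b ! j) (comb-! s t u u′ j) (comb-! s t v v′ i)) ⟩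
      a ! i * comb s t u u′ ! j + comb s t v v′ ! i * b ! j ∎)
    (trans (dot-comb s t u u′ a) (zero-comb s t e₁ e₁′))
    (trans (dot-comm b _) (trans (dot-comb s t v v′ b) (zero-comb s t (trans (dot-comm v b) e₂) (trans (dot-comm v′ b) e₂′))))

  tangentMatrix : V K → V K → V K → V K → Mat K
  tangentMatrix a u v b = zipV (zipV _+_) (outer a u) (outer v b)

  tangentMatrix-! : ∀ a u v b i j → tangentMatrix a u v b ! i ! j ≡ a ! i * u ! j + v ! i * b ! j
  tangentMatrix-! a u v b i j = trans (sum-! (outer a u) (outer v b) i j) (cong₂ _+_ (outer-! a u i j) (outer-! v b i j))
    where
    row-! : ∀ (r s : V K) j → zipV _+_ r s ! j ≡ r ! j + s ! j
    row-! r s 0F = refl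
    row-! r s 1F = refl
    row-! r s 2F = refl
    sum-! : ∀ M N i j → zipV (zipV _+_) M N ! i ! j ≡ M ! i ! j + N ! i ! j
    sum-! M N 0F j = row-! (M ! 0F) (N ! 0F) j
    sum-! M N 1F j = row-! (M ! 1F) (N ! 1F) j
    sum-! M N 2F j = row-! (M ! 2F) (N ! 2F) j

  module _ (a u v b : V K) where

    private
      ρ : Vec K 12
      ρ = entries (a , u , v) (proj₁ b ∷ proj₁ (proj₂ b) ∷ proj₂ (proj₂ b) ∷ [])
      A U W B : V (Polynomial 12)
      A = proj₁ Nₚ
      U = proj₁ (proj₂ Nₚ)
      W = proj₂ (proj₂ Nₚ)
      B = var (# 9) , var (# 10) , var (# 11)
      T : Mat (Polynomial 12)
      T = zipV (zipV _:+_) (Sym.outer A U) (Sym.outer W B)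

    tangent-trace : trace (tangentMatrix a u v b) ≡ dot u a + dot b v
    tangent-trace = prove ρ (Sym.trace T) (Sym.dot U A :+ Sym.dot B W) refl

    tangent-quad : quad (tangentMatrix a u v b) ≡ (0# + dot u v * dot b a) + (- dot b v) * dot u a
    tangent-quad = prove ρ (Sym.quad T) (0ₚ :+ Sym.dot U W :* Sym.dot B A :+ :- Sym.dot B W :* Sym.dot U A) refl

    tangent-det : det (tangentMatrix a u v b) ≡ 0#
    tangent-det = prove ρ (Sym.det T) 0ₚ refl

  -- The determinant vanishes because the rank is at most two, the trace is `u · a + b · v`, and the
  -- quadric evaluates to `(u · v)(b · a) - (b · v)(u · a)`.
  tangent-nil : ∀ {a b M} → dot b a ≡ 0# → Tangent a b M → Nil M
  tangent-nil {a} {b} {M} b·a (tangent u v e e₁ e₂) = subst Nil (sym M≡)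
    (trans (tangent-trace a u v b) (trans (cong₂ _+_ e₁ e₂) (+-identityʳ 0#)) ,
     drop₁ (dot u v) b·a (drop₁ (- dot b v) e₁ (tangent-quad a u v b)) ,
     tangent-det a u v b)
    where
    M≡ : M ≡ tangentMatrix a u v b
    M≡ = M-ext {M} {tangentMatrix a u v b} (λ i j → trans (e i j) (sym (tangentMatrix-! a u v b i j)))

  outer≢O : ∀ {a b} → outer a b ≢ O → a ≢ 𝟎 × b ≢ 𝟎
  outer≢O {a} {b} ne = (λ { refl → ne (cong₂ _,_ (scale-zeroˡ b) (cong₂ _,_ (scale-zeroˡ b) (scale-zeroˡ b))) }) ,
                       (λ { refl → ne (outer-𝟎 a) })

  -- A minor of `a ⊗ b + c ⊗ d` is the product of a minor of `(a , c)` and one of `(b , d)`, and all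
  -- minors of `e ⊗ f` vanish.
  sum-minors : ∀ {a b c d e f} → lin 1# 1# (outer a b) (outer c d) ≡ outer e f → ∀ i k j l →
               (a ! i * c ! k - a ! k * c ! i) * (b ! j * d ! l - b ! l * d ! j) ≡ 0#
  sum-minors {a} {b} {c} {d} {e} {f} eq i k j l = begin
    (a ! i * c ! k - a ! k * c ! i) * (b ! j * d ! l - b ! l * d ! j)
      ≡⟨ solve 8 (λ aᵢ aₖ cᵢ cₖ bⱼ bₗ dⱼ dₗ → (aᵢ :* cₖ :- aₖ :* cᵢ) :* (bⱼ :* dₗ :- bₗ :* dⱼ) :=
           (1ₚ :* (aᵢ :* bⱼ) :+ 1ₚ :* (cᵢ :* dⱼ)) :* (1ₚ :* (aₖ :* bₗ) :+ 1ₚ :* (cₖ :* dₗ)) :-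
           (1ₚ :* (aᵢ :* bₗ) :+ 1ₚ :* (cᵢ :* dₗ)) :* (1ₚ :* (aₖ :* bⱼ) :+ 1ₚ :* (cₖ :* dⱼ)))
           refl (a ! i) (a ! k) (c ! i) (c ! k) (b ! j) (b ! l) (d ! j) (d ! l) ⟩
    s i j * s k l - s i l * s k j
      ≡⟨ cong₂ _-_ (cong₂ _*_ (at i j) (at k l)) (cong₂ _*_ (at i l) (at k j)) ⟩
    (e ! i * f ! j) * (e ! k * f ! l) - (e ! i * f ! l) * (e ! k * f ! j)
      ≡⟨ solve 4 (λ eᵢ eₖ fⱼ fₗ → eᵢ :* fⱼ :* (eₖ :* fₗ) :- eᵢ :* fₗ :* (eₖ :* fⱼ) := 0ₚ) refl (e ! i) (e ! k) (f ! j) (f ! l) ⟩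
    0# ∎
    where
    s : Fin 3 → Fin 3 → K
    s i j = 1# * (a ! i * b ! j) + 1# * (c ! i * d ! j)
    at : ∀ i j → s i j ≡ e ! i * f ! j
    at i j = trans (sym (trans (lin-! 1# 1# (outer a b) (outer c d) i j)
        (cong₂ (λ x y → 1# * x + 1# * y) (outer-! a b i j) (outer-! c d i j))))
      (trans (cong (λ M → M ! i ! j) eq) (outer-! e f i j))

  -- By `sum-minors` two points of the Segre variety whose sum has rank at most one share a factor:
  -- `c` is parallel to `a`, or else some minor of `(a , c)` is nonzero and `d` is parallel to `b`.
  -- The vanishing trace of `c ⊗ d` then gives the incidence of the other factor.
  line-point-tangent : ∀ {a b c d e f} → outer a b ≢ O → lin 1# 1# (outer a b) (outer c d) ≡ outer e f →
                       trace (outer c d) ≡ 0# → Tangent a b (outer c d)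
  line-point-tangent {a} {b} {c} {d} {e} {f} ne eq tr₀ = by-cases (cross a c ≟ 𝟎)
    where
    d·c : dot d c ≡ 0#
    d·c = trans (sym (trace-outer c d)) tr₀
    by-cases : Dec (cross a c ≡ 𝟎) → Tangent a b (outer c d)
    by-cases (yes a∥c) = tangent (scale r d) 𝟎
      (λ i j → begin
        outer c d ! i ! j                       ≡⟨ trans (outer-! c d i j) (cong (_* d ! j) (scale-!≡ r a c≡ra i)) ⟩
        (r * a ! i) * d ! j                     ≡⟨ solve 4 (λ r a d b → r :* a :* d := a :* (r :* d) :+ 0ₚ :* b) refl r (a ! i) (d ! j) (b ! j) ⟩
        a ! i * (r * d ! j) + 0# * b ! j        ≡⟨ sym (cong₂ (λ x y → a ! i * x + y * b ! j) (scale-! r d j) (𝟎-! i)) ⟩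
        a ! i * scale r d ! j + 𝟎 ! i * b ! j   ∎)
      (begin
        dot (scale r d) a   ≡⟨ dot-scaleˡ r d a ⟩
        r * dot d a         ≡⟨ cong (r *_) (dot-comm d a) ⟩
        r * dot a d         ≡⟨ sym (dot-scaleˡ r a d) ⟩
        dot (scale r a) d   ≡⟨ cong (λ c → dot c d) (sym c≡ra) ⟩
        dot c d             ≡⟨ dot-comm c d ⟩
        dot d c             ≡⟨ d·c ⟩
        0#                  ∎)
      (dot-𝟎 b)
      where
      r = proj₁ (parallel {a} {c} (proj₁ (outer≢O {a} {b} ne)) a∥c)
      c≡ra : c ≡ scale r a
      c≡ra = proj₂ (parallel {a} {c} (proj₁ (outer≢O {a} {b} ne)) a∥c)
    by-cases (no a∦c) = tangent 𝟎 (scale r c)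
      (λ i j → begin
        outer c d ! i ! j                       ≡⟨ trans (outer-! c d i j) (cong (c ! i *_) (scale-!≡ r b d≡rb j)) ⟩
        c ! i * (r * b ! j)                     ≡⟨ solve 4 (λ r a c b → c :* (r :* b) := a :* 0ₚ :+ r :* c :* b) refl r (a ! i) (c ! i) (b ! j) ⟩
        a ! i * 0# + (r * c ! i) * b ! j        ≡⟨ sym (cong₂ (λ x y → a ! i * x + y * b ! j) (𝟎-! j) (scale-! r c i)) ⟩
        a ! i * 𝟎 ! j + scale r c ! i * b ! j   ∎)
      (dot-𝟎ˡ a)
      (begin
        dot b (scale r c)   ≡⟨ dot-comm b (scale r c) ⟩
        dot (scale r c) b   ≡⟨ dot-scaleˡ r c b ⟩
        r * dot c b         ≡⟨ cong (r *_) (dot-comm c b) ⟩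
        r * dot b c         ≡⟨ sym (dot-scaleˡ r b c) ⟩
        dot (scale r b) c   ≡⟨ cong (λ d → dot d c) (sym d≡rb) ⟩
        dot d c             ≡⟨ d·c ⟩
        0#                  ∎)
      where
      rows : ∃ λ i → ¬ (∀ k → a ! i * c ! k ≡ a ! k * c ! i)
      rows = Fin.¬∀⟶∃¬ 3 (λ i → ∀ k → a ! i * c ! k ≡ a ! k * c ! i) (λ i → Fin.all? (λ k → a ! i * c ! k ≟ a ! k * c ! i))
        (λ h → a∦c (zero-cross {a} {c} h))
      i = proj₁ rows
      row : ∃ λ k → a ! i * c ! k ≢ a ! k * c ! i
      row = Fin.¬∀⟶∃¬ 3 (λ k → a ! i * c ! k ≡ a ! k * c ! i) (λ k → a ! i * c ! k ≟ a ! k * c ! i) (proj₂ rows)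
      b∥d : cross b d ≡ 𝟎
      b∥d = zero-cross {b} {d} (λ j l → x-y≡0⇒x≡y (*-cancel₀ (proj₂ row ∘ x-y≡0⇒x≡y)
        (sum-minors {a} {b} {c} {d} {e} {f} eq i (proj₁ row) j l)))
      r = proj₁ (parallel {b} {d} (proj₂ (outer≢O {a} {b} ne)) b∥d)
      d≡rb : d ≡ scale r b
      d≡rb = proj₂ (parallel {b} {d} (proj₂ (outer≢O {a} {b} ne)) b∥d)

  -- M lies in the plane π_x of x = a⊗b; one line of Γ through x contains a⊗h₁ and a⊗h₂, the other v⊗b.
  record Flag (M : Mat K) : Set where
    field
      g₁ g₂ a h₁ h₂ : V K
      k₁ k₂ c d t   : K
      a≢𝟎           : a ≢ 𝟎
      h₁·a          : dot h₁ a ≡ 0#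
      h₂·a          : dot h₂ a ≡ 0#
      h₁·g₁         : dot h₁ g₁ ≡ 1#
      h₁·g₂         : dot h₁ g₂ ≡ 0#
      h₂·g₁         : dot h₂ g₁ ≡ 0#
      h₂·g₂         : dot h₂ g₂ ≡ 1#
      k≢0           : ¬ (k₁ ≡ 0# × k₂ ≡ 0#)
    v : V K
    v = comb k₂ (- k₁) g₁ g₂
    b : V K
    b = comb k₁ k₂ h₁ h₂
    field
      decomposition : ∀ i j → M ! i ! j ≡
        c * outer a h₁ ! i ! j + (d * outer a h₂ ! i ! j + (0# * outer a b ! i ! j + (t * outer v b ! i ! j + 0#)))

  opaque
    unfolding conj unconj

    unconj-product : ∀ p N → unconj p N ≡ frame p · N · frame⁻¹ p
    unconj-product p N = refl

  private
    -- The upper left part is `t` times the column `(k₂ , - k₁)` times the row `(k₁ , k₂)`, the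
    -- general nilpotent block.
    block : K → K → K → K → K → Mat K
    block k₁ k₂ t c d = ((t * (k₂ * k₁)) , (t * (k₂ * k₂)) , 0#) ,
                        ((- (t * (k₁ * k₁))) , (- (t * (k₁ * k₂))) , 0#) , (c , d , 0#)

    module _ (G H : Mat K) (k₁ k₂ t c d : K) where

      rebuilt : Fin 3 → Fin 3 → K
      rebuilt i j = c * (G ! i ! 2F * H ! 0F ! j) + (d * (G ! i ! 2F * H ! 1F ! j) +
        (t * ((k₂ * G ! i ! 0F + (- k₁) * G ! i ! 1F) * (k₁ * H ! 0F ! j + k₂ * H ! 1F ! j))))

      tabulateM : (Fin 3 → Fin 3 → K) → Mat K
      tabulateM f = (f 0F 0F , f 0F 1F , f 0F 2F) , (f 1F 0F , f 1F 1F , f 1F 2F) , (f 2F 0F , f 2F 1F , f 2F 2F)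

      tabulateM-! : ∀ f i j → tabulateM f ! i ! j ≡ f i j
      tabulateM-! f 0F 0F = refl
      tabulateM-! f 0F 1F = refl
      tabulateM-! f 0F 2F = refl
      tabulateM-! f 1F 0F = refl
      tabulateM-! f 1F 1F = refl
      tabulateM-! f 1F 2F = refl
      tabulateM-! f 2F 0F = refl
      tabulateM-! f 2F 1F = refl
      tabulateM-! f 2F 2F = refl

      product-block : G · block k₁ k₂ t c d · H ≡ tabulateM rebuilt
      product-block = prove-M (entries G (entries H (k₁ ∷ k₂ ∷ t ∷ c ∷ d ∷ [])))
        (Gₚ Sym.· ((((tₚ :* (k₂ₚ :* k₁ₚ)) , (tₚ :* (k₂ₚ :* k₂ₚ)) , 0ₚ) ,
                    ((:- (tₚ :* (k₁ₚ :* k₁ₚ))) , (:- (tₚ :* (k₁ₚ :* k₂ₚ))) , 0ₚ) , (cₚ , dₚ , 0ₚ))) Sym.· Hₚ)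
        ((at 0F 0F , at 0F 1F , at 0F 2F) , (at 1F 0F , at 1F 1F , at 1F 2F) , (at 2F 0F , at 2F 1F , at 2F 2F)) refl
        where
        Gₚ Hₚ : Mat (Polynomial 23)
        Gₚ = Nₚ
        Hₚ = (var (# 9) , var (# 10) , var (# 11)) , (var (# 12) , var (# 13) , var (# 14)) , (var (# 15) , var (# 16) , var (# 17))
        k₁ₚ k₂ₚ tₚ cₚ dₚ : Polynomial 23
        k₁ₚ = var (# 18)
        k₂ₚ = var (# 19)
        tₚ = var (# 20)
        cₚ = var (# 21)
        dₚ = var (# 22)
        at : Fin 3 → Fin 3 → Polynomial 23
        at i j = cₚ :* (Gₚ ! i ! 2F :* Hₚ ! 0F ! j) :+ (dₚ :* (Gₚ ! i ! 2F :* Hₚ ! 1F ! j) :+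
          (tₚ :* ((k₂ₚ :* Gₚ ! i ! 0F :+ (:- k₁ₚ) :* Gₚ ! i ! 1F) :* (k₁ₚ :* Hₚ ! 0F ! j :+ k₂ₚ :* Hₚ ! 1F ! j))))

    transpose-! : ∀ (M : Mat K) i j → transpose M ! i ! j ≡ M ! j ! i
    transpose-! M 0F 0F = refl
    transpose-! M 0F 1F = refl
    transpose-! M 0F 2F = refl
    transpose-! M 1F 0F = refl
    transpose-! M 1F 1F = refl
    transpose-! M 1F 2F = refl
    transpose-! M 2F 0F = refl
    transpose-! M 2F 1F = refl
    transpose-! M 2F 2F = refl

    identity : Mat K
    identity = (1# , 0# , 0#) , (0# , 1# , 0#) , (0# , 0# , 1#)

    frames-inverse : ∀ p → frame⁻¹ p · frame p ≡ identity
    frames-inverse (inj₁ (a , b))   = prove-M (a ∷ b ∷ [])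
      (Sym.frame⁻¹ (inj₁ (var (# 0) , var (# 1))) Sym.· Sym.frame (inj₁ (var (# 0) , var (# 1))))
      ((1ₚ , 0ₚ , 0ₚ) , (0ₚ , 1ₚ , 0ₚ) , (0ₚ , 0ₚ , 1ₚ)) refl
    frames-inverse (inj₂ (inj₁ a))  = prove-M (a ∷ [])
      (Sym.frame⁻¹ (inj₂ (inj₁ (var (# 0)))) Sym.· Sym.frame (inj₂ (inj₁ (var (# 0)))))
      ((1ₚ , 0ₚ , 0ₚ) , (0ₚ , 1ₚ , 0ₚ) , (0ₚ , 0ₚ , 1ₚ)) refl
    frames-inverse (inj₂ (inj₂ 0F)) = prove-M []
      (Sym.frame⁻¹ lastₚ Sym.· Sym.frame lastₚ)
      ((1ₚ , 0ₚ , 0ₚ) , (0ₚ , 1ₚ , 0ₚ) , (0ₚ , 0ₚ , 1ₚ)) refl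

    dual : ∀ p i j → dot (frame⁻¹ p ! i) (transpose (frame p) ! j) ≡ identity ! i ! j
    dual p i j = trans (dot-comm (frame⁻¹ p ! i) (transpose (frame p) ! j))
      (trans (sym (product-! i)) (cong (λ M → M ! i ! j) (frames-inverse p)))
      where
      product-! : ∀ i → (frame⁻¹ p · frame p) ! i ! j ≡ dot (transpose (frame p) ! j) (frame⁻¹ p ! i)
      product-! 0F = apply-! (transpose (frame p)) (frame⁻¹ p ! 0F) j
      product-! 1F = apply-! (transpose (frame p)) (frame⁻¹ p ! 1F) j
      product-! 2F = apply-! (transpose (frame p)) (frame⁻¹ p ! 2F) j

    block-flag : ∀ {M} p k₁ k₂ t c d → ¬ (k₁ ≡ 0# × k₂ ≡ 0#) → conj p M ≡ block k₁ k₂ t c d → Flag M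
    block-flag {M} p k₁ k₂ t c d k≢0 eq = record
      { g₁ = g 0F ; g₂ = g 1F ; a = g 2F ; h₁ = h 0F ; h₂ = h 1F ; k₁ = k₁ ; k₂ = k₂ ; c = c ; d = d ; t = t
      ; a≢𝟎 = λ e → ray≢𝟎 p (trans (sym (frame-ray p)) e)
      ; h₁·a = dual p 0F 2F ; h₂·a = dual p 1F 2F ; h₁·g₁ = dual p 0F 0F ; h₁·g₂ = dual p 0F 1F
      ; h₂·g₁ = dual p 1F 0F ; h₂·g₂ = dual p 1F 1F ; k≢0 = k≢0
      ; decomposition = λ i j → begin
          M ! i ! j
            ≡⟨ cong (λ M → M ! i ! j) (trans (sym (unconj-conj p M)) (trans (cong (unconj p) eq)
                 (trans (unconj-product p (block k₁ k₂ t c d)) (product-block (frame p) (frame⁻¹ p) k₁ k₂ t c d)))) ⟩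
          tabulateM (frame p) (frame⁻¹ p) k₁ k₂ t c d (rebuilt (frame p) (frame⁻¹ p) k₁ k₂ t c d) ! i ! j
            ≡⟨ tabulateM-! (frame p) (frame⁻¹ p) k₁ k₂ t c d (rebuilt (frame p) (frame⁻¹ p) k₁ k₂ t c d) i j ⟩
          rebuilt (frame p) (frame⁻¹ p) k₁ k₂ t c d i j
            ≡⟨ cong₂ (λ x y → c * x + (d * y + t * z i j)) (entry 2F 0F i j) (entry 2F 1F i j) ⟩
          c * outer (g 2F) (h 0F) ! i ! j + (d * outer (g 2F) (h 1F) ! i ! j + t * z i j)
            ≡⟨ cong (λ x → c * outer (g 2F) (h 0F) ! i ! j + (d * outer (g 2F) (h 1F) ! i ! j + x))
                 (solve 3 (λ t z y → t :* z := 0ₚ :* y :+ (t :* z :+ 0ₚ)) refl t (z i j) (outer (g 2F) b ! i ! j)) ⟩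
          c * outer (g 2F) (h 0F) ! i ! j + (d * outer (g 2F) (h 1F) ! i ! j + (0# * outer (g 2F) b ! i ! j + (t * z i j + 0#)))
            ≡⟨ cong (λ x → c * outer (g 2F) (h 0F) ! i ! j + (d * outer (g 2F) (h 1F) ! i ! j + (0# * outer (g 2F) b ! i ! j + (t * x + 0#))))
                 (sym (trans (outer-! v b i j) (cong₂ _*_
                   (trans (comb-! k₂ (- k₁) (g 0F) (g 1F) i) (cong₂ (λ x y → k₂ * x + (- k₁) * y) (transpose-! (frame p) 0F i) (transpose-! (frame p) 1F i)))
                   (comb-! k₁ k₂ (h 0F) (h 1F) j)))) ⟩
          c * outer (g 2F) (h 0F) ! i ! j + (d * outer (g 2F) (h 1F) ! i ! j + (0# * outer (g 2F) b ! i ! j + (t * outer v b ! i ! j + 0#))) ∎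
      }
      where
      g h : Fin 3 → V K
      g j = transpose (frame p) ! j
      h i = frame⁻¹ p ! i
      v b : V K
      v = comb k₂ (- k₁) (g 0F) (g 1F)
      b = comb k₁ k₂ (h 0F) (h 1F)
      z : Fin 3 → Fin 3 → K
      z i j = (k₂ * frame p ! i ! 0F + (- k₁) * frame p ! i ! 1F) * (k₁ * frame⁻¹ p ! 0F ! j + k₂ * frame⁻¹ p ! 1F ! j)
      entry : ∀ k l i j → frame p ! i ! k * frame⁻¹ p ! l ! j ≡ outer (g k) (h l) ! i ! j
      entry k l i j = sym (trans (outer-! (g k) (h l) i j) (cong (_* h l ! j) (transpose-! (frame p) k i)))

    -- The cone is parametrised by `t (k₁ k₂ , k₂^2 , - k₁^2)`. For nonzero `y` take
    -- `(k₁ , k₂) = (x , y)` and `t = 1/y`; if `y = 0` then `x = 0`, and `(1 , 0)` with `t = - z`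
    -- serves.
    killed-block : ∀ N → Nil N → col₃ N ≡ 𝟎 → ∃ λ k₁ → ∃ λ k₂ → ∃ λ t → ∃ λ c → ∃ λ d →
                   ¬ (k₁ ≡ 0# × k₂ ≡ 0#) × N ≡ block k₁ k₂ t c d
    killed-block ((x , y , _) , (z , w , _) , (c , d , _)) (tr₀ , quad₀ , _) refl = by-cases (y ≟ 0#)
      where
      w≡-x : w ≡ - x
      w≡-x = drop₁ 1# tr₀ (solve 2 (λ x w → w := :- x :+ 1ₚ :* (x :+ w :+ 0ₚ)) refl x w)
      cone : x * x + y * z ≡ 0#
      cone = drop₁ x tr₀ (drop₁ 1# quad₀ (solve 6 (λ x y z w c d → x :* x :+ y :* z :=
        0ₚ :+ x :* (x :+ w :+ 0ₚ) :+ 1ₚ :* Sym.quad ((x , y , 0ₚ) , (z , w , 0ₚ) , (c , d , 0ₚ))) refl x y z w c d))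
      assemble : ∀ {k₁ k₂ t} → x ≡ t * (k₂ * k₁) → y ≡ t * (k₂ * k₂) → z ≡ - (t * (k₁ * k₁)) → w ≡ - (t * (k₁ * k₂)) →
                 ((x , y , 0#) , (z , w , 0#) , (c , d , 0#)) ≡ block k₁ k₂ t c d
      assemble e₁ e₂ e₃ e₄ = cong₂ (λ u v → u , v , (c , d , 0#)) (cong₂ (λ x y → x , y , 0#) e₁ e₂) (cong₂ (λ x y → x , y , 0#) e₃ e₄)
      by-cases : Dec (y ≡ 0#) → ∃ λ k₁ → ∃ λ k₂ → ∃ λ t → ∃ λ c′ → ∃ λ d′ →
                 ¬ (k₁ ≡ 0# × k₂ ≡ 0#) × ((x , y , 0#) , (z , w , 0#) , (c , d , 0#)) ≡ block k₁ k₂ t c′ d′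
      by-cases (no y≢0) = x , y , inv y , c , d , (λ (_ , y≡0) → y≢0 y≡0) , assemble
        (cancel x)
        (cancel y)
        (*-cancelˡ y≢0 (drop₁ 1# cone (drop₁ (x * x) unit
          (solve 4 (λ x y z i → y :* z := y :* :- (i :* (x :* x)) :+ 1ₚ :* (x :* x :+ y :* z) :+ x :* x :* (y :* i :- 1ₚ)) refl x y z (inv y)))))
        (trans w≡-x (cong -_ (trans (cancel x) (cong (inv y *_) (*-comm y x)))))
        where
        unit : y * inv y - 1# ≡ 0#
        unit = x≡y⇒x-y≡0 (inv-r y≢0)
        cancel : ∀ x → x ≡ inv y * (y * x)
        cancel x = drop₁ (- x) unit (solve 3 (λ x y i → x := i :* (y :* x) :+ :- x :* (y :* i :- 1ₚ)) refl x y (inv y))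
      by-cases (yes refl) = 1# , 0# , - z , c , d , (λ (e , _) → 1≢0 e) , assemble
        (trans x≡0 (solve 1 (λ z → 0ₚ := :- z :* (0ₚ :* 1ₚ)) refl z))
        (solve 1 (λ z → 0ₚ := :- z :* (0ₚ :* 0ₚ)) refl z)
        (solve 1 (λ z → z := :- (:- z :* (1ₚ :* 1ₚ))) refl z)
        (trans w≡-x (trans (cong -_ x≡0) (solve 1 (λ z → :- 0ₚ := :- (:- z :* (1ₚ :* 0ₚ))) refl z)))
        where
        x≡0 : x ≡ 0#
        x≡0 = [ (λ e → e) , (λ e → e) ]′ (*-zero (drop₁ 1# cone (solve 2 (λ x z → x :* x := 0ₚ :+ 1ₚ :* (x :* x :+ 0ₚ :* z)) refl x z)))

  -- For nonzero `M` the kernel identity reads `kernelRays M = 1 + q (imageRays M)`, so some ray is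
  -- killed; in a frame at that ray `M` is a `block`.
  nil⇒flag : ∀ {M} → Nil M → M ≢ O → Flag M
  nil⇒flag {M} (tr₀ , quad₀ , det₀) M≢O with ∑-nonzero {A = Ω K} (λ p → ι (kills? (conj p M))) rays≢0
    where
    rays≢0 : kernelRays M ≢ 0
    rays≢0 e = ℕ.1+n≢0 (trans (sym (kernel-identity M tr₀ det₀)) (trans (cong₂ (λ s i → s ℕ.+ q ℕ.* (q ℕ.* q) ℕ.* i) e (ι-no (M ≟ O) M≢O))
      (ℕ.*-zeroʳ (q ℕ.* (q ℕ.* q)))))
  ... | p , ιp≢0 with kills? (conj p M)
  ...   | no _  = ⊥-elim (ιp≢0 refl)
  ...   | yes k with killed-block (conj p M) (trans (trace-conj p M) tr₀ , trans (quad-conj p M) quad₀ , trans (det-conj p M) det₀) k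
  ...     | k₁ , k₂ , t , c , d , k≢0 , eq = block-flag p k₁ k₂ t c d k≢0 eq

  module FlagProperties {M : Mat K} (fl : Flag M) where
    open Flag fl

    dot-b : ∀ u → dot b u ≡ k₁ * dot h₁ u + k₂ * dot h₂ u
    dot-b u = dot-comb k₁ k₂ h₁ h₂ u

    b·a : dot b a ≡ 0#
    b·a = trans (dot-b a) (zero-comb k₁ k₂ h₁·a h₂·a)

    dot-v : ∀ h → dot h v ≡ k₂ * dot h g₁ + (- k₁) * dot h g₂
    dot-v h = trans (dot-comm h v) (trans (dot-comb k₂ (- k₁) g₁ g₂ h)
      (cong₂ (λ x y → k₂ * x + (- k₁) * y) (dot-comm g₁ h) (dot-comm g₂ h)))

    h₁·v : dot h₁ v ≡ k₂
    h₁·v = trans (dot-v h₁) (trans (cong₂ (λ x y → k₂ * x + (- k₁) * y) h₁·g₁ h₁·g₂)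
      (solve 2 (λ x y → y :* 1ₚ :+ :- x :* 0ₚ := y) refl k₁ k₂))

    h₂·v : dot h₂ v ≡ - k₁
    h₂·v = trans (dot-v h₂) (trans (cong₂ (λ x y → k₂ * x + (- k₁) * y) h₂·g₁ h₂·g₂)
      (solve 2 (λ x y → y :* 0ₚ :+ :- x :* 1ₚ := :- x) refl k₁ k₂))

    -- `v` has coordinates `(k₂ , - k₁)` and `b` has coordinates `(k₁ , k₂)` in dual pairs of
    -- vectors; this is what puts `v ⊗ b` in the trace-zero hyperplane.
    b·v : dot b v ≡ 0#
    b·v = trans (dot-b v) (trans (cong₂ (λ x y → k₁ * x + k₂ * y) h₁·v h₂·v)
      (solve 2 (λ x y → x :* y :+ y :* :- x := 0ₚ) refl k₁ k₂))

    -- `h₁` and `h₂` take the values `k₂` and `- k₁` at `v`, not both zero. As both vanish at `a`,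
    -- this keeps `v` off the ray of `a`.
    v-free : ∀ s → s * dot h₁ v ≡ 0# → s * dot h₂ v ≡ 0# → s ≡ 0#
    v-free s e₁ e₂ with s ≟ 0#
    ... | yes s≡0 = s≡0
    ... | no s≢0  = ⊥-elim (k≢0 (k₁≡0 , trans (sym h₁·v) (*-cancel₀ s≢0 e₁)))
      where
      k₁≡0 : k₁ ≡ 0#
      k₁≡0 = trans (solve 1 (λ x → x := :- (:- x)) refl k₁) (trans (cong -_ (trans (sym h₂·v) (*-cancel₀ s≢0 e₂))) (solve 0 (:- 0ₚ := 0ₚ) refl))

-- Hyperbolic coordinates on the trace-zero quadric.

module HyperbolicForm {ℓ₁ ℓ₂ : Level} {q : ℕ} (F : FiniteField ℓ₁ ℓ₂ q) where

  open FiniteField F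
  open import Data.Fin using (#_)
  open import Data.Fin.Patterns
  open import Data.Vec.Base as Vec using (Vec)
  open import Data.Vec.Functional using (Vector; []; _∷_; _++_)
  open RingSolver commutativeRing
  open Point

  drop : ∀ {x y u} c → u ≈ 0# → x ≈ y + c * u → x ≈ y
  drop {y = y} c u≈0 e = trans e (trans (+-congˡ (trans (*-congˡ u≈0) (zeroʳ c))) (+-identityʳ y))

  difference : ∀ {x y} → x ≈ y → x - y ≈ 0#
  difference {y = y} e = trans (+-congʳ e) (-‿inverseʳ y)

  -- The entries are parameters so that the same table serves as vectors over the field and as
  -- polynomials for the solver.
  block-basis : ∀ {a} {A : Set a} (o i x₁ x₅ x₉ y₁ y₅ y₉ : A) → Vector (Vector A 9) 8
  block-basis o i x₁ x₅ x₉ y₁ y₅ y₉ =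
    (o ∷ i ∷ o ∷ o ∷ o ∷ o ∷ o ∷ o ∷ o ∷ []) ∷
    (o ∷ o ∷ i ∷ o ∷ o ∷ o ∷ o ∷ o ∷ o ∷ []) ∷
    (o ∷ o ∷ o ∷ o ∷ o ∷ i ∷ o ∷ o ∷ o ∷ []) ∷
    (x₁ ∷ o ∷ o ∷ o ∷ x₅ ∷ o ∷ o ∷ o ∷ x₉ ∷ []) ∷
    (o ∷ o ∷ o ∷ i ∷ o ∷ o ∷ o ∷ o ∷ o ∷ []) ∷
    (o ∷ o ∷ o ∷ o ∷ o ∷ o ∷ i ∷ o ∷ o ∷ []) ∷
    (o ∷ o ∷ o ∷ o ∷ o ∷ o ∷ o ∷ i ∷ o ∷ []) ∷
    (y₁ ∷ o ∷ o ∷ o ∷ y₅ ∷ o ∷ o ∷ o ∷ y₉ ∷ []) ∷ []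

  private
    atₚ : Fin 9 → Polynomial 14
    atₚ k = var (# 0) :* b 0F k :+ (var (# 1) :* b 1F k :+ (var (# 2) :* b 2F k :+ (var (# 3) :* b 3F k :+
            (var (# 4) :* b 4F k :+ (var (# 5) :* b 5F k :+ (var (# 6) :* b 6F k :+ (var (# 7) :* b 7F k :+ 0ₚ)))))))
      where
      b : Vector (Vector (Polynomial 14) 9) 8
      b = block-basis 0ₚ 1ₚ (var (# 8)) (var (# 9)) (var (# 10)) (var (# 11)) (var (# 12)) (var (# 13))

  -- `δ` is the inverse of `w - w²`. From `x = X₁ - w X₅` and `y = X₁ - w² X₅` one recovers
  -- `X₅ = δ (y - x)` and `X₁ = δ (w y - w² x)`, and `X₉` is minus their sum; this gives the
  -- coefficients of the two diagonal basis vectors.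
  module _ (w δ : Carrier) (ww²≈1 : w * - (1# + w) ≈ 1#) (δ-inverse : (w - - (1# + w)) * δ ≈ 1#) where

    w² : Carrier
    w² = - (1# + w)

    -- Dual to the coordinates X₂, X₃, X₆, X₁ - w X₅ and X₄, X₇, X₈, X₁ - w² X₅ on Π.
    basis : Vector (Vector Carrier 9) 8
    basis = block-basis 0# 1# (- (w² * δ)) (- δ) (w² * δ + δ) (w * δ) δ (- (w * δ + δ))

    private
      module _ (a : Vector Carrier 8) where

        at : Fin 9 → Carrier
        at = linComb F a basis

        ρ : Vec Carrier 14
        ρ = a 0F Vec.∷ a 1F Vec.∷ a 2F Vec.∷ a 3F Vec.∷ a 4F Vec.∷ a 5F Vec.∷ a 6F Vec.∷ a 7F Vec.∷
            - (w² * δ) Vec.∷ - δ Vec.∷ (w² * δ + δ) Vec.∷ (w * δ) Vec.∷ δ Vec.∷ - (w * δ + δ) Vec.∷ Vec.[]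

        at₁ : at 1F ≈ a 0F
        at₁ = prove ρ (atₚ 1F) (var (# 0)) refl
        at₂ : at 2F ≈ a 1F
        at₂ = prove ρ (atₚ 2F) (var (# 1)) refl
        at₅ : at 5F ≈ a 2F
        at₅ = prove ρ (atₚ 5F) (var (# 2)) refl
        at₃ : at 3F ≈ a 4F
        at₃ = prove ρ (atₚ 3F) (var (# 4)) refl
        at₆ : at 6F ≈ a 5F
        at₆ = prove ρ (atₚ 6F) (var (# 5)) refl
        at₇ : at 7F ≈ a 6F
        at₇ = prove ρ (atₚ 7F) (var (# 6)) refl
        at₀ : at 0F ≈ a 3F * - (w² * δ) + a 7F * (w * δ)
        at₀ = prove ρ (atₚ 0F) (var (# 3) :* var (# 8) :+ var (# 7) :* var (# 11)) refl
        at₄ : at 4F ≈ a 3F * - δ + a 7F * δ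
        at₄ = prove ρ (atₚ 4F) (var (# 3) :* var (# 9) :+ var (# 7) :* var (# 12)) refl
        at₈ : at 8F ≈ a 3F * (w² * δ + δ) + a 7F * - (w * δ + δ)
        at₈ = prove ρ (atₚ 8F) (var (# 3) :* var (# 10) :+ var (# 7) :* var (# 13)) refl

        at-x₃ : at 0F - w * at 4F ≈ a 3F
        at-x₃ = trans (+-cong at₀ (-‿cong (*-congˡ at₄))) (drop (a 3F) (difference δ-inverse)
          (solve 4 (λ a h w δ → let w² = :- (1ₚ :+ w) in a :* :- (w² :* δ) :+ h :* (w :* δ) :- w :* (a :* :- δ :+ h :* δ) :=
            a :+ a :* ((w :- w²) :* δ :- 1ₚ)) refl (a 3F) (a 7F) w δ))

        at-y₃ : at 0F - w² * at 4F ≈ a 7F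
        at-y₃ = trans (+-cong at₀ (-‿cong (*-congˡ at₄))) (drop (a 7F) (difference δ-inverse)
          (solve 4 (λ a h w δ → let w² = :- (1ₚ :+ w) in a :* :- (w² :* δ) :+ h :* (w :* δ) :- w² :* (a :* :- δ :+ h :* δ) :=
            h :+ h :* ((w :- w²) :* δ :- 1ₚ)) refl (a 3F) (a 7F) w δ))

        at-trace : at 0F + at 4F + at 8F ≈ 0#
        at-trace = trans (+-cong (+-cong at₀ at₄) at₈)
          (solve 4 (λ a h w δ → let w² = :- (1ₚ :+ w) in (a :* :- (w² :* δ) :+ h :* (w :* δ)) :+ (a :* :- δ :+ h :* δ) :+
            (a :* (w² :* δ :+ δ) :+ h :* :- (w :* δ :+ δ)) := 0ₚ) refl (a 3F) (a 7F) w δ)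

    independent : LinearlyIndependent F basis
    independent a h = λ
      { 0F → trans (sym (at₁ a)) (h 1F)
      ; 1F → trans (sym (at₂ a)) (h 2F)
      ; 2F → trans (sym (at₅ a)) (h 5F)
      ; 3F → trans (sym (at-x₃ a)) (combine₀ w)
      ; 4F → trans (sym (at₃ a)) (h 3F)
      ; 5F → trans (sym (at₆ a)) (h 6F)
      ; 6F → trans (sym (at₇ a)) (h 7F)
      ; 7F → trans (sym (at-y₃ a)) (combine₀ w²) }
      where
      combine₀ : ∀ s → linComb F a basis 0F - s * linComb F a basis 4F ≈ 0#
      combine₀ s = trans (+-cong (h 0F) (-‿cong (*-congˡ (h 4F)))) (solve 1 (λ s → 0ₚ :- s :* 0ₚ := 0ₚ) refl s)

    private
      form : (x₁ x₂ x₃ x₄ x₅ x₆ x₇ x₈ : Carrier) → Carrier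
      form x₁ x₂ x₃ x₄ x₅ x₆ x₇ x₈ = x₂ * x₄ + (x₃ * x₇ + (x₆ * x₈ + ((x₁ - w * x₅) * (x₁ - w² * x₅) + 0#)))

      -- On Π the diagonal part is X₁² + X₁X₅ + X₅² = (X₁ - w X₅)(X₁ - w² X₅).
      quadric-form : ∀ x₁ x₂ x₃ x₄ x₅ x₆ x₇ x₈ x₉ → x₁ + x₅ + x₉ ≈ 0# →
        x₂ * x₄ - x₁ * x₅ + x₃ * x₇ - x₁ * x₉ + x₆ * x₈ - x₅ * x₉ ≈ form x₁ x₂ x₃ x₄ x₅ x₆ x₇ x₈
      quadric-form x₁ x₂ x₃ x₄ x₅ x₆ x₇ x₈ x₉ e = drop (- (x₁ + x₅)) e (drop (- (x₅ * x₅)) (difference ww²≈1)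
        (solve 10 (λ x₁ x₂ x₃ x₄ x₅ x₆ x₇ x₈ x₉ w → let w² = :- (1ₚ :+ w) in
          x₂ :* x₄ :- x₁ :* x₅ :+ x₃ :* x₇ :- x₁ :* x₉ :+ x₆ :* x₈ :- x₅ :* x₉ :=
          (x₂ :* x₄ :+ (x₃ :* x₇ :+ (x₆ :* x₈ :+ ((x₁ :- w :* x₅) :* (x₁ :- w² :* x₅) :+ 0ₚ))))
            :+ :- (x₁ :+ x₅) :* (x₁ :+ x₅ :+ x₉) :+ :- (x₅ :* x₅) :* (w :* w² :- 1ₚ))
          refl x₁ x₂ x₃ x₄ x₅ x₆ x₇ x₈ x₉ w))

    hyperbolic : IsHyperbolicQuadric F 4 (Q⁺₇ F)
    hyperbolic = basis , independent , λ P → mk⇔ (coordinates P) (membership P)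
      where
      coordinates : ∀ P → Q⁺₇ F P → _
      coordinates P (Πp , Qp) = (X 1F ∷ X 2F ∷ X 5F ∷ X 0F - w * X 4F ∷ []) , (X 3F ∷ X 6F ∷ X 7F ∷ X 0F - w² * X 4F ∷ []) ,
        (λ { 0F → sym (trans (at₀ a) x₁≈)
           ; 1F → sym (at₁ a)
           ; 2F → sym (at₂ a)
           ; 3F → sym (at₃ a)
           ; 4F → sym (trans (at₄ a) x₅≈)
           ; 5F → sym (at₅ a)
           ; 6F → sym (at₆ a)
           ; 7F → sym (at₇ a)
           ; 8F → sym (trans (at₈ a) x₉≈) }) ,
        trans (sym (quadric-form _ _ _ _ _ _ _ _ _ Πp)) Qp
        where
        X = coord P
        a : Vector Carrier 8
        a = (X 1F ∷ X 2F ∷ X 5F ∷ X 0F - w * X 4F ∷ []) ++ (X 3F ∷ X 6F ∷ X 7F ∷ X 0F - w² * X 4F ∷ [])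
        x₁≈ : (X 0F - w * X 4F) * - (w² * δ) + (X 0F - w² * X 4F) * (w * δ) ≈ X 0F
        x₁≈ = drop (X 0F) (difference δ-inverse) (solve 4 (λ x y w δ → let w² = :- (1ₚ :+ w) in
          (x :- w :* y) :* :- (w² :* δ) :+ (x :- w² :* y) :* (w :* δ) := x :+ x :* ((w :- w²) :* δ :- 1ₚ)) refl (X 0F) (X 4F) w δ)
        x₅≈ : (X 0F - w * X 4F) * - δ + (X 0F - w² * X 4F) * δ ≈ X 4F
        x₅≈ = drop (X 4F) (difference δ-inverse) (solve 4 (λ x y w δ → let w² = :- (1ₚ :+ w) in
          (x :- w :* y) :* :- δ :+ (x :- w² :* y) :* δ := y :+ y :* ((w :- w²) :* δ :- 1ₚ)) refl (X 0F) (X 4F) w δ)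
        x₉≈ : (X 0F - w * X 4F) * (w² * δ + δ) + (X 0F - w² * X 4F) * - (w * δ + δ) ≈ X 8F
        x₉≈ = drop (- 1#) Πp (drop (- (X 0F + X 4F)) (difference δ-inverse) (solve 5 (λ x y z w δ → let w² = :- (1ₚ :+ w) in
          (x :- w :* y) :* (w² :* δ :+ δ) :+ (x :- w² :* y) :* :- (w :* δ :+ δ) :=
          z :+ :- 1ₚ :* (x :+ y :+ z) :+ :- (x :+ y) :* ((w :- w²) :* δ :- 1ₚ)) refl (X 0F) (X 4F) (X 8F) w δ))
      membership : ∀ P → _ → Q⁺₇ F P
      membership P (x , y , e , xy≈0) = Πp , trans (quadric-form _ _ _ _ _ _ _ _ _ Πp) (trans same xy≈0)
        where
        a : Vector Carrier 8
        a = x ++ y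
        X = coord P
        Πp : X 0F + X 4F + X 8F ≈ 0#
        Πp = trans (+-cong (+-cong (e 0F) (e 4F)) (e 8F)) (at-trace a)
        shifted : ∀ s → X 0F - s * X 4F ≈ linComb F a basis 0F - s * linComb F a basis 4F
        shifted s = +-cong (e 0F) (-‿cong (*-congˡ (e 4F)))
        same : form (X 0F) (X 1F) (X 2F) (X 3F) (X 4F) (X 5F) (X 6F) (X 7F) ≈
               x 0F * y 0F + (x 1F * y 1F + (x 2F * y 2F + (x 3F * y 3F + 0#)))
        same = +-cong (*-cong (trans (e 1F) (at₁ a)) (trans (e 3F) (at₃ a)))
          (+-cong (*-cong (trans (e 2F) (at₂ a)) (trans (e 6F) (at₆ a)))
          (+-cong (*-cong (trans (e 5F) (at₅ a)) (trans (e 7F) (at₇ a)))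
          (+-congʳ (*-cong (trans (shifted w) (at-x₃ a)) (trans (shifted w²) (at-y₃ a))))))

-- Transport of the geometry to matrices over `Fin q`.

module Quadric {ℓ₁ ℓ₂ : Level} {q : ℕ} (q%3≡1 : q Data.Nat.Base.% 3 ≡ 1) (F : FiniteField ℓ₁ ℓ₂ q) where

  import Algebra.Morphism.RingMonomorphism as RingMonomorphism
  open import Algebra.Morphism.Structures using (IsRingMonomorphism)
  open import Data.Fin.Base using (combine; quotient; remainder)
  open import Data.Fin using (#_)
  open import Data.Fin.Patterns
  import Data.Fin.Properties as Fin
  import Data.Nat.Base as ℕ
  import Data.Nat.Properties as ℕ
  open import Data.Vec.Base using () renaming (_∷_ to _∷ᵥ_; [] to []ᵥ)
  open import Data.Vec.Functional using ([]; _∷_)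
  open import Function.Bundles using (Inverse)
  open import Relation.Unary using (_∈_; _∩_)
  open ≡ using (refl; sym; trans; cong; cong₂; subst; module ≡-Reasoning)
  open ≡-Reasoning
  open FiniteSums using (_≟_; Enumeration; enumeration)
  open Matrices
  open Point
  open Line

  private module F = FiniteField F

  φ : F.Carrier → Fin q
  φ = Inverse.to F.cardinality

  ψ : Fin q → F.Carrier
  ψ = Inverse.from F.cardinality

  φψ : ∀ x → φ (ψ x) ≡ x
  φψ = Inverse.strictlyInverseˡ F.cardinality

  ψφ : ∀ x → ψ (φ x) F.≈ x
  ψφ = Inverse.strictlyInverseʳ F.cardinality

  φ-cong : ∀ {x y} → x F.≈ y → φ x ≡ φ y
  φ-cong = Inverse.to-cong F.cardinality

  φ-injective : ∀ {x y} → φ x ≡ φ y → x F.≈ y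
  φ-injective {x} {y} e = F.trans (F.sym (ψφ x)) (F.trans (F.reflexive (cong ψ e)) (ψφ y))

  infixl 6 _⊕_
  infixl 7 _⊛_
  _⊕_ _⊛_ : Fin q → Fin q → Fin q
  x ⊕ y = φ (ψ x F.+ ψ y)
  x ⊛ y = φ (ψ x F.* ψ y)

  ⊝_ : Fin q → Fin q
  ⊝ x = φ (F.- ψ x)

  𝟘 𝟙 : Fin q
  𝟘 = φ F.0#
  𝟙 = φ F.1#

  ⊕-rawRing : RawRing _ _
  ⊕-rawRing = record { Carrier = Fin q ; _≈_ = _≡_ ; _+_ = _⊕_ ; _*_ = _⊛_ ; -_ = ⊝_ ; 0# = 𝟘 ; 1# = 𝟙 }

  -- The operations on `Fin q` are defined by passing through the field, so `ψ` respects them and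
  -- the ring laws can be pulled back along it.
  ψ-isRingMonomorphism : IsRingMonomorphism ⊕-rawRing F.rawRing ψ
  ψ-isRingMonomorphism = record
    { isRingHomomorphism = record
      { isSemiringHomomorphism = record
        { isNearSemiringHomomorphism = record
          { +-isMonoidHomomorphism = record
            { isMagmaHomomorphism = record
              { isRelHomomorphism = record { cong = λ e → F.reflexive (cong ψ e) }
              ; homo = λ x y → ψφ _ }
            ; ε-homo = ψφ _ }
          ; *-homo = λ x y → ψφ _ }
        ; 1#-homo = ψφ _ }
      ; -‿homo = λ x → ψφ _ }
    ; injective = λ {x} {y} e → trans (sym (φψ x)) (trans (φ-cong e) (φψ y)) }

  isCR : IsCommutativeRing _≡_ _⊕_ _⊛_ ⊝_ 𝟘 𝟙
  isCR = RingMonomorphism.isCommutativeRing ψ-isRingMonomorphism F.isCommutativeRing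

  1≢0 : 𝟙 ≢ 𝟘
  1≢0 e = F.1≉0 (φ-injective e)

  inverse : ∀ x → x ≢ 𝟘 → ∃ λ y → x ⊛ y ≡ 𝟙
  inverse x x≢0 with F.inverse (ψ x) (λ e → x≢0 (trans (sym (φψ x)) (φ-cong e)))
  ... | y , e = φ y , φ-cong (F.trans (F.*-congˡ (ψφ y)) e)

  φ-+ : ∀ x y → φ (x F.+ y) ≡ φ x ⊕ φ y
  φ-+ x y = φ-cong (F.+-cong (F.sym (ψφ x)) (F.sym (ψφ y)))

  φ-* : ∀ x y → φ (x F.* y) ≡ φ x ⊛ φ y
  φ-* x y = φ-cong (F.*-cong (F.sym (ψφ x)) (F.sym (ψφ y)))

  φ-neg : ∀ x → φ (F.- x) ≡ ⊝ φ x
  φ-neg x = φ-cong (F.-‿cong (F.sym (ψφ x)))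

  open FiniteFields isCR 1≢0 inverse q%3≡1

  φ-- : ∀ x y → φ (x F.- y) ≡ φ x - φ y
  φ-- x y = trans (φ-+ x (F.- y)) (cong (φ x ⊕_) (φ-neg y))

  -- Projective points, spans and incidence in terms of matrices.

  mat : Point F 8 → Mat K
  mat P = (x (# 0) , x (# 1) , x (# 2)) , (x (# 3) , x (# 4) , x (# 5)) , (x (# 6) , x (# 7) , x (# 8))
    where
    x : Fin 9 → K
    x k = φ (coord P k)

  mat-! : ∀ P i j → mat P ! i ! j ≡ φ (coord P (combine i j))
  mat-! P 0F 0F = refl
  mat-! P 0F 1F = refl
  mat-! P 0F 2F = refl
  mat-! P 1F 0F = refl
  mat-! P 1F 1F = refl
  mat-! P 1F 2F = refl
  mat-! P 2F 0F = refl
  mat-! P 2F 1F = refl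
  mat-! P 2F 2F = refl

  positions : ∀ {p} {B : Fin 9 → Set p} → (∀ (i j : Fin 3) → B (combine i j)) → ∀ k → B k
  positions {B = B} h k with Fin.combine-surjective {3} {3} k
  ... | i , j , e = subst B e (h i j)

  O-! : ∀ i j → O ! i ! j ≡ 0#
  O-! 0F j = 𝟎-! j
  O-! 1F j = 𝟎-! j
  O-! 2F j = 𝟎-! j

  mat≢O : ∀ P → mat P ≢ O
  mat≢O P e = nonzero P (positions λ i j → φ-injective (trans (sym (mat-! P i j)) (trans (cong (λ M → M ! i ! j) e) (O-! i j))))

  point : (N : Mat K) → N ≢ O → Point F 8
  point N N≢O = record { coord = x ; nonzero = λ h → N≢O (M-ext {N} {O} λ i j → trans (sym (x-combine i j)) (trans (φ-cong (h (combine i j))) (sym (O-! i j)))) }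
    where
    x : Fin 9 → F.Carrier
    x k = ψ (N ! quotient {3} 3 k ! remainder {3} 3 k)
    x-combine : ∀ i j → φ (x (combine i j)) ≡ N ! i ! j
    x-combine i j = trans (φψ _) (cong (λ (i , j) → N ! i ! j) (Fin.remQuot-combine {3} {3} i j))

  mat-point : ∀ N N≢O → mat (point N N≢O) ≡ N
  mat-point N N≢O = M-ext {mat (point N N≢O)} {N} λ i j → trans (mat-! (point N N≢O) i j)
    (trans (φψ _) (cong (λ (i , j) → N ! i ! j) (Fin.remQuot-combine {3} {3} i j)))

  Π⇒ : ∀ P → Π F P → trace (mat P) ≡ 0#
  Π⇒ P e = trans (sym (trans (φ-+ _ _) (cong (_⊕ φ (coord P (# 8))) (φ-+ _ _)))) (φ-cong e)

  Π⇐ : ∀ P → trace (mat P) ≡ 0# → Π F P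
  Π⇐ P e = φ-injective (trans (trans (φ-+ _ _) (cong (_⊕ φ (coord P (# 8))) (φ-+ _ _))) e)

  private
    φ-quad : ∀ a b c d e f g h i → φ (b F.* d F.- a F.* e F.+ c F.* g F.- a F.* i F.+ f F.* h F.- e F.* i) ≡
             quad ((φ a , φ b , φ c) , (φ d , φ e , φ f) , (φ g , φ h , φ i))
    φ-quad a b c d e f g h i = minus (plus (minus (plus (minus (φ-* b d) (φ-* a e)) (φ-* c g)) (φ-* a i)) (φ-* f h)) (φ-* e i)
      where
      plus : ∀ {x y u v} → φ x ≡ u → φ y ≡ v → φ (x F.+ y) ≡ u + v
      plus {x} {y} refl refl = φ-+ x y
      minus : ∀ {x y u v} → φ x ≡ u → φ y ≡ v → φ (x F.- y) ≡ u - v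
      minus {x} {y} refl refl = φ-- x y

  Q₈⇒ : ∀ P → Q₈ F P → quad (mat P) ≡ 0#
  Q₈⇒ P e = trans (sym (φ-quad _ _ _ _ _ _ _ _ _)) (φ-cong e)

  Q₈⇐ : ∀ P → quad (mat P) ≡ 0# → Q₈ F P
  Q₈⇐ P e = φ-injective (trans (φ-quad _ _ _ _ _ _ _ _ _) e)

  Segre⇒ : ∀ P → Segre F P → ∃₂ λ a b → mat P ≡ outer a b
  Segre⇒ P (a , b , _ , _ , e) = u , v , M-ext {mat P} {outer u v} λ i j → trans (mat-! P i j) (trans (φ-cong (e i j))
      (trans (φ-* (a i) (b j)) (trans (cong₂ _⊛_ (tab-! a i) (tab-! b j)) (sym (outer-! u v i j)))))
    where
    tab : (Fin 3 → F.Carrier) → V K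
    tab a = φ (a 0F) , φ (a 1F) , φ (a 2F)
    tab-! : ∀ a i → φ (a i) ≡ tab a ! i
    tab-! a 0F = refl
    tab-! a 1F = refl
    tab-! a 2F = refl
    u = tab a
    v = tab b

  Segre⇐ : ∀ P a b → mat P ≡ outer a b → Segre F P
  Segre⇐ P a b e = (λ i → ψ (a ! i)) , (λ j → ψ (b ! j)) ,
    (λ h → proj₁ ne (V-ext {u = a} {v = 𝟎} λ i → zero (a ! i) (h i) i)) ,
    (λ h → proj₂ ne (V-ext {u = b} {v = 𝟎} λ i → zero (b ! i) (h i) i)) ,
    λ i j → φ-injective (trans (sym (mat-! P i j)) (trans (cong (λ M → M ! i ! j) e) (outer-! a b i j)))
    where
    ne = outer≢O {a} {b} (λ e′ → mat≢O P (trans e e′))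
    zero : ∀ x → ψ x F.≈ F.0# → ∀ i → x ≡ 𝟎 ! i
    zero x h i = trans (sym (φψ x)) (trans (φ-cong h) (sym (𝟎-! i)))

  Span₂⇒ : ∀ {P R S} → Span F (P ∷ R ∷ []) S → ∃₂ λ s t → mat S ≡ lin s t (mat P) (mat R)
  Span₂⇒ {P} {R} {S} (a , e) = s , t , M-ext {mat S} {lin s t (mat P) (mat R)} λ i j → begin
    mat S ! i ! j
      ≡⟨ trans (mat-! S i j) (φ-cong (F.trans (e (combine i j)) (F.+-congˡ (F.+-identityʳ _)))) ⟩
    φ (a 0F F.* coord P (combine i j) F.+ a 1F F.* coord R (combine i j))
      ≡⟨ trans (φ-+ _ _) (cong₂ _⊕_ (φ-* _ _) (φ-* _ _)) ⟩
    s ⊛ φ (coord P (combine i j)) ⊕ t ⊛ φ (coord R (combine i j))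
      ≡⟨ sym (cong₂ (λ x y → s ⊛ x ⊕ t ⊛ y) (mat-! P i j) (mat-! R i j)) ⟩
    s ⊛ mat P ! i ! j ⊕ t ⊛ mat R ! i ! j
      ≡⟨ sym (lin-! s t (mat P) (mat R) i j) ⟩
    lin s t (mat P) (mat R) ! i ! j ∎
    where
    s = φ (a 0F)
    t = φ (a 1F)

  Span₂⇐ : ∀ {P R S} s t → mat S ≡ lin s t (mat P) (mat R) → Span F (P ∷ R ∷ []) S
  Span₂⇐ {P} {R} {S} s t e = (ψ s ∷ ψ t ∷ []) , positions λ i j → φ-injective (begin
    φ (coord S (combine i j))
      ≡⟨ sym (mat-! S i j) ⟩
    mat S ! i ! j
      ≡⟨ trans (cong (λ M → M ! i ! j) e) (lin-! s t (mat P) (mat R) i j) ⟩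
    s ⊛ mat P ! i ! j ⊕ t ⊛ mat R ! i ! j
      ≡⟨ cong₂ _⊕_ (cong₂ _⊛_ (sym (φψ s)) (mat-! P i j)) (cong₂ _⊛_ (sym (φψ t)) (mat-! R i j)) ⟩
    φ (ψ s) ⊛ φ (coord P (combine i j)) ⊕ φ (ψ t) ⊛ φ (coord R (combine i j))
      ≡⟨ sym (trans (φ-+ _ _) (cong₂ _⊕_ (φ-* _ _) (φ-* _ _))) ⟩
    φ (ψ s F.* coord P (combine i j) F.+ ψ t F.* coord R (combine i j))
      ≡⟨ φ-cong (F.+-congˡ (F.sym (F.+-identityʳ _))) ⟩
    φ (ψ s F.* coord P (combine i j) F.+ (ψ t F.* coord R (combine i j) F.+ F.0#)) ∎)

  sum₄ : (s₁ s₂ s₃ s₄ m₁ m₂ m₃ m₄ : K) → K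
  sum₄ s₁ s₂ s₃ s₄ m₁ m₂ m₃ m₄ = s₁ ⊛ m₁ ⊕ (s₂ ⊛ m₂ ⊕ (s₃ ⊛ m₃ ⊕ (s₄ ⊛ m₄ ⊕ 0#)))

  φ-sum₄ : ∀ s₁ s₂ s₃ s₄ m₁ m₂ m₃ m₄ →
           φ (s₁ F.* m₁ F.+ (s₂ F.* m₂ F.+ (s₃ F.* m₃ F.+ (s₄ F.* m₄ F.+ F.0#)))) ≡
           sum₄ (φ s₁) (φ s₂) (φ s₃) (φ s₄) (φ m₁) (φ m₂) (φ m₃) (φ m₄)
  φ-sum₄ s₁ s₂ s₃ s₄ m₁ m₂ m₃ m₄ = step s₁ m₁ (step s₂ m₂ (step s₃ m₃ (step s₄ m₄ refl)))
    where
    step : ∀ s m {x y} → φ x ≡ y → φ (s F.* m F.+ x) ≡ φ s ⊛ φ m ⊕ y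
    step s m e = trans (φ-+ _ _) (cong₂ _⊕_ (φ-* s m) e)

  Span₄⇒ : ∀ {P₁ P₂ P₃ P₄ S} → Span F (P₁ ∷ P₂ ∷ P₃ ∷ P₄ ∷ []) S → ∃₂ λ s₁ s₂ → ∃₂ λ s₃ s₄ → ∀ i j →
           mat S ! i ! j ≡ sum₄ s₁ s₂ s₃ s₄ (mat P₁ ! i ! j) (mat P₂ ! i ! j) (mat P₃ ! i ! j) (mat P₄ ! i ! j)
  Span₄⇒ {P₁} {P₂} {P₃} {P₄} {S} (a , e) = φ (a 0F) , φ (a 1F) , φ (a 2F) , φ (a 3F) , λ i j →
    trans (mat-! S i j) (trans (φ-cong (e (combine i j))) (trans (φ-sum₄ _ _ _ _ _ _ _ _)
      (sym (cong₂ (λ (w , x) (y , z) → sum₄ (φ (a 0F)) (φ (a 1F)) (φ (a 2F)) (φ (a 3F)) w x y z)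
        (cong₂ _,_ (mat-! P₁ i j) (mat-! P₂ i j)) (cong₂ _,_ (mat-! P₃ i j) (mat-! P₄ i j))))))

  Span₄⇐ : ∀ {P₁ P₂ P₃ P₄ S} s₁ s₂ s₃ s₄ → (∀ i j →
           mat S ! i ! j ≡ sum₄ s₁ s₂ s₃ s₄ (mat P₁ ! i ! j) (mat P₂ ! i ! j) (mat P₃ ! i ! j) (mat P₄ ! i ! j)) →
           Span F (P₁ ∷ P₂ ∷ P₃ ∷ P₄ ∷ []) S
  Span₄⇐ {P₁} {P₂} {P₃} {P₄} {S} s₁ s₂ s₃ s₄ e = (ψ s₁ ∷ ψ s₂ ∷ ψ s₃ ∷ ψ s₄ ∷ []) , positions λ i j → φ-injective
    (trans (sym (mat-! S i j)) (trans (e i j) (sym (trans (φ-sum₄ _ _ _ _ _ _ _ _)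
      (trans (cong₂ (λ (w , x) (y , z) → sum₄ w x y z (φ (coord P₁ (combine i j))) (φ (coord P₂ (combine i j))) (φ (coord P₃ (combine i j))) (φ (coord P₄ (combine i j))))
        (cong₂ _,_ (φψ s₁) (φψ s₂)) (cong₂ _,_ (φψ s₃) (φψ s₄)))
      (sym (cong₂ (λ (w , x) (y , z) → sum₄ s₁ s₂ s₃ s₄ w x y z)
        (cong₂ _,_ (mat-! P₁ i j) (mat-! P₂ i j)) (cong₂ _,_ (mat-! P₃ i j) (mat-! P₄ i j)))))))))

  ∼⇒ : ∀ {P R} → _∼_ F P R → ∃ λ t → t ≢ 0# × mat P ≡ scaleM t (mat R)
  ∼⇒ {P} {R} (t , t≉0 , e) = φ t , (λ e → t≉0 (φ-injective e)) , M-ext {mat P} {scaleM (φ t) (mat R)} λ i j →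
    trans (mat-! P i j) (trans (φ-cong (e (combine i j))) (trans (φ-* t _)
      (sym (trans (scaleM-! (φ t) (mat R) i j) (cong (φ t ⊛_) (mat-! R i j))))))

  ∼⇐ : ∀ {P R} t → t ≢ 0# → mat P ≡ scaleM t (mat R) → _∼_ F P R
  ∼⇐ {P} {R} t t≢0 e = ψ t , (λ h → t≢0 (trans (sym (φψ t)) (φ-cong h))) , positions λ i j → φ-injective
    (trans (sym (mat-! P i j)) (trans (cong (λ M → M ! i ! j) e) (trans (scaleM-! t (mat R) i j)
      (sym (trans (φ-* (ψ t) _) (cong₂ _⊛_ (φψ t) (sym (mat-! R i j))))))))

  -- A combination of the two endpoints may be `O`, which is not a point of the line; as `𝟎 ⊗ 𝟎` it
  -- still has the required shape.
  Γ-combination : ∀ {l} → ΓLine F l → ∀ s t → ∃₂ λ e f → lin s t (mat (pt₁ l)) (mat (pt₂ l)) ≡ outer e f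
  Γ-combination {l} Γl s t = by-cases (N ≟ O)
    where
    N = lin s t (mat (pt₁ l)) (mat (pt₂ l))
    by-cases : Dec (N ≡ O) → ∃₂ λ e f → N ≡ outer e f
    by-cases (yes N≡O) = 𝟎 , 𝟎 , trans N≡O (sym (outer-𝟎 𝟎))
    by-cases (no N≢O)  = let R = point N N≢O ; e , f , eq = Segre⇒ R (proj₂ (Γl {R} (Span₂⇐ {pt₁ l} {pt₂ l} {R} s t (mat-point N N≢O)))) in
      e , f , trans (sym (mat-point N N≢O)) eq

  lin-10 : ∀ M N → M ≡ lin 1# 0# M N
  lin-10 M N = M-ext {M} {lin 1# 0# M N} λ i j → trans
    (solve 2 (λ m n → m := 1ₚ :* m :+ 0ₚ :* n) refl (M ! i ! j) (N ! i ! j)) (sym (lin-! 1# 0# M N i j))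

  lin-01 : ∀ M N → N ≡ lin 0# 1# M N
  lin-01 M N = M-ext {N} {lin 0# 1# M N} λ i j → trans
    (solve 2 (λ m n → n := 0ₚ :* m :+ 1ₚ :* n) refl (M ! i ! j) (N ! i ! j)) (sym (lin-! 0# 1# M N i j))

  -- The sum of `x` and `R` is again a combination of the endpoints of `l`, hence of rank at most
  -- one, as `line-point-tangent` demands.
  Γ-endpoint : ∀ {l a b x R} → ΓLine F l → x ∈ pointsOf F l → mat x ≡ outer a b →
               (∃₂ λ s t → mat R ≡ lin s t (mat (pt₁ l)) (mat (pt₂ l))) → Tangent a b (mat R)
  Γ-endpoint {l} {a} {b} {x} {R} Γl x∈l x≡ (s , t , R≡) = subst (Tangent a b) (sym (proj₂ (proj₂ cd)))
    (line-point-tangent {a} {b} {proj₁ cd} {proj₁ (proj₂ cd)} {proj₁ ef} {proj₁ (proj₂ ef)}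
      (λ e → mat≢O x (trans x≡ e))
      (trans (sym (cong₂ (lin 1# 1#) x≡ (proj₂ (proj₂ cd)))) (trans sum≡ (proj₂ (proj₂ ef))))
      (trans (sym (cong trace (proj₂ (proj₂ cd)))) (Π⇒ R (proj₁ RΓ))))
    where
    RΓ : ΓPoint F R
    RΓ = Γl {R} (Span₂⇐ {pt₁ l} {pt₂ l} {R} s t R≡)
    cd : ∃₂ λ c d → mat R ≡ outer c d
    cd = Segre⇒ R (proj₂ RΓ)
    xs : ∃₂ λ s t → mat x ≡ lin s t (mat (pt₁ l)) (mat (pt₂ l))
    xs = Span₂⇒ {pt₁ l} {pt₂ l} {x} x∈l
    s′ t′ : K
    s′ = proj₁ xs
    t′ = proj₁ (proj₂ xs)
    ef : ∃₂ λ e f → lin (s′ + s) (t′ + t) (mat (pt₁ l)) (mat (pt₂ l)) ≡ outer e f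
    ef = Γ-combination {l} (λ {R} → Γl {R}) (s′ + s) (t′ + t)
    M N : Mat K
    M = mat (pt₁ l)
    N = mat (pt₂ l)
    sum≡ : lin 1# 1# (mat x) (mat R) ≡ lin (s′ + s) (t′ + t) M N
    sum≡ = M-ext {lin 1# 1# (mat x) (mat R)} {lin (s′ + s) (t′ + t) M N} λ i j → begin
      lin 1# 1# (mat x) (mat R) ! i ! j
        ≡⟨ lin-! 1# 1# (mat x) (mat R) i j ⟩
      1# * mat x ! i ! j + 1# * mat R ! i ! j
        ≡⟨ cong₂ (λ u v → 1# * u + 1# * v) (trans (cong (λ M → M ! i ! j) (proj₂ (proj₂ xs))) (lin-! s′ t′ M N i j))
                                           (trans (cong (λ M → M ! i ! j) R≡) (lin-! s t M N i j)) ⟩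
      1# * (s′ * M ! i ! j + t′ * N ! i ! j) + 1# * (s * M ! i ! j + t * N ! i ! j)
        ≡⟨ solve 6 (λ s′ t′ s t m n → 1ₚ :* (s′ :* m :+ t′ :* n) :+ 1ₚ :* (s :* m :+ t :* n) := (s′ :+ s) :* m :+ (t′ :+ t) :* n)
             refl s′ t′ s t (M ! i ! j) (N ! i ! j) ⟩
      (s′ + s) * M ! i ! j + (t′ + t) * N ! i ! j
        ≡⟨ sym (lin-! (s′ + s) (t′ + t) M N i j) ⟩
      lin (s′ + s) (t′ + t) M N ! i ! j ∎

  -- All four spanning points lie on lines of Γ through `x`, so each is tangent at `x = a ⊗ b`.
  -- Tangency is preserved by linear combinations and implies nilpotency.
  𝒪⇒nil : ∀ P → P ∈ 𝒪 F → Nil (mat P)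
  𝒪⇒nil P (x , (Πx , Sx) , l , l′ , (Γl , x∈l) , (Γl′ , x∈l′) , _ , P∈) =
    tangent-nil {a} {b} {mat P} b·a (subst (Tangent a b) (sym P≡)
      (tangent-lin {a} {b} {lin s₁ s₂ M₁ M₂} {lin s₃ s₄ M₃ M₄} 1# 1#
        (tangent-lin {a} {b} {M₁} {M₂} s₁ s₂ (Γ-endpoint {l} {a} {b} {x} {pt₁ l} (λ {R} → Γl {R}) x∈l x≡ (1# , 0# , lin-10 M₁ M₂)) (Γ-endpoint {l} {a} {b} {x} {pt₂ l} (λ {R} → Γl {R}) x∈l x≡ (0# , 1# , lin-01 M₁ M₂)))
        (tangent-lin {a} {b} {M₃} {M₄} s₃ s₄ (Γ-endpoint {l′} {a} {b} {x} {pt₁ l′} (λ {R} → Γl′ {R}) x∈l′ x≡ (1# , 0# , lin-10 M₃ M₄)) (Γ-endpoint {l′} {a} {b} {x} {pt₂ l′} (λ {R} → Γl′ {R}) x∈l′ x≡ (0# , 1# , lin-01 M₃ M₄)))))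
    where
    ab = Segre⇒ x Sx
    a b : V K
    a = proj₁ ab
    b = proj₁ (proj₂ ab)
    x≡ : mat x ≡ outer a b
    x≡ = proj₂ (proj₂ ab)
    b·a : dot b a ≡ 0#
    b·a = trans (sym (trace-outer a b)) (trans (cong trace (sym x≡)) (Π⇒ x Πx))
    M₁ M₂ M₃ M₄ : Mat K
    M₁ = mat (pt₁ l)
    M₂ = mat (pt₂ l)
    M₃ = mat (pt₁ l′)
    M₄ = mat (pt₂ l′)
    span = Span₄⇒ {pt₁ l} {pt₂ l} {pt₁ l′} {pt₂ l′} {P} P∈
    s₁ s₂ s₃ s₄ : K
    s₁ = proj₁ span
    s₂ = proj₁ (proj₂ span)
    s₃ = proj₁ (proj₂ (proj₂ span))
    s₄ = proj₁ (proj₂ (proj₂ (proj₂ span)))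
    P≡ : mat P ≡ lin 1# 1# (lin s₁ s₂ M₁ M₂) (lin s₃ s₄ M₃ M₄)
    P≡ = M-ext {mat P} {lin 1# 1# (lin s₁ s₂ M₁ M₂) (lin s₃ s₄ M₃ M₄)} λ i j → begin
      mat P ! i ! j
        ≡⟨ proj₂ (proj₂ (proj₂ (proj₂ span))) i j ⟩
      sum₄ s₁ s₂ s₃ s₄ (M₁ ! i ! j) (M₂ ! i ! j) (M₃ ! i ! j) (M₄ ! i ! j)
        ≡⟨ solve 8 (λ s₁ s₂ s₃ s₄ m₁ m₂ m₃ m₄ → s₁ :* m₁ :+ (s₂ :* m₂ :+ (s₃ :* m₃ :+ (s₄ :* m₄ :+ 0ₚ))) :=
             1ₚ :* (s₁ :* m₁ :+ s₂ :* m₂) :+ 1ₚ :* (s₃ :* m₃ :+ s₄ :* m₄)) refl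
             s₁ s₂ s₃ s₄ (M₁ ! i ! j) (M₂ ! i ! j) (M₃ ! i ! j) (M₄ ! i ! j) ⟩
      1# * (s₁ * M₁ ! i ! j + s₂ * M₂ ! i ! j) + 1# * (s₃ * M₃ ! i ! j + s₄ * M₄ ! i ! j)
        ≡⟨ sym (trans (lin-! 1# 1# (lin s₁ s₂ M₁ M₂) (lin s₃ s₄ M₃ M₄) i j)
             (cong₂ (λ u v → 1# * u + 1# * v) (lin-! s₁ s₂ M₁ M₂ i j) (lin-! s₃ s₄ M₃ M₄ i j))) ⟩
      lin 1# 1# (lin s₁ s₂ M₁ M₂) (lin s₃ s₄ M₃ M₄) ! i ! j ∎

  outer-nonzero : ∀ {a b} → a ≢ 𝟎 → b ≢ 𝟎 → outer a b ≢ O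
  outer-nonzero {a} {b} a≢𝟎 b≢𝟎 e =
    let i , aᵢ≢0 = nonzero-entry {a} a≢𝟎 ; j , bⱼ≢0 = nonzero-entry {b} b≢𝟎 in
    *-nonzero aᵢ≢0 bⱼ≢0 (trans (sym (outer-! a b i j)) (trans (cong (λ M → M ! i ! j) e) (O-! i j)))

  scaleM-outer : ∀ t a b → scaleM t (outer a b) ≡ outer a (scale t b)
  scaleM-outer t a b = M-ext {scaleM t (outer a b)} {outer a (scale t b)} λ i j → begin
    scaleM t (outer a b) ! i ! j     ≡⟨ trans (scaleM-! t (outer a b) i j) (cong (t *_) (outer-! a b i j)) ⟩
    t * (a ! i * b ! j)              ≡⟨ solve 3 (λ t a b → t :* (a :* b) := a :* (t :* b)) refl t (a ! i) (b ! j) ⟩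
    a ! i * (t * b ! j)              ≡⟨ sym (trans (outer-! a (scale t b) i j) (cong (a ! i *_) (scale-! t b j))) ⟩
    outer a (scale t b) ! i ! j      ∎

  lin-outerʳ : ∀ s t a b b′ → lin s t (outer a b) (outer a b′) ≡ outer a (comb s t b b′)
  lin-outerʳ s t a b b′ = M-ext {lin s t (outer a b) (outer a b′)} {outer a (comb s t b b′)} λ i j → begin
    lin s t (outer a b) (outer a b′) ! i ! j
      ≡⟨ trans (lin-! s t (outer a b) (outer a b′) i j) (cong₂ (λ x y → s * x + t * y) (outer-! a b i j) (outer-! a b′ i j)) ⟩
    s * (a ! i * b ! j) + t * (a ! i * b′ ! j)
      ≡⟨ solve 5 (λ s t a b c → s :* (a :* b) :+ t :* (a :* c) := a :* (s :* b :+ t :* c)) refl s t (a ! i) (b ! j) (b′ ! j) ⟩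
    a ! i * (s * b ! j + t * b′ ! j)
      ≡⟨ sym (trans (outer-! a (comb s t b b′) i j) (cong (a ! i *_) (comb-! s t b b′ j))) ⟩
    outer a (comb s t b b′) ! i ! j ∎

  lin-outerˡ : ∀ s t a a′ b → lin s t (outer a b) (outer a′ b) ≡ outer (comb s t a a′) b
  lin-outerˡ s t a a′ b = M-ext {lin s t (outer a b) (outer a′ b)} {outer (comb s t a a′) b} λ i j → begin
    lin s t (outer a b) (outer a′ b) ! i ! j
      ≡⟨ trans (lin-! s t (outer a b) (outer a′ b) i j) (cong₂ (λ x y → s * x + t * y) (outer-! a b i j) (outer-! a′ b i j)) ⟩
    s * (a ! i * b ! j) + t * (a′ ! i * b ! j)
      ≡⟨ solve 5 (λ s t a b c → s :* (a :* b) :+ t :* (c :* b) := (s :* a :+ t :* c) :* b) refl s t (a ! i) (b ! j) (a′ ! i) ⟩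
    (s * a ! i + t * a′ ! i) * b ! j
      ≡⟨ sym (trans (outer-! (comb s t a a′) b i j) (cong (_* b ! j) (comb-! s t a a′ i))) ⟩
    outer (comb s t a a′) b ! i ! j ∎

  scaleM-1 : ∀ M → scaleM 1# M ≡ M
  scaleM-1 M = M-ext {scaleM 1# M} {M} λ i j → trans (scaleM-! 1# M i j) (*-identityˡ _)

  -- A plane of the hexagon through a given nilpotent matrix.

  module FlagPlane (P : Point F 8) (fl : Flag (mat P)) where
    open Flag fl
    open FlagProperties fl

    h₁≢𝟎 : h₁ ≢ 𝟎
    h₁≢𝟎 e = 1≢0 (trans (sym h₁·g₁) (trans (cong (λ h → dot h g₁) e) (dot-𝟎ˡ g₁)))

    h₂≢𝟎 : h₂ ≢ 𝟎
    h₂≢𝟎 e = 1≢0 (trans (sym h₂·g₂) (trans (cong (λ h → dot h g₂) e) (dot-𝟎ˡ g₂)))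

    b·g₁ : dot b g₁ ≡ k₁
    b·g₁ = trans (dot-b g₁) (trans (cong₂ (λ x y → k₁ * x + k₂ * y) h₁·g₁ h₂·g₁)
      (solve 2 (λ x y → x :* 1ₚ :+ y :* 0ₚ := x) refl k₁ k₂))

    b·g₂ : dot b g₂ ≡ k₂
    b·g₂ = trans (dot-b g₂) (trans (cong₂ (λ x y → k₁ * x + k₂ * y) h₁·g₂ h₂·g₂)
      (solve 2 (λ x y → x :* 0ₚ :+ y :* 1ₚ := y) refl k₁ k₂))

    b≢𝟎 : b ≢ 𝟎
    b≢𝟎 e = k≢0 (trans (sym b·g₁) (trans (cong (λ h → dot h g₁) e) (dot-𝟎ˡ g₁)) ,
                trans (sym b·g₂) (trans (cong (λ h → dot h g₂) e) (dot-𝟎ˡ g₂)))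

    v≢𝟎 : v ≢ 𝟎
    v≢𝟎 e = 1≢0 (v-free 1# (zero h₁) (zero h₂))
      where
      zero : ∀ h → 1# * dot h v ≡ 0#
      zero h = trans (*-identityˡ _) (trans (cong (dot h) e) (dot-𝟎 h))

    -- Compare a column where `b` is nonzero and pair it with `h₁` and `h₂`: the side with `a`
    -- vanishes, and `v-free` applies to the other.
    v∦a : ∀ s w → outer a w ≡ scaleM s (outer v b) → s ≡ 0#
    v∦a s w e = v-free s (zero h₁ h₁·a) (zero h₂ h₂·a)
      where
      j = proj₁ (nonzero-entry {b} b≢𝟎)
      e-j = λ i → trans (sym (outer-! a w i j)) (trans (cong (λ M → M ! i ! j) e)
              (trans (scaleM-! s (outer v b) i j) (cong (s *_) (outer-! v b i j))))
      scaled : scale (w ! j) a ≡ scale (s * b ! j) v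
      scaled = V-ext {u = scale (w ! j) a} {v = scale (s * b ! j) v} λ i → begin
        scale (w ! j) a ! i          ≡⟨ trans (scale-! (w ! j) a i) (*-comm (w ! j) (a ! i)) ⟩
        a ! i * w ! j                ≡⟨ e-j i ⟩
        s * (v ! i * b ! j)          ≡⟨ solve 3 (λ s v b → s :* (v :* b) := s :* b :* v) refl s (v ! i) (b ! j) ⟩
        (s * b ! j) * v ! i          ≡⟨ sym (scale-! (s * b ! j) v i) ⟩
        scale (s * b ! j) v ! i      ∎
      zero : ∀ h → dot h a ≡ 0# → s * dot h v ≡ 0#
      zero h h·a = *-cancel₀ (proj₂ (nonzero-entry {b} b≢𝟎)) (begin
        b ! j * (s * dot h v)            ≡⟨ solve 3 (λ b s x → b :* (s :* x) := s :* b :* x) refl (b ! j) s (dot h v) ⟩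
        (s * b ! j) * dot h v            ≡⟨ cong ((s * b ! j) *_) (dot-comm h v) ⟩
        (s * b ! j) * dot v h            ≡⟨ sym (dot-scaleˡ (s * b ! j) v h) ⟩
        dot (scale (s * b ! j) v) h      ≡⟨ cong (λ u → dot u h) (sym scaled) ⟩
        dot (scale (w ! j) a) h          ≡⟨ dot-scaleˡ (w ! j) a h ⟩
        w ! j * dot a h                  ≡⟨ cong (w ! j *_) (trans (dot-comm a h) h·a) ⟩
        w ! j * 0#                       ≡⟨ zeroʳ _ ⟩
        0#                               ∎)

    -- `R₁` and `R₂` span the line of Γ with left factor `a`; `X` and `Y` span the one with right
    -- factor `b`. The lines meet in `X = a ⊗ b`.
    R₁ R₂ X Y : Point F 8
    R₁ = point (outer a h₁) (outer-nonzero {a} {h₁} a≢𝟎 h₁≢𝟎)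
    R₂ = point (outer a h₂) (outer-nonzero {a} {h₂} a≢𝟎 h₂≢𝟎)
    X  = point (outer a b) (outer-nonzero {a} {b} a≢𝟎 b≢𝟎)
    Y  = point (outer v b) (outer-nonzero {v} {b} v≢𝟎 b≢𝟎)

    mat-R₁ : mat R₁ ≡ outer a h₁
    mat-R₁ = mat-point (outer a h₁) (outer-nonzero {a} {h₁} a≢𝟎 h₁≢𝟎)
    mat-R₂ : mat R₂ ≡ outer a h₂
    mat-R₂ = mat-point (outer a h₂) (outer-nonzero {a} {h₂} a≢𝟎 h₂≢𝟎)
    mat-X : mat X ≡ outer a b
    mat-X = mat-point (outer a b) (outer-nonzero {a} {b} a≢𝟎 b≢𝟎)
    mat-Y : mat Y ≡ outer v b
    mat-Y = mat-point (outer v b) (outer-nonzero {v} {b} v≢𝟎 b≢𝟎)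

    l l′ : Line F 8
    l = record { pt₁ = R₁ ; pt₂ = R₂ ; distinct = λ R₁∼R₂ → apart (∼⇒ {R₁} {R₂} R₁∼R₂) }
      where
      apart : (∃ λ s → s ≢ 0# × mat R₁ ≡ scaleM s (mat R₂)) → ⊥
      apart (s , _ , e) = *-nonzero (proj₂ (nonzero-entry {a} a≢𝟎)) 1≢0 (begin
        a ! i * 1#                 ≡⟨ cong (a ! i *_) (sym h₁·g₁) ⟩
        a ! i * dot h₁ g₁          ≡⟨ at h₁ ⟩
        apply (outer a h₁) g₁ ! i  ≡⟨ cong (λ M → apply M g₁ ! i) (trans (sym mat-R₁) (trans e (trans (cong (scaleM s) mat-R₂) (scaleM-outer s a h₂)))) ⟩
        apply (outer a (scale s h₂)) g₁ ! i ≡⟨ sym (at (scale s h₂)) ⟩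
        a ! i * dot (scale s h₂) g₁   ≡⟨ cong (a ! i *_) (trans (dot-scaleˡ s h₂ g₁) (trans (cong (s *_) h₂·g₁) (zeroʳ s))) ⟩
        a ! i * 0#                 ≡⟨ zeroʳ _ ⟩
        0# ∎)
        where
        i = proj₁ (nonzero-entry {a} a≢𝟎)
        at : ∀ h → a ! i * dot h g₁ ≡ apply (outer a h) g₁ ! i
        at h = trans (*-comm (a ! i) (dot h g₁)) (sym (trans (cong (_! i) (apply-outer a h g₁)) (scale-! (dot h g₁) a i)))
    l′ = record { pt₁ = X ; pt₂ = Y ; distinct = λ X∼Y → apart (∼⇒ {X} {Y} X∼Y) }
      where
      apart : (∃ λ s → s ≢ 0# × mat X ≡ scaleM s (mat Y)) → ⊥
      apart (s , s≢0 , e) = s≢0 (v∦a s b (trans (sym mat-X) (trans e (cong (scaleM s) mat-Y))))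

    Γ-point : ∀ {R} u w → mat R ≡ outer u w → dot w u ≡ 0# → ΓPoint F R
    Γ-point {R} u w e e′ = Π⇐ R (trans (cong trace e) (trans (trace-outer u w) e′)) , Segre⇐ R u w e

    Γl : ΓLine F l
    Γl {R} R∈ = let s , t , e = Span₂⇒ {R₁} {R₂} {R} R∈ in
      Γ-point {R} a (comb s t h₁ h₂) (trans e (trans (cong₂ (lin s t) mat-R₁ mat-R₂) (lin-outerʳ s t a h₁ h₂)))
        (trans (dot-comb s t h₁ h₂ a) (zero-comb s t h₁·a h₂·a))

    Γl′ : ΓLine F l′
    Γl′ {R} R∈ = let s , t , e = Span₂⇒ {X} {Y} {R} R∈ in
      Γ-point {R} (comb s t a v) b (trans e (trans (cong₂ (lin s t) mat-X mat-Y) (lin-outerˡ s t a v b)))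
        (trans (dot-comm b (comb s t a v)) (trans (dot-comb s t a v b) (zero-comb s t (trans (dot-comm a b) b·a) (trans (dot-comm v b) b·v))))

    X∈l : X ∈ pointsOf F l
    X∈l = Span₂⇐ {R₁} {R₂} {X} k₁ k₂ (trans mat-X (sym (trans (cong₂ (lin k₁ k₂) mat-R₁ mat-R₂) (lin-outerʳ k₁ k₂ a h₁ h₂))))

    X∈l′ : X ∈ pointsOf F l′
    X∈l′ = Span₂⇐ {X} {Y} {X} 1# 0# (lin-10 (mat X) (mat Y))

    Y∈l′ : Y ∈ pointsOf F l′
    Y∈l′ = Span₂⇐ {X} {Y} {Y} 0# 1# (lin-01 (mat X) (mat Y))

    Y∉l : ¬ (Y ∈ pointsOf F l)
    Y∉l Y∈l = let s , t , e = Span₂⇒ {R₁} {R₂} {Y} Y∈l in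
      1≢0 (v∦a 1# (comb s t h₁ h₂) (sym (trans (scaleM-1 (outer v b))
        (trans (sym mat-Y) (trans e (trans (cong₂ (lin s t) mat-R₁ mat-R₂) (lin-outerʳ s t a h₁ h₂)))))))

    P∈𝒪 : P ∈ 𝒪 F
    P∈𝒪 = X , Γ-point {X} a b mat-X b·a , l , l′ , ((λ {R} → Γl {R}) , X∈l) , ((λ {R} → Γl′ {R}) , X∈l′) ,
      (λ (_ , l′⊆l) → Y∉l (l′⊆l {Y} Y∈l′)) ,
      -- `X` gets coefficient 0, since it is already a combination of `R₁` and `R₂`; it is listed
      -- only as an endpoint of the second line.
      Span₄⇐ {R₁} {R₂} {X} {Y} {P} c d 0# t λ i j → trans (decomposition i j)
        (sym (cong₂ (λ (w , x) (y , z) → sum₄ c d 0# t (w ! i ! j) (x ! i ! j) (y ! i ! j) (z ! i ! j))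
          (cong₂ _,_ mat-R₁ mat-R₂) (cong₂ _,_ mat-X mat-Y)))

  nil⇒𝒪 : ∀ P → Nil (mat P) → P ∈ 𝒪 F
  nil⇒𝒪 P nil = FlagPlane.P∈𝒪 P (nil⇒flag nil (mat≢O P))

  -- Collinearity on the quadric as vanishing of a trace.

  -- Exhibits the polar form as `tr (M N) - tr M tr N`. It is the mixed coefficient itself, with no
  -- division by 2, and on traceless matrices it is `tr (M N)`.
  quad-lin : ∀ s t M N → quad (lin s t M N) ≡
             (s * s) * quad M + ((t * t) * quad N + (s * t) * (trace (M · N) - trace M * trace N))
  quad-lin s t M N = prove (entries N (s ∷ᵥ t ∷ᵥ entries M []ᵥ))
    (Sym.quad (zipV (zipV (λ x y → aₚ :* x :+ bₚ :* y)) Pₚ Nₚ))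
    (aₚ :* aₚ :* Sym.quad Pₚ :+ (bₚ :* bₚ :* Sym.quad Nₚ :+ aₚ :* bₚ :* (Sym.trace (Pₚ Sym.· Nₚ) :- Sym.trace Pₚ :* Sym.trace Nₚ))) refl

  trace-lin : ∀ s t M N → trace (lin s t M N) ≡ s * trace M + t * trace N
  trace-lin s t M N = prove (entries N (s ∷ᵥ t ∷ᵥ entries M []ᵥ))
    (Sym.trace (zipV (zipV (λ x y → aₚ :* x :+ bₚ :* y)) Pₚ Nₚ)) (aₚ :* Sym.trace Pₚ :+ bₚ :* Sym.trace Nₚ) refl

  quad-O : quad O ≡ 0#
  quad-O = prove []ᵥ (Sym.quad (Sym.𝟎 , Sym.𝟎 , Sym.𝟎)) 0ₚ refl

  Q⁺₇⇒ : ∀ {P} → P ∈ Q⁺₇ F → trace (mat P) ≡ 0# × quad (mat P) ≡ 0#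
  Q⁺₇⇒ {P} (Πp , Qp) = Π⇒ P Πp , Q₈⇒ P Qp

  Q⁺₇⇐ : ∀ {P} → trace (mat P) ≡ 0# → quad (mat P) ≡ 0# → P ∈ Q⁺₇ F
  Q⁺₇⇐ {P} e₁ e₂ = Π⇐ P e₁ , Q₈⇐ P e₂

  module _ {P R : Point F 8} (P∈ : P ∈ Q⁺₇ F) (R∈ : R ∈ Q⁺₇ F) where

    private
      M N : Mat K
      M = mat P
      N = mat R
      traces : trace M * trace N ≡ 0#
      traces = trans (cong (_* trace N) (proj₁ (Q⁺₇⇒ {P} P∈))) (zeroˡ _)
      quad-span : ∀ s t → quad (lin s t M N) ≡ (s * t) * trace (M · N)
      quad-span s t = begin
        quad (lin s t M N)
          ≡⟨ quad-lin s t M N ⟩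
        (s * s) * quad M + ((t * t) * quad N + (s * t) * (trace (M · N) - trace M * trace N))
          ≡⟨ cong₂ (λ (x , y) z → (s * s) * x + ((t * t) * y + (s * t) * (trace (M · N) - z)))
               (cong₂ _,_ (proj₂ (Q⁺₇⇒ {P} P∈)) (proj₂ (Q⁺₇⇒ {R} R∈))) traces ⟩
        (s * s) * 0# + ((t * t) * 0# + (s * t) * (trace (M · N) - 0#))
          ≡⟨ solve 3 (λ s t x → s :* s :* 0ₚ :+ (t :* t :* 0ₚ :+ s :* t :* (x :- 0ₚ)) := s :* t :* x) refl s t (trace (M · N)) ⟩
        (s * t) * trace (M · N) ∎

    -- The single combination `M + N` is tested, where `quad` equals the polar form. If the sum is
    -- `O` it is not a point of the span, but `quad` vanishes there anyway.
    collinear⇒ : (∀ {S} → Span F (P ∷ R ∷ []) S → S ∈ Q⁺₇ F) → trace (M · N) ≡ 0#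
    collinear⇒ span⊆ = trans (solve 1 (λ x → x := 1ₚ :* 1ₚ :* x) refl (trace (M · N)))
      (trans (sym (quad-span 1# 1#)) (by-cases (lin 1# 1# M N ≟ O)))
      where
      by-cases : Dec (lin 1# 1# M N ≡ O) → quad (lin 1# 1# M N) ≡ 0#
      by-cases (yes e) = trans (cong quad e) quad-O
      by-cases (no ne) = let S = point (lin 1# 1# M N) ne ; S≡ = mat-point (lin 1# 1# M N) ne in
        trans (cong quad (sym S≡)) (proj₂ (Q⁺₇⇒ {S} (span⊆ {S} (Span₂⇐ {P} {R} {S} 1# 1# S≡))))

    collinear⇐ : trace (M · N) ≡ 0# → ∀ {S} → Span F (P ∷ R ∷ []) S → S ∈ Q⁺₇ F
    collinear⇐ e {S} S∈ = let s , t , S≡ = Span₂⇒ {P} {R} {S} S∈ in Q⁺₇⇐ {S}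
      (trans (cong trace S≡) (trans (trace-lin s t M N) (zero-comb s t (proj₁ (Q⁺₇⇒ {P} P∈)) (proj₁ (Q⁺₇⇒ {R} R∈)))))
      (trans (cong quad S≡) (trans (quad-span s t) (trans (cong ((s * t) *_) e) (zeroʳ _))))

  Represents : Mat K → Mat K → Set
  Represents M N = Nil N × trace (M · N) ≡ 0#

  module _ {P : Point F 8} (P∈ : P ∈ Q⁺₇ F) where

    member⇒ : ∀ R → R ∈ (_^⊥[_] F P (Q⁺₇ F) ∩ 𝒪 F) → Represents (mat P) (mat R)
    member⇒ R ((R∈ , span⊆) , R∈𝒪) = 𝒪⇒nil R R∈𝒪 , collinear⇒ {P} {R} P∈ R∈ (λ {S} → span⊆ {S})

    member⇐ : ∀ R → Represents (mat P) (mat R) → R ∈ (_^⊥[_] F P (Q⁺₇ F) ∩ 𝒪 F)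
    member⇐ R (nil@(tr₀ , quad₀ , _) , e) = (R∈ , λ {S} → collinear⇐ {P} {R} P∈ R∈ e {S}) , nil⇒𝒪 R nil
      where
      R∈ : R ∈ Q⁺₇ F
      R∈ = Q⁺₇⇐ {R} tr₀ quad₀

  represents-scale : ∀ t {M N} → Represents M N → Represents M (scaleM t N)
  represents-scale t {M} {N} ((a , b , c) , d) =
    (zero (trace-scale t N) a , zero (quad-scale t N) b , zero (det-scale t N) c) , zero (perp-scale t M N) d
    where
    zero : ∀ {x y z} → x ≡ y * z → z ≡ 0# → x ≡ 0#
    zero {y = y} e e′ = trans e (trans (cong (y *_) e′) (zeroʳ y))

  scaleM-* : ∀ s t M → scaleM s (scaleM t M) ≡ scaleM (s * t) M
  scaleM-* s t M = M-ext {scaleM s (scaleM t M)} {scaleM (s * t) M} λ i j →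
    trans (scaleM-! s (scaleM t M) i j) (trans (cong (s *_) (scaleM-! t M i j))
      (trans (sym (*-assoc s t _)) (sym (scaleM-! (s * t) M i j))))

  normalised-unique : ∀ {M N t} → t ≢ 0# → M ≡ scaleM t N → Normalised M → Normalised N → M ≡ N
  normalised-unique {M} {N} {t} t≢0 M≡ M₁ N₁ = trans M≡ (trans (cong (λ t → scaleM t N) t≡1) (scaleM-1 N))
    where
    t≡1 : t ≡ 1#
    t≡1 = begin
      t                     ≡⟨ solve 1 (λ t → t := t :* 1ₚ) refl t ⟩
      t * 1#                ≡⟨ cong (t *_) (sym N₁) ⟩
      t * leading N         ≡⟨ sym (leading-scale t≢0 N) ⟩
      leading (scaleM t N)  ≡⟨ cong leading (sym M≡) ⟩
      leading M             ≡⟨ M₁ ⟩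
      1#                    ∎

  normalised≢O : ∀ {N} → Normalised N → N ≢ O
  normalised≢O N₁ refl = 1≢0 (trans (sym N₁) leading-O)

  -- Sizes of the perpendicular sets and the ovoid property.

  factor : Point F 8 → K
  factor R = inv (leading (mat R))

  factor≢0 : ∀ R → factor R ≢ 0#
  factor≢0 R = inv≢0 (mat≢O R ∘ leading≡0 (mat R))

  normalForm : Point F 8 → Mat K
  normalForm R = scaleM (factor R) (mat R)

  normalForm-normalised : ∀ R → Normalised (normalForm R)
  normalForm-normalised R = trans (leading-scale (factor≢0 R) (mat R))
    (trans (*-comm (factor R) (leading (mat R))) (inv-r (mat≢O R ∘ leading≡0 (mat R))))

  -- A point goes to the index of its normal form. Scalar multiples have equal normal forms and `at`
  -- is injective, so neither the representative vector nor the membership proof affects the index.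
  hasSize : ∀ {P} → P ∈ Q⁺₇ F → HasSize F (_^⊥[_] F P (Q⁺₇ F) ∩ 𝒪 F) (representatives (mat P))
  hasSize {P} P∈ = record
    { to        = to
    ; from      = from
    ; to-cong   = λ {R} {S} R∼S → to-unique R S R∼S
    ; from-cong = λ { refl → ∼-refl F {P = proj₁ (from _)} }
    ; inverse   = (λ {i} {R} R∼i → to-from i R R∼i) , (λ {R} {i} e → from-to R i e)
    }
    where
    S : Point F 8 → Set _
    S = _^⊥[_] F P (Q⁺₇ F) ∩ 𝒪 F
    enum : Enumeration (λ N → Normalised N × Represents (mat P) N) (representatives (mat P))
    enum = enumeration (λ N → normalised? N ×-dec (nil? N ×-dec perp? (mat P) N))
    open Enumeration enum
    normal : (R : Σ (Point F 8) S) → Normalised (normalForm (proj₁ R)) × Represents (mat P) (normalForm (proj₁ R))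
    normal (R , R∈) = normalForm-normalised R , represents-scale (factor R) {mat P} {mat R} (member⇒ {P} P∈ R R∈)
    to : Σ (Point F 8) S → Fin (representatives (mat P))
    to R = index (normalForm (proj₁ R)) (normal R)
    at-to : ∀ R → at (to R) ≡ normalForm (proj₁ R)
    at-to R = at-index (normalForm (proj₁ R)) (normal R)
    base : Fin (representatives (mat P)) → Point F 8
    base i = point (at i) (normalised≢O {at i} (proj₁ (at-∈ i)))
    mat-base : ∀ i → mat (base i) ≡ at i
    mat-base i = mat-point (at i) (normalised≢O {at i} (proj₁ (at-∈ i)))
    from : Fin (representatives (mat P)) → Σ (Point F 8) S
    from i = base i , member⇐ {P} P∈ (base i) (subst (Represents (mat P)) (sym (mat-base i)) (proj₂ (at-∈ i)))
    to-unique : ∀ (R T : Σ (Point F 8) S) → _∼_ F (proj₁ R) (proj₁ T) → to R ≡ to T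
    to-unique R T R∼T = at-injective (to R) (to T) (trans (at-to R) (trans
      (normalised-unique {normalForm (proj₁ R)} {normalForm (proj₁ T)} {t}
        (*-nonzero (factor≢0 (proj₁ R)) (*-nonzero (proj₁ (proj₂ r)) (unit≢0 {leading (mat (proj₁ T))} {factor (proj₁ T)} (inv-r l≢0))))
        scaled (normalForm-normalised (proj₁ R)) (normalForm-normalised (proj₁ T)))
      (sym (at-to T))))
      where
      r = ∼⇒ {proj₁ R} {proj₁ T} R∼T
      l≢0 : leading (mat (proj₁ T)) ≢ 0#
      l≢0 = mat≢O (proj₁ T) ∘ leading≡0 (mat (proj₁ T))
      -- If the first matrix is `r` times the second, passing between normal forms means undoing the
      -- second factor by its leading entry, multiplying by `r`, and applying the first factor.
      t = factor (proj₁ R) * (proj₁ r * leading (mat (proj₁ T)))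
      scaled : normalForm (proj₁ R) ≡ scaleM t (normalForm (proj₁ T))
      scaled = begin
        scaleM (factor (proj₁ R)) (mat (proj₁ R))
          ≡⟨ cong (scaleM (factor (proj₁ R))) (proj₂ (proj₂ r)) ⟩
        scaleM (factor (proj₁ R)) (scaleM (proj₁ r) (mat (proj₁ T)))
          ≡⟨ scaleM-* (factor (proj₁ R)) (proj₁ r) (mat (proj₁ T)) ⟩
        scaleM (factor (proj₁ R) * proj₁ r) (mat (proj₁ T))
          ≡⟨ cong (λ t → scaleM t (mat (proj₁ T))) (drop₁ (- (factor (proj₁ R) * proj₁ r)) (x≡y⇒x-y≡0 (inv-r l≢0))
               (solve 4 (λ f r l i → f :* r := f :* (r :* l) :* i :+ :- (f :* r) :* (l :* i :- 1ₚ)) refl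
                 (factor (proj₁ R)) (proj₁ r) (leading (mat (proj₁ T))) (factor (proj₁ T)))) ⟩
        scaleM (t * factor (proj₁ T)) (mat (proj₁ T))
          ≡⟨ sym (scaleM-* t (factor (proj₁ T)) (mat (proj₁ T))) ⟩
        scaleM t (normalForm (proj₁ T)) ∎
    to-from : ∀ i (R : Σ (Point F 8) S) → _∼_ F (proj₁ R) (base i) → to R ≡ i
    to-from i R R∼i = at-injective (to R) i (trans (at-to R)
      (normalised-unique {normalForm (proj₁ R)} {at i} {factor (proj₁ R) * proj₁ r}
        (*-nonzero (factor≢0 (proj₁ R)) (proj₁ (proj₂ r)))
        (trans (cong (scaleM (factor (proj₁ R))) (trans (proj₂ (proj₂ r)) (cong (scaleM (proj₁ r)) (mat-base i))))
          (scaleM-* (factor (proj₁ R)) (proj₁ r) (at i)))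
        (normalForm-normalised (proj₁ R)) (proj₁ (at-∈ i))))
      where r = ∼⇒ {proj₁ R} {base i} R∼i
    from-to : ∀ (R : Σ (Point F 8) S) i → i ≡ to R → _∼_ F (base i) (proj₁ R)
    from-to R i e = ∼⇐ {base i} {proj₁ R} (factor (proj₁ R)) (factor≢0 (proj₁ R))
      (trans (mat-base i) (trans (cong at e) (at-to R)))

  ψ-ω : ψ ω F.* (F.- (F.1# F.+ ψ ω)) F.≈ F.1#
  ψ-ω = φ-injective (trans (φ-* _ _) (trans (cong₂ _*_ (φψ ω) (trans (φ-neg _) (cong -_ (trans (φ-+ _ _) (cong (φ F.1# +_) (φψ ω)))))) ω*ω²))

  ψ-δ : (ψ ω F.- (F.- (F.1# F.+ ψ ω))) F.* ψ (inv (ω - ω²)) F.≈ F.1#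
  ψ-δ = φ-injective (trans (φ-* _ _) (trans (cong₂ _*_
    (trans (φ-- _ _) (cong₂ _-_ (φψ ω) (trans (φ-neg _) (cong -_ (trans (φ-+ _ _) (cong (φ F.1# +_) (φψ ω)))))))
    (φψ _)) (inv-r ω≢ω²)))

  isOvoid : IsOvoid F 4 (q ℕ.^ 2 ℕ.+ q ℕ.+ 1) (Q⁺₇ F) (𝒪 F)
  isOvoid = record
    { hyperbolic = HyperbolicForm.hyperbolic F (ψ ω) (ψ (inv (ω - ω²))) ψ-ω ψ-δ
    ; positive   = ℕ.≤-trans (ℕ.s≤s ℕ.z≤n) (ℕ.m≤n+m 1 (q ℕ.^ 2 ℕ.+ q))
    ; subset     = λ {P} P∈𝒪 → let tr₀ , quad₀ , _ = 𝒪⇒nil P P∈𝒪 in Q⁺₇⇐ {P} tr₀ quad₀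
    ; inside     = λ P P∈ P∈𝒪 → subst (HasSize F (_^⊥[_] F P (Q⁺₇ F) ∩ 𝒪 F))
                     (representatives-of-nil (mat P) (𝒪⇒nil P P∈𝒪) (mat≢O P)) (hasSize {P} P∈)
    -- On the quadric the trace and `quad` already vanish, so failure to lie in `𝒪` can only come
    -- from a nonzero determinant.
    ; outside    = λ P P∈ P∉𝒪 → let tr₀ , quad₀ = Q⁺₇⇒ {P} P∈ in subst (HasSize F (_^⊥[_] F P (Q⁺₇ F) ∩ 𝒪 F))
                     (representatives-of-invertible (mat P) tr₀ quad₀ (λ det₀ → P∉𝒪 (nil⇒𝒪 P (tr₀ , quad₀ , det₀)))) (hasSize {P} P∈)
    }

open import Data.Nat.Base using (_+_; _^_; _%_)

theorem3p3 : {c ℓ : Level} (q : ℕ) → PrimePower q → q % 3 ≡ 1 →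
    (F : FiniteField c ℓ q) →
    IsOvoid F 4 (q ^ 2 + q + 1) (Q⁺₇ F) (𝒪 F)
theorem3p3 q _ q%3≡1 F = Quadric.isOvoid q%3≡1 F
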